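{- Let $\mathrm S$ be a dependent type theory with identity types and discrete identity types, and let $p\colon\mathfrak T_{\mathrm S}\to\mathfrak C_{\mathrm S}$ be the $2$-functor from the $2$-category of types-in-context to the $2$-category of contexts of $\mathrm S$ which sends $(\Gamma,A)$ to $\Gamma$. Then $p$ is a globally split $2$-fibration.
   Context: **Type theory.** $\mathrm S$ is a dependent type theory with the four judgement forms $A\ \mathsf{type}$, $a:A$, $A=B\ \mathsf{type}$, $a=b:A$ (the last two are definitional equality), made relative to contexts $\Gamma=(x_1:A_1,\dots,x_n:A_n)$ with each $A_i$ a type in context $(x_1:A_1,\dots,x_{i-1}:A_{i-1})$. It has the equality rules (definitional equality is a congruence) and the structural rules (weakening, contraction, exchange, substitution). Every rule is read relative to an arbitrary ambient context and every operation is stable under substitution in it. Furthermore $\mathrm S$ has: - identity types: from $a,b:A$ form $\mathrm{Id}_A(a,b)$; $\mathrm r(a):\mathrm{Id}_A(a,a)$; from $x,y:A,\,p:\mathrm{Id}_A(x,y),\,\Delta\vdash C(x,y,p)\ \mathsf{type}$ and $x:A,\,\Delta[x,x,\mathrm r(x)/x,y,p]\vdash d(x):C(x,x,\mathrm r(x))$ infer $x,y:A,\,p:\mathrm{Id}_A(x,y),\,\Delta\vdash\mathrm J_d(x,y,p):C(x,y,p)$, with $\mathrm J_d(x,x,\mathrm r(x))=d(x)$; - discrete identity types: if $p,q:\mathrm{Id}_A(a,b)$ and $\alpha:\mathrm{Id}_{\mathrm{Id}_A(a,b)}(p,q)$ then $p=q$ and $\alpha=\mathrm r(p)$ definitionally.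 Vector notation is used: an element $a:\Gamma$ of a context is a list of terms of the successive types, and $x:\Gamma\vdash\Delta(x)\ \mathsf{ctxt}$ denotes a telescope over $\Gamma$. **Identity contexts.** The identity rules extend from types to contexts by induction on length. For a single type, elimination into a context $\Theta=(u:\Lambda,v:D(u))$ is componentwise: from $d=(d_1,d_2)$ form $\mathrm J_{d_1}$, then $\mathrm J_{d_2}$ eliminating into $D(x,y,p,\mathrm J_{d_1}(x,y,p))$. For the empty context, $\mathrm{Id}_{()}=()$ and $\mathrm J_d=d$. For $\Phi=(x:\Lambda,y:D(x))$: transport $p^*(z):\Upsilon(x)$ for $x:\Lambda\vdash\Upsilon(x)\ \mathsf{ctxt}$, $p:\mathrm{Id}_\Lambda(x,x')$, $z:\Upsilon(x')$ is defined by $\mathrm{Id}_\Lambda$-elimination from $\mathrm r(x)^*(z)=z$; $\mathrm{Id}_\Phi((x,y),(x',y')):=(p:\mathrm{Id}_\Lambda(x,x'),\,q:\mathrm{Id}_{D(x)}(y,p^*y'))$; $\mathrm r(x,y):=(\mathrm r(x),\mathrm r(y))$; elimination for $\mathrm{Id}_\Phi$ is obtained by first applying elimination for $\mathrm{Id}_{D(x)}$ to $d$, giving $d'(x,y,y',q)$, and then applying $\mathrm{Id}_\Lambda$-elimination with post-context $(y,y',q)$ to $d'$. **The 2-category $\mathfrak C_{\mathrm S}$.** (All modulo $\alpha$-conversion and definitional equality.) Objects: contexts. 1-cells $\Gamma\to\Delta$: judgements $x:\Gamma\vdash f(x):\Delta$, composed by substitution. 2-cells $f\Rightarrow g$: judgements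 $x:\Gamma\vdash\alpha(x):\mathrm{Id}_\Delta(fx,gx)$. Here $q\circ p$ is defined by elimination on $q$ with $\mathrm r(y)\circ p=p$, and $h^\bullet(p):\mathrm{Id}_\Delta(hx,hy)$ by elimination on $p$ with $h^\bullet(\mathrm r(x))=\mathrm r(hx)$; vertical composition is $\beta(x)\circ\alpha(x)$, identities are $\mathrm r(fx)$, whiskerings are $(\alpha k)(x)=\alpha(kx)$, $(h\alpha)(x)=h^\bullet(\alpha(x))$. It is locally groupoidal. **The 2-category $\mathfrak T_{\mathrm S}$ and the functors $E$, $p$.** Objects: pairs $(\Gamma,A)$ with $\Gamma$ a context and $A$ a type in context $\Gamma$. 1-cells $(\Gamma,A)\to(\Delta,B)$: pairs $(f,g)$ with $f\colon\Gamma\to\Delta$ and $x:\Gamma,y:A(x)\vdash g(x,y):B(fx)$. Let $\Gamma.A=(x:\Gamma,y:A(x))$, $\pi_A\colon\Gamma.A\to\Gamma$ the projection, and $f.g\colon\Gamma.A\to\Delta.B$ the map $(x,y)\mapsto(fx,g(x,y))$. 2-cells $(f,g)\Rightarrow(f',g')$: pairs $(\gamma\colon f.g\Rightarrow f'.g',\ \alpha\colon f\Rightarrow f')$ of 2-cells of $\mathfrak C_{\mathrm S}$ with $\pi_B\gamma=\alpha\pi_A$; compositions as in the arrow 2-category $\mathfrak C_{\mathrm S}^{\mathbf 2}$. The 2-functor $p\colon\mathfrak T_{\mathrm S}\to\mathfrak C_{\mathrm S}$ sends $(\Gamma,A)\mapsto\Gamma$, $(f,g)\mapsto f$, $(\gamma,\alpha)\mapsto\alpha$.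 The chosen cartesian lift of $f\colon\Gamma\to\Delta$ at $(\Delta,B)$ is $(f,\iota)\colon(\Gamma,f^*B)\to(\Delta,B)$, where $f^*B$ is $x:\Gamma\vdash B(fx)\ \mathsf{type}$ and $\iota$ is $x:\Gamma,y:B(fx)\vdash y:B(fx)$. **2-fibrations.** A 2-functor $p\colon\mathbf E\to\mathbf B$ is a *cloven 2-fibration* if: (i) its underlying ordinary functor is a cloven fibration; (ii) each cartesian 1-cell $f\colon y\to z$ has the property that for each 2-cell $\alpha\colon g\Rightarrow h\colon x\to z$ of $\mathbf E$ and each factorisation $p(\alpha)=p(f)\gamma$ with $\gamma\colon k\Rightarrow l\colon p(x)\to p(y)$, there is a unique factorisation $\alpha=f\gamma'$ with $\gamma'\colon k'\Rightarrow l'\colon x\to y$ and $p(\gamma')=\gamma$; (iii) each functor $\mathbf E(x,y)\to\mathbf B(px,py)$ is a cloven fibration of categories; (iv) for each $f\colon x\to y$, the functor $(-)\cdot f\colon\mathbf E(y,z)\to\mathbf E(x,z)$ preserves cartesian liftings of 2-cells. It is *globally split* if the fibration in (i) is split. -}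

module Defs where

open import Data.Fin.Base using (Fin; zero; suc)
open import Data.Nat.Base using (ℕ; zero; suc; _+_)
open import Data.Product.Base using (Σ-syntax; _×_; _,_; proj₁; proj₂)
open import Data.Vec.Base using (Vec; []; _∷_; _++_; lookup; map; tabulate; head)
open import Data.Vec.Properties using (map-cong; map-∘; map-id; map-++; tabulate-∘; tabulate-cong; tabulate∘lookup; lookup∘tabulate)
open import Relation.Binary.PropositionalEquality using (_≡_; refl; sym; trans; cong; cong₂; subst)

-- Raw expressions, modulo α-conversion, in n free variables.  Variable zero is the most recently
-- declared one, so a substitution lists the term for the last variable first.

record RawSyntax : Set₁ where
  infixl 30 _[_]ᵀ _[_] _⊚_
  field
    Ty Tm : ℕ → Set
    var   : ∀ {n} → Fin n → Tm n
    _[_]ᵀ : ∀ {m n} → Ty n → Vec (Tm m) n → Ty m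
    _[_]  : ∀ {m n} → Tm n → Vec (Tm m) n → Tm m

  Sub : ℕ → ℕ → Set
  Sub m n = Vec (Tm m) n

  _⊚_ : ∀ {l m n} → Sub m n → Sub l m → Sub l n
  σ ⊚ τ = map (_[ τ ]) σ

  idₛ : ∀ {n} → Sub n n
  idₛ = tabulate var

  wk : ∀ {n} → Sub (suc n) n
  wk = tabulate (λ i → var (suc i))

  ↑ : ∀ {m n} → Sub m n → Sub (suc m) (suc n)
  ↑ σ = var zero ∷ σ ⊚ wk

  field
    var-[] : ∀ {m n} (i : Fin n) (σ : Sub m n) → var i [ σ ] ≡ lookup σ i
    [id]ᵀ  : ∀ {n} (A : Ty n) → A [ idₛ ]ᵀ ≡ A
    [id]   : ∀ {n} (a : Tm n) → a [ idₛ ] ≡ a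
    [⊚]ᵀ   : ∀ {l m n} (A : Ty n) (σ : Sub m n) (τ : Sub l m) → A [ σ ]ᵀ [ τ ]ᵀ ≡ A [ σ ⊚ τ ]ᵀ
    [⊚]    : ∀ {l m n} (a : Tm n) (σ : Sub m n) (τ : Sub l m) → a [ σ ] [ τ ] ≡ a [ σ ⊚ τ ]

-- Scope extension by k variables, associated so that (suc n) ⊞ k and n ⊞ (suc k) agree.

infixl 6 _⊞_
_⊞_ : ℕ → ℕ → ℕ
n ⊞ zero  = n
n ⊞ suc k = suc n ⊞ k

module Telescopes (L : RawSyntax) where
  open RawSyntax L

  infixl 5 _▹_ _▹▹_
  infixl 5 _⧺_

  data Ctx : ℕ → Set where
    []  : Ctx zero
    _▹_ : ∀ {n} → Ctx n → Ty n → Ctx (suc n)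

  -- Telescopes over a scope of n variables, listed from the first entry (Tele) or from the last
  -- entry (Ext).

  data Tele : ℕ → ℕ → Set where
    []  : ∀ {n} → Tele n zero
    _∷_ : ∀ {n k} → Ty n → Tele (suc n) k → Tele n (suc k)

  data Ext (n : ℕ) : ℕ → Set where
    []  : Ext n zero
    _▹_ : ∀ {k} → Ext n k → Ty (k + n) → Ext n (suc k)

  _⧺_ : ∀ {n k} → Ctx n → Tele n k → Ctx (n ⊞ k)
  Γ ⧺ []      = Γ
  Γ ⧺ (A ∷ Δ) = (Γ ▹ A) ⧺ Δ

  _▹▹_ : ∀ {n k} → Ctx n → Ext n k → Ctx (k + n)
  Γ ▹▹ []      = Γ
  Γ ▹▹ (Θ ▹ A) = (Γ ▹▹ Θ) ▹ A

  lift : ∀ {m n} k → Sub m n → Sub (m ⊞ k) (n ⊞ k)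
  lift zero    σ = σ
  lift (suc k) σ = lift k (↑ σ)

  lift₊ : ∀ {m n} k → Sub m n → Sub (k + m) (k + n)
  lift₊ zero    σ = σ
  lift₊ (suc k) σ = ↑ (lift₊ k σ)

  _[_]ᴰ : ∀ {m n k} → Tele n k → Sub m n → Tele m k
  []      [ σ ]ᴰ = []
  (A ∷ Δ) [ σ ]ᴰ = A [ σ ]ᵀ ∷ Δ [ ↑ σ ]ᴰ

  _[_]ᴱ : ∀ {m n k} → Ext n k → Sub m n → Ext m k
  []      [ σ ]ᴱ = []
  _[_]ᴱ {k = suc k} (Θ ▹ A) σ = Θ [ σ ]ᴱ ▹ A [ lift₊ k σ ]ᵀ

  typeOf : ∀ {n} → Ctx n → Fin n → Ty n
  typeOf (Γ ▹ A) zero    = A [ wk ]ᵀ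
  typeOf (Γ ▹ A) (suc i) = typeOf Γ i [ wk ]ᵀ

record IdentityOperations (L : RawSyntax) : Set where
  open RawSyntax L
  open Telescopes L
  field
    Id : ∀ {n} → Ty n → Tm n → Tm n → Ty n
    r  : ∀ {n} → Ty n → Tm n → Tm n
    -- J A Δ C d is J_d(x,y,p) with x, y, p and the variables of the post-context Δ free.  An
    -- unannotated syntax, with r(a) and J_d only, is the case in which the other arguments are ignored.
    J  : ∀ {n k} → Ty n → Tele (3 + n) k → Ty (3 + n ⊞ k) → Tm (1 + n ⊞ k) → Tm (3 + n ⊞ k)

    Id-[] : ∀ {m n} (A : Ty n) (a b : Tm n) (σ : Sub m n) →
            Id A a b [ σ ]ᵀ ≡ Id (A [ σ ]ᵀ) (a [ σ ]) (b [ σ ])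
    r-[]  : ∀ {m n} (A : Ty n) (a : Tm n) (σ : Sub m n) → r A a [ σ ] ≡ r (A [ σ ]ᵀ) (a [ σ ])
    J-[]  : ∀ {m n k} (A : Ty n) (Δ : Tele (3 + n) k) C d (σ : Sub m n) →
            J A Δ C d [ lift k (↑ (↑ (↑ σ))) ] ≡
            J (A [ σ ]ᵀ) (Δ [ ↑ (↑ (↑ σ)) ]ᴰ) (C [ lift k (↑ (↑ (↑ σ))) ]ᵀ) (d [ lift k (↑ σ) ])

-- Raw syntax together with the four forms of judgement.

record Judgements : Set₁ where
  field raw : RawSyntax
  open RawSyntax raw public
  open Telescopes raw public
  field identityOperations : IdentityOperations raw
  open IdentityOperations identityOperations public

  infix 4 _⊢_type _⊢_∶_ _⊢_≐_type _⊢_≐_∶_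
  field
    _⊢_type   : ∀ {n} → Ctx n → Ty n → Set
    _⊢_∶_     : ∀ {n} → Ctx n → Tm n → Ty n → Set
    _⊢_≐_type : ∀ {n} → Ctx n → Ty n → Ty n → Set
    _⊢_≐_∶_   : ∀ {n} → Ctx n → Tm n → Tm n → Ty n → Set

module Contexts (𝒥 : Judgements) where
  open Judgements 𝒥

  infix 4 ⊢_ ⊢_≐_ _⊢_⇛_ _⊢_≐_⇛_ _⊢_∋_ _⊢_∋_≐_

  data ⊢_ : ∀ {n} → Ctx n → Set where
    []  : ⊢ []
    _▹_ : ∀ {n} {Γ : Ctx n} {A} → ⊢ Γ → Γ ⊢ A type → ⊢ Γ ▹ A

  data ⊢_≐_ : ∀ {n} → Ctx n → Ctx n → Set where
    []  : ⊢ [] ≐ []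
    _▹_ : ∀ {n} {Γ Γ′ : Ctx n} {A A′} → ⊢ Γ ≐ Γ′ → Γ ⊢ A ≐ A′ type → ⊢ Γ ▹ A ≐ Γ′ ▹ A′

  -- Γ ⊢ σ ⇛ Δ  says that σ is an element of the context Δ, in context Γ.

  data _⊢_⇛_ {m} (Γ : Ctx m) : ∀ {n} → Sub m n → Ctx n → Set where
    []  : ⊢ Γ → Γ ⊢ [] ⇛ []
    ext : ∀ {n} {Δ : Ctx n} {A σ a} → Γ ⊢ σ ⇛ Δ → Δ ⊢ A type → Γ ⊢ a ∶ A [ σ ]ᵀ → Γ ⊢ a ∷ σ ⇛ Δ ▹ A

  data _⊢_≐_⇛_ {m} (Γ : Ctx m) : ∀ {n} → Sub m n → Sub m n → Ctx n → Set where
    []  : ⊢ Γ → Γ ⊢ [] ≐ [] ⇛ []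
    ext : ∀ {n} {Δ : Ctx n} {A σ τ a b} → Γ ⊢ σ ≐ τ ⇛ Δ → Δ ⊢ A type →
          Γ ⊢ a ≐ b ∶ A [ σ ]ᵀ → Γ ⊢ a ∷ σ ≐ b ∷ τ ⇛ Δ ▹ A

  -- Elements of a telescope Θ over Γ.

  _⊢_∋_ : ∀ {m k} → Ctx m → Ext m k → Sub m k → Set
  Γ ⊢ Θ ∋ ts = Γ ⊢ ts ++ idₛ ⇛ Γ ▹▹ Θ

  _⊢_∋_≐_ : ∀ {m k} → Ctx m → Ext m k → Sub m k → Sub m k → Set
  Γ ⊢ Θ ∋ ts ≐ us = Γ ⊢ ts ++ idₛ ≐ us ++ idₛ ⇛ Γ ▹▹ Θ

  -- (Γ, x : A, y : A, p : Id_A(x,y)), and the substitution (x, x, r(x)) into it from (Γ, x : A).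

  path : ∀ {n} → Ctx n → Ty n → Ctx (3 + n)
  path Γ A = Γ ▹ A ▹ A [ wk ]ᵀ ▹ Id (A [ wk ]ᵀ [ wk ]ᵀ) (var (suc zero)) (var zero)

  refl-path : ∀ {n} → Ty n → Sub (1 + n) (3 + n)
  refl-path A = r (A [ wk ]ᵀ) (var zero) ∷ var zero ∷ var zero ∷ wk

-- Weakening, contraction, exchange and substitution are instances of simultaneous substitution along
-- an element of a context; with variables, they generate it.

record IsTypeTheory (𝒥 : Judgements) : Set where
  open Judgements 𝒥
  open Contexts 𝒥
  field
    context-of  : ∀ {n} {Γ : Ctx n} {A} → Γ ⊢ A type → ⊢ Γ
    type-of     : ∀ {n} {Γ : Ctx n} {A a} → Γ ⊢ a ∶ A → Γ ⊢ A type
    left-type   : ∀ {n} {Γ : Ctx n} {A B} → Γ ⊢ A ≐ B type → Γ ⊢ A type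
    left-term   : ∀ {n} {Γ : Ctx n} {A a b} → Γ ⊢ a ≐ b ∶ A → Γ ⊢ a ∶ A

    ≐ᵀ-refl  : ∀ {n} {Γ : Ctx n} {A} → Γ ⊢ A type → Γ ⊢ A ≐ A type
    ≐ᵀ-sym   : ∀ {n} {Γ : Ctx n} {A B} → Γ ⊢ A ≐ B type → Γ ⊢ B ≐ A type
    ≐ᵀ-trans : ∀ {n} {Γ : Ctx n} {A B C} → Γ ⊢ A ≐ B type → Γ ⊢ B ≐ C type → Γ ⊢ A ≐ C type
    ≐-refl   : ∀ {n} {Γ : Ctx n} {A a} → Γ ⊢ a ∶ A → Γ ⊢ a ≐ a ∶ A
    ≐-sym    : ∀ {n} {Γ : Ctx n} {A a b} → Γ ⊢ a ≐ b ∶ A → Γ ⊢ b ≐ a ∶ A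
    ≐-trans  : ∀ {n} {Γ : Ctx n} {A a b c} → Γ ⊢ a ≐ b ∶ A → Γ ⊢ b ≐ c ∶ A → Γ ⊢ a ≐ c ∶ A
    conv     : ∀ {n} {Γ : Ctx n} {A B a} → Γ ⊢ a ∶ A → Γ ⊢ A ≐ B type → Γ ⊢ a ∶ B
    conv-≐   : ∀ {n} {Γ : Ctx n} {A B a b} → Γ ⊢ a ≐ b ∶ A → Γ ⊢ A ≐ B type → Γ ⊢ a ≐ b ∶ B

    variables : ∀ {n} {Γ : Ctx n} → ⊢ Γ → (i : Fin n) → Γ ⊢ var i ∶ typeOf Γ i
    subst-type   : ∀ {m n} {Γ : Ctx m} {Δ : Ctx n} {σ A} →
                   Γ ⊢ σ ⇛ Δ → Δ ⊢ A type → Γ ⊢ A [ σ ]ᵀ type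
    subst-term   : ∀ {m n} {Γ : Ctx m} {Δ : Ctx n} {σ A a} →
                   Γ ⊢ σ ⇛ Δ → Δ ⊢ a ∶ A → Γ ⊢ a [ σ ] ∶ A [ σ ]ᵀ
    subst-type-≐ : ∀ {m n} {Γ : Ctx m} {Δ : Ctx n} {σ τ A B} →
                   Γ ⊢ σ ≐ τ ⇛ Δ → Δ ⊢ A ≐ B type → Γ ⊢ A [ σ ]ᵀ ≐ B [ τ ]ᵀ type
    subst-term-≐ : ∀ {m n} {Γ : Ctx m} {Δ : Ctx n} {σ τ A a b} →
                   Γ ⊢ σ ≐ τ ⇛ Δ → Δ ⊢ a ≐ b ∶ A → Γ ⊢ a [ σ ] ≐ b [ τ ] ∶ A [ σ ]ᵀ

record HasIdentityTypes (𝒥 : Judgements) : Set where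
  open Judgements 𝒥
  open Contexts 𝒥
  field
    Id-form : ∀ {n} {Γ : Ctx n} {A a b} → Γ ⊢ a ∶ A → Γ ⊢ b ∶ A → Γ ⊢ Id A a b type
    Id-cong : ∀ {n} {Γ : Ctx n} {A A′ a a′ b b′} → Γ ⊢ A ≐ A′ type → Γ ⊢ a ≐ a′ ∶ A → Γ ⊢ b ≐ b′ ∶ A →
              Γ ⊢ Id A a b ≐ Id A′ a′ b′ type
    r-intro : ∀ {n} {Γ : Ctx n} {A a} → Γ ⊢ a ∶ A → Γ ⊢ r A a ∶ Id A a a
    r-cong  : ∀ {n} {Γ : Ctx n} {A A′ a a′} → Γ ⊢ A ≐ A′ type → Γ ⊢ a ≐ a′ ∶ A →
              Γ ⊢ r A a ≐ r A′ a′ ∶ Id A a a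
    J-elim  : ∀ {n k} {Γ : Ctx n} {A} {Δ : Tele (3 + n) k} {C d} →
              path Γ A ⧺ Δ ⊢ C type →
              (Γ ▹ A) ⧺ Δ [ refl-path A ]ᴰ ⊢ d ∶ C [ lift k (refl-path A) ]ᵀ →
              path Γ A ⧺ Δ ⊢ J A Δ C d ∶ C
    J-comp  : ∀ {n k} {Γ : Ctx n} {A} {Δ : Tele (3 + n) k} {C d} →
              path Γ A ⧺ Δ ⊢ C type →
              (Γ ▹ A) ⧺ Δ [ refl-path A ]ᴰ ⊢ d ∶ C [ lift k (refl-path A) ]ᵀ →
              (Γ ▹ A) ⧺ Δ [ refl-path A ]ᴰ ⊢
                J A Δ C d [ lift k (refl-path A) ] ≐ d ∶ C [ lift k (refl-path A) ]ᵀ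
    J-cong  : ∀ {n k} {Γ : Ctx n} {A A′} {Δ Δ′ : Tele (3 + n) k} {C C′ d d′} →
              ⊢ path Γ A ⧺ Δ ≐ path Γ A′ ⧺ Δ′ →
              path Γ A ⧺ Δ ⊢ C ≐ C′ type →
              (Γ ▹ A) ⧺ Δ [ refl-path A ]ᴰ ⊢ d ≐ d′ ∶ C [ lift k (refl-path A) ]ᵀ →
              path Γ A ⧺ Δ ⊢ J A Δ C d ≐ J A′ Δ′ C′ d′ ∶ C

record HasDiscreteIdentityTypes (𝒥 : Judgements) : Set where
  open Judgements 𝒥
  field
    reflect   : ∀ {n} {Γ : Ctx n} {A a b p q α} → Γ ⊢ α ∶ Id (Id A a b) p q → Γ ⊢ p ≐ q ∶ Id A a b
    reflect-r : ∀ {n} {Γ : Ctx n} {A a b p q α} → Γ ⊢ α ∶ Id (Id A a b) p q →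
                Γ ⊢ α ≐ r (Id A a b) p ∶ Id (Id A a b) p q

record TypeTheory : Set₁ where
  field
    judgements               : Judgements
    isTypeTheory             : IsTypeTheory judgements
    hasIdentityTypes         : HasIdentityTypes judgements
    hasDiscreteIdentityTypes : HasDiscreteIdentityTypes judgements
  open Judgements judgements public
  open Contexts judgements public
  open IsTypeTheory isTypeTheory public
  open HasIdentityTypes hasIdentityTypes public
  open HasDiscreteIdentityTypes hasDiscreteIdentityTypes public

module SubstitutionLemmas (L : RawSyntax) where
  open RawSyntax L
  open Telescopes L

  ⊚-assoc : ∀ {k l m n} (ρ : Sub m n) (σ : Sub l m) (τ : Sub k l) → ρ ⊚ σ ⊚ τ ≡ ρ ⊚ (σ ⊚ τ)
  ⊚-assoc ρ σ τ = trans (sym (map-∘ (_[ τ ]) (_[ σ ]) ρ)) (map-cong (λ a → [⊚] a σ τ) ρ)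

  ⊚-id : ∀ {m n} (σ : Sub m n) → σ ⊚ idₛ ≡ σ
  ⊚-id σ = trans (map-cong [id] σ) (map-id σ)

  tabulate-⊚ : ∀ {k m n} (f : Fin n → Fin k) (σ : Sub m k) →
               tabulate (λ i → var (f i)) ⊚ σ ≡ tabulate (λ i → lookup σ (f i))
  tabulate-⊚ f σ = trans (sym (tabulate-∘ (_[ σ ]) (λ i → var (f i)))) (tabulate-cong (λ i → var-[] (f i) σ))

  id-⊚ : ∀ {m n} (σ : Sub m n) → idₛ ⊚ σ ≡ σ
  id-⊚ σ = trans (tabulate-⊚ (λ i → i) σ) (tabulate∘lookup σ)

  wk-∷ : ∀ {m n} (a : Tm m) (σ : Sub m n) → wk ⊚ (a ∷ σ) ≡ σ
  wk-∷ a σ = trans (tabulate-⊚ suc (a ∷ σ)) (tabulate∘lookup σ)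

  v₀ : ∀ {m n} (a : Tm m) (σ : Sub m n) → var zero [ a ∷ σ ] ≡ a
  v₀ a σ = var-[] zero (a ∷ σ)

  v₁ : ∀ {m n} (a b : Tm m) (σ : Sub m n) → var (suc zero) [ a ∷ b ∷ σ ] ≡ b
  v₁ a b σ = var-[] (suc zero) (a ∷ b ∷ σ)

  ⊚wk-∷ : ∀ {m n k} (ρ : Sub n k) (a : Tm m) (σ : Sub m n) → ρ ⊚ wk ⊚ (a ∷ σ) ≡ ρ ⊚ σ
  ⊚wk-∷ ρ a σ = trans (⊚-assoc ρ wk (a ∷ σ)) (cong (ρ ⊚_) (wk-∷ a σ))

  ↑-∷ : ∀ {l m n} (σ : Sub m n) (a : Tm l) (τ : Sub l m) → ↑ σ ⊚ (a ∷ τ) ≡ a ∷ σ ⊚ τ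
  ↑-∷ σ a τ = cong₂ _∷_ (v₀ a τ) (⊚wk-∷ σ a τ)

  wk-↑ : ∀ {m n} (σ : Sub m n) → wk ⊚ ↑ σ ≡ σ ⊚ wk
  wk-↑ σ = wk-∷ _ _

  ↑-⊚ : ∀ {l m n} (σ : Sub m n) (τ : Sub l m) → ↑ σ ⊚ ↑ τ ≡ ↑ (σ ⊚ τ)
  ↑-⊚ σ τ = trans (↑-∷ σ _ _) (cong (var zero ∷_) (sym (⊚-assoc σ τ wk)))

  ↑-id : ∀ {n} → ↑ (idₛ {n}) ≡ idₛ
  ↑-id = cong (var zero ∷_) (id-⊚ wk)

  lift-id : ∀ {n} k → lift {n} k idₛ ≡ idₛ
  lift-id zero    = refl
  lift-id (suc k) = trans (cong (lift k) ↑-id) (lift-id k)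

  lift-⊚ : ∀ {l m n} k (σ : Sub m n) (τ : Sub l m) → lift k σ ⊚ lift k τ ≡ lift k (σ ⊚ τ)
  lift-⊚ zero    σ τ = refl
  lift-⊚ (suc k) σ τ = trans (lift-⊚ k (↑ σ) (↑ τ)) (cong (lift k) (↑-⊚ σ τ))

  lift₊-id : ∀ {n} k → lift₊ {n} k idₛ ≡ idₛ
  lift₊-id zero    = refl
  lift₊-id (suc k) = trans (cong ↑ (lift₊-id k)) ↑-id

  lift₊-⊚ : ∀ {l m n} k (σ : Sub m n) (τ : Sub l m) → lift₊ k σ ⊚ lift₊ k τ ≡ lift₊ k (σ ⊚ τ)
  lift₊-⊚ zero    σ τ = refl
  lift₊-⊚ (suc k) σ τ = trans (↑-⊚ _ _) (cong ↑ (lift₊-⊚ k σ τ))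

  lift₊-++ : ∀ {l m n k} (σ : Sub m n) (ts : Sub l k) (τ : Sub l m) → lift₊ k σ ⊚ (ts ++ τ) ≡ ts ++ σ ⊚ τ
  lift₊-++ σ []       τ = refl
  lift₊-++ σ (t ∷ ts) τ = trans (↑-∷ _ t (ts ++ τ)) (cong (t ∷_) (lift₊-++ σ ts τ))

  ++-⊚ : ∀ {l m n k} (ts : Sub m k) (σ : Sub m n) (τ : Sub l m) → (ts ++ σ) ⊚ τ ≡ ts ⊚ τ ++ σ ⊚ τ
  ++-⊚ ts σ τ = map-++ (_[ τ ]) ts σ

  ++id-⊚ : ∀ {m n k} (ts : Sub n k) (ρ : Sub m n) → (ts ++ idₛ) ⊚ ρ ≡ lift₊ k ρ ⊚ (ts ⊚ ρ ++ idₛ)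
  ++id-⊚ ts ρ = trans (++-⊚ ts idₛ ρ) (trans (cong (ts ⊚ ρ ++_) (trans (id-⊚ ρ) (sym (⊚-id ρ)))) (sym (lift₊-++ ρ (ts ⊚ ρ) idₛ)))

  [id]ᴰ : ∀ {n k} (Δ : Tele n k) → Δ [ idₛ ]ᴰ ≡ Δ
  [id]ᴰ []      = refl
  [id]ᴰ (A ∷ Δ) = cong₂ _∷_ ([id]ᵀ A) (trans (cong (Δ [_]ᴰ) ↑-id) ([id]ᴰ Δ))

  [⊚]ᴰ : ∀ {l m n k} (Δ : Tele n k) (σ : Sub m n) (τ : Sub l m) → Δ [ σ ]ᴰ [ τ ]ᴰ ≡ Δ [ σ ⊚ τ ]ᴰ
  [⊚]ᴰ []      σ τ = refl
  [⊚]ᴰ (A ∷ Δ) σ τ = cong₂ _∷_ ([⊚]ᵀ A σ τ) (trans ([⊚]ᴰ Δ (↑ σ) (↑ τ)) (cong (Δ [_]ᴰ) (↑-⊚ σ τ)))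

  [id]ᴱ : ∀ {n k} (Θ : Ext n k) → Θ [ idₛ ]ᴱ ≡ Θ
  [id]ᴱ []      = refl
  [id]ᴱ (_▹_ {k} Θ A) = cong₂ _▹_ ([id]ᴱ Θ) (trans (cong (A [_]ᵀ) (lift₊-id k)) ([id]ᵀ A))

  [⊚]ᴱ : ∀ {l m n k} (Θ : Ext n k) (σ : Sub m n) (τ : Sub l m) → Θ [ σ ]ᴱ [ τ ]ᴱ ≡ Θ [ σ ⊚ τ ]ᴱ
  [⊚]ᴱ []            σ τ = refl
  [⊚]ᴱ (_▹_ {k} Θ A) σ τ = cong₂ _▹_ ([⊚]ᴱ Θ σ τ) (trans ([⊚]ᵀ A _ _) (cong (A [_]ᵀ) (lift₊-⊚ k σ τ)))

  []-[]ᵀ : ∀ {l m n} (A : Ty n) {σ : Sub m n} {τ : Sub l m} {ρ : Sub l n} → σ ⊚ τ ≡ ρ → A [ σ ]ᵀ [ τ ]ᵀ ≡ A [ ρ ]ᵀ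
  []-[]ᵀ A eq = trans ([⊚]ᵀ A _ _) (cong (A [_]ᵀ) eq)

  []-[] : ∀ {l m n} (a : Tm n) {σ : Sub m n} {τ : Sub l m} {ρ : Sub l n} → σ ⊚ τ ≡ ρ → a [ σ ] [ τ ] ≡ a [ ρ ]
  []-[] a eq = trans ([⊚] a _ _) (cong (a [_]) eq)

  []-id : ∀ {n} (A : Ty n) {σ : Sub n n} → σ ≡ idₛ → A [ σ ]ᵀ ≡ A
  []-id A eq = trans (cong (A [_]ᵀ) eq) ([id]ᵀ A)

module Structural (S : TypeTheory) where
  open TypeTheory S
  open SubstitutionLemmas raw public

  infixl 3 _∶≡_ _≐≡_

  _∶≡_ : ∀ {n} {Γ : Ctx n} {A B a} → Γ ⊢ a ∶ A → A ≡ B → Γ ⊢ a ∶ B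
  t ∶≡ refl = t

  _≐≡_ : ∀ {n} {Γ : Ctx n} {A B a b} → Γ ⊢ a ≐ b ∶ A → A ≡ B → Γ ⊢ a ≐ b ∶ B
  t ≐≡ refl = t

  tm≡ : ∀ {n} {Γ : Ctx n} {A B a b} → a ≡ b → A ≡ B → Γ ⊢ a ∶ A → Γ ⊢ b ∶ B
  tm≡ refl refl t = t

  eq≡ : ∀ {n} {Γ : Ctx n} {A B a b c d} → a ≡ c → b ≡ d → A ≡ B → Γ ⊢ a ≐ b ∶ A → Γ ⊢ c ≐ d ∶ B
  eq≡ refl refl refl t = t

  ty≡ : ∀ {n} {Γ : Ctx n} {A B} → A ≡ B → Γ ⊢ A type → Γ ⊢ B type
  ty≡ refl t = t

  teq≡ : ∀ {n} {Γ : Ctx n} {A B C D} → A ≡ C → B ≡ D → Γ ⊢ A ≐ B type → Γ ⊢ C ≐ D type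
  teq≡ refl refl t = t

  ⇛≡ : ∀ {m n} {Γ : Ctx m} {Δ : Ctx n} {σ τ} → σ ≡ τ → Γ ⊢ σ ⇛ Δ → Γ ⊢ τ ⇛ Δ
  ⇛≡ refl t = t

  ⇛≐≡ : ∀ {m n} {Γ : Ctx m} {Δ : Ctx n} {σ τ σ′ τ′} → σ ≡ σ′ → τ ≡ τ′ → Γ ⊢ σ ≐ τ ⇛ Δ → Γ ⊢ σ′ ≐ τ′ ⇛ Δ
  ⇛≐≡ refl refl t = t

  right-type : ∀ {n} {Γ : Ctx n} {A B} → Γ ⊢ A ≐ B type → Γ ⊢ B type
  right-type e = left-type (≐ᵀ-sym e)

  right-term : ∀ {n} {Γ : Ctx n} {A a b} → Γ ⊢ a ≐ b ∶ A → Γ ⊢ b ∶ A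
  right-term e = left-term (≐-sym e)

  dom : ∀ {m n} {Γ : Ctx m} {Δ : Ctx n} {σ} → Γ ⊢ σ ⇛ Δ → ⊢ Γ
  dom ([] w)      = w
  dom (ext s _ _) = dom s

  cod : ∀ {m n} {Γ : Ctx m} {Δ : Ctx n} {σ} → Γ ⊢ σ ⇛ Δ → ⊢ Δ
  cod ([] w)      = []
  cod (ext s A _) = cod s ▹ A

  ⇛-refl : ∀ {m n} {Γ : Ctx m} {Δ : Ctx n} {σ} → Γ ⊢ σ ⇛ Δ → Γ ⊢ σ ≐ σ ⇛ Δ
  ⇛-refl ([] w)      = [] w
  ⇛-refl (ext s A a) = ext (⇛-refl s) A (≐-refl a)

  ⇛-sym : ∀ {m n} {Γ : Ctx m} {Δ : Ctx n} {σ τ} → Γ ⊢ σ ≐ τ ⇛ Δ → Γ ⊢ τ ≐ σ ⇛ Δ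
  ⇛-sym ([] w)      = [] w
  ⇛-sym (ext s A a) = ext (⇛-sym s) A (conv-≐ (≐-sym a) (subst-type-≐ s (≐ᵀ-refl A)))

  ⇛-trans : ∀ {m n} {Γ : Ctx m} {Δ : Ctx n} {σ τ ρ} → Γ ⊢ σ ≐ τ ⇛ Δ → Γ ⊢ τ ≐ ρ ⇛ Δ → Γ ⊢ σ ≐ ρ ⇛ Δ
  ⇛-trans ([] w)      ([] _)      = [] w
  ⇛-trans (ext s A a) (ext t _ b) = ext (⇛-trans s t) A (≐-trans a (conv-≐ b (≐ᵀ-sym (subst-type-≐ s (≐ᵀ-refl A)))))

  ⇛-left : ∀ {m n} {Γ : Ctx m} {Δ : Ctx n} {σ τ} → Γ ⊢ σ ≐ τ ⇛ Δ → Γ ⊢ σ ⇛ Δ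
  ⇛-left ([] w)      = [] w
  ⇛-left (ext s A a) = ext (⇛-left s) A (left-term a)

  ⇛-right : ∀ {m n} {Γ : Ctx m} {Δ : Ctx n} {σ τ} → Γ ⊢ σ ≐ τ ⇛ Δ → Γ ⊢ τ ⇛ Δ
  ⇛-right s = ⇛-left (⇛-sym s)

  ⇛-comp : ∀ {l m n} {Γ : Ctx l} {Δ : Ctx m} {Ξ : Ctx n} {σ τ} → Δ ⊢ σ ⇛ Ξ → Γ ⊢ τ ⇛ Δ → Γ ⊢ σ ⊚ τ ⇛ Ξ
  ⇛-comp ([] w)      t = [] (dom t)
  ⇛-comp (ext {A = A} s B a) t = ext (⇛-comp s t) B (subst-term t a ∶≡ [⊚]ᵀ A _ _)

  ⇛-comp-≐ : ∀ {l m n} {Γ : Ctx l} {Δ : Ctx m} {Ξ : Ctx n} {σ σ′ τ τ′} →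
             Δ ⊢ σ ≐ σ′ ⇛ Ξ → Γ ⊢ τ ≐ τ′ ⇛ Δ → Γ ⊢ σ ⊚ τ ≐ σ′ ⊚ τ′ ⇛ Ξ
  ⇛-comp-≐ ([] w)      t = [] (dom (⇛-left t))
  ⇛-comp-≐ (ext {A = A} s B a) t = ext (⇛-comp-≐ s t) B (subst-term-≐ t a ≐≡ [⊚]ᵀ A _ _)

  rename⇛ : ∀ {m n} {Γ : Ctx m} {Δ : Ctx n} → ⊢ Γ → ⊢ Δ → (f : Fin n → Fin m) →
             (∀ i → typeOf Γ (f i) ≡ typeOf Δ i [ tabulate (λ j → var (f j)) ]ᵀ) →
             Γ ⊢ tabulate (λ j → var (f j)) ⇛ Δ
  rename⇛ w []      f eq = [] w
  rename⇛ {Δ = Δ ▹ A} w (v ▹ B) f eq =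
    ext (rename⇛ w v (λ i → f (suc i)) (λ i → trans (eq (suc i)) ([]-[]ᵀ (typeOf Δ i) (wk-∷ _ _)))) B
        (variables w (f zero) ∶≡ trans (eq zero) ([]-[]ᵀ A (wk-∷ _ _)))

  wk⇛ : ∀ {n} {Γ : Ctx n} {A} → Γ ⊢ A type → Γ ▹ A ⊢ wk ⇛ Γ
  wk⇛ A = rename⇛ (context-of A ▹ A) (context-of A) suc (λ i → refl)

  id⇛ : ∀ {n} {Γ : Ctx n} → ⊢ Γ → Γ ⊢ idₛ ⇛ Γ
  id⇛ w = rename⇛ w w (λ i → i) (λ i → sym ([id]ᵀ _))

  v₀∶ : ∀ {n} {Γ : Ctx n} {A} → Γ ⊢ A type → Γ ▹ A ⊢ var zero ∶ A [ wk ]ᵀ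
  v₀∶ A = variables (context-of A ▹ A) zero

  ↑⇛ : ∀ {m n} {Γ : Ctx m} {Δ : Ctx n} {σ A} → Γ ⊢ σ ⇛ Δ → Δ ⊢ A type → Γ ▹ A [ σ ]ᵀ ⊢ ↑ σ ⇛ Δ ▹ A
  ↑⇛ {A = A} s B = ext (⇛-comp s (wk⇛ C)) B (v₀∶ C ∶≡ [⊚]ᵀ A _ _)
    where C = subst-type s B

  wk-type : ∀ {n} {Γ : Ctx n} {A B} → Γ ⊢ A type → Γ ⊢ B type → Γ ▹ A ⊢ B [ wk ]ᵀ type
  wk-type A B = subst-type (wk⇛ A) B

  record Converts {n} (Γ Γ′ : Ctx n) : Set where
    constructor converts
    field
      to   : Γ ⊢ idₛ ⇛ Γ′
      from : Γ′ ⊢ idₛ ⇛ Γ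
  open Converts public

  ctx-type : ∀ {n} {Γ Γ′ : Ctx n} {A} → Converts Γ Γ′ → Γ ⊢ A type → Γ′ ⊢ A type
  ctx-type c A = ty≡ ([id]ᵀ _) (subst-type (from c) A)

  ctx-term : ∀ {n} {Γ Γ′ : Ctx n} {A a} → Converts Γ Γ′ → Γ ⊢ a ∶ A → Γ′ ⊢ a ∶ A
  ctx-term c a = tm≡ ([id] _) ([id]ᵀ _) (subst-term (from c) a)

  ctx-type-≐ : ∀ {n} {Γ Γ′ : Ctx n} {A B} → Converts Γ Γ′ → Γ ⊢ A ≐ B type → Γ′ ⊢ A ≐ B type
  ctx-type-≐ c A = teq≡ ([id]ᵀ _) ([id]ᵀ _) (subst-type-≐ (⇛-refl (from c)) A)

  ctx-term-≐ : ∀ {n} {Γ Γ′ : Ctx n} {A a b} → Converts Γ Γ′ → Γ ⊢ a ≐ b ∶ A → Γ′ ⊢ a ≐ b ∶ A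
  ctx-term-≐ c a = eq≡ ([id] _) ([id] _) ([id]ᵀ _) (subst-term-≐ (⇛-refl (from c)) a)

  ctx-⇛ : ∀ {m n} {Γ Γ′ : Ctx m} {Δ Δ′ : Ctx n} {σ} → Converts Γ Γ′ → Converts Δ Δ′ → Γ ⊢ σ ⇛ Δ → Γ′ ⊢ σ ⇛ Δ′
  ctx-⇛ c d s = ⇛≡ (trans (⊚-id _) (id-⊚ _)) (⇛-comp (⇛-comp (to d) s) (from c))

  ctx-⇛-≐ : ∀ {m n} {Γ Γ′ : Ctx m} {Δ Δ′ : Ctx n} {σ τ} → Converts Γ Γ′ → Converts Δ Δ′ →
            Γ ⊢ σ ≐ τ ⇛ Δ → Γ′ ⊢ σ ≐ τ ⇛ Δ′
  ctx-⇛-≐ c d s = ⇛≐≡ (trans (⊚-id _) (id-⊚ _)) (trans (⊚-id _) (id-⊚ _))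
                      (⇛-comp-≐ (⇛-comp-≐ (⇛-refl (to d)) s) (⇛-refl (from c)))

  id-converts : ∀ {n} {Γ : Ctx n} → ⊢ Γ → Converts Γ Γ
  id-converts w = converts (id⇛ w) (id⇛ w)

  sym-converts : ∀ {n} {Γ Γ′ : Ctx n} → Converts Γ Γ′ → Converts Γ′ Γ
  sym-converts c = converts (from c) (to c)

  ▹-converts : ∀ {n} {Γ Γ′ : Ctx n} {A A′} → Converts Γ Γ′ → Γ ⊢ A ≐ A′ type → Converts (Γ ▹ A) (Γ′ ▹ A′)
  ▹-converts {A = A} {A′} c e =
    converts (ext (⇛≡ (id-⊚ _) (⇛-comp (to c) (wk⇛ (left-type e)))) (right-type e′)
                  (conv (v₀∶ (left-type e)) (subst-type-≐ (⇛-refl (wk⇛ (left-type e))) e)))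
             (ext (⇛≡ (id-⊚ _) (⇛-comp (from c) (wk⇛ (right-type e′)))) (left-type e)
                  (conv (v₀∶ (right-type e′)) (subst-type-≐ (⇛-refl (wk⇛ (right-type e′))) (≐ᵀ-sym e′))))
    where e′ = ctx-type-≐ c e

  ≐-converts : ∀ {n} {Γ Γ′ : Ctx n} → ⊢ Γ ≐ Γ′ → Converts Γ Γ′
  ≐-converts []      = converts ([] []) ([] [])
  ≐-converts (c ▹ e) = ▹-converts (≐-converts c) e

  ctx-refl : ∀ {n} {Γ : Ctx n} → ⊢ Γ → ⊢ Γ ≐ Γ
  ctx-refl []      = []
  ctx-refl (w ▹ A) = ctx-refl w ▹ ≐ᵀ-refl A

  ctx-sym : ∀ {n} {Γ Γ′ : Ctx n} → ⊢ Γ ≐ Γ′ → ⊢ Γ′ ≐ Γ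
  ctx-sym []      = []
  ctx-sym (c ▹ e) = ctx-sym c ▹ ctx-type-≐ (≐-converts c) (≐ᵀ-sym e)

  ctx-trans : ∀ {n} {Γ Δ Ξ : Ctx n} → ⊢ Γ ≐ Δ → ⊢ Δ ≐ Ξ → ⊢ Γ ≐ Ξ
  ctx-trans []      []      = []
  ctx-trans (c ▹ e) (d ▹ f) = ctx-trans c d ▹ ≐ᵀ-trans e (ctx-type-≐ (sym-converts (≐-converts c)) f)

  ⧺-prefix : ∀ {n k} {Γ : Ctx n} (Δ : Tele n k) → ⊢ Γ ⧺ Δ → ⊢ Γ
  ⧺-prefix []      w = w
  ⧺-prefix (A ∷ Δ) w with ⧺-prefix Δ w
  ... | v ▹ _ = v

  lift⇛ : ∀ {m n k} {Γ : Ctx m} {Ξ : Ctx n} {σ} (Δ : Tele n k) → Γ ⊢ σ ⇛ Ξ → ⊢ Ξ ⧺ Δ →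
          Γ ⧺ Δ [ σ ]ᴰ ⊢ lift k σ ⇛ Ξ ⧺ Δ
  lift⇛ []      s w = s
  lift⇛ (A ∷ Δ) s w with ⧺-prefix Δ w
  ... | _ ▹ B = lift⇛ Δ (↑⇛ s B) w

  ⧺-converts : ∀ {n k} {Γ Γ′ : Ctx n} (Δ : Tele n k) → Converts Γ Γ′ → ⊢ Γ ⧺ Δ → Converts (Γ ⧺ Δ) (Γ′ ⧺ Δ)
  ⧺-converts []      c w = c
  ⧺-converts (A ∷ Δ) c w with ⧺-prefix Δ w
  ... | _ ▹ B = ⧺-converts Δ (▹-converts c (≐ᵀ-refl B)) w

  ▹▹-prefix : ∀ {n k} {Γ : Ctx n} (Θ : Ext n k) → ⊢ Γ ▹▹ Θ → ⊢ Γ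
  ▹▹-prefix []      w       = w
  ▹▹-prefix (Θ ▹ A) (w ▹ _) = ▹▹-prefix Θ w

  lift₊⇛ : ∀ {m n k} {Γ : Ctx m} {Ξ : Ctx n} {σ} (Θ : Ext n k) → Γ ⊢ σ ⇛ Ξ → ⊢ Ξ ▹▹ Θ →
           Γ ▹▹ Θ [ σ ]ᴱ ⊢ lift₊ k σ ⇛ Ξ ▹▹ Θ
  lift₊⇛ []      s w       = s
  lift₊⇛ (Θ ▹ A) s (w ▹ B) = ↑⇛ (lift₊⇛ Θ s w) B

  ▹▹-converts : ∀ {n k} {Γ Γ′ : Ctx n} (Θ : Ext n k) → Converts Γ Γ′ → ⊢ Γ ▹▹ Θ → Converts (Γ ▹▹ Θ) (Γ′ ▹▹ Θ)
  ▹▹-converts []      c w       = c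
  ▹▹-converts (Θ ▹ A) c (w ▹ B) = ▹-converts (▹▹-converts Θ c w) (≐ᵀ-refl B)

tri : ℕ → ℕ
tri zero    = zero
tri (suc n) = 3 + tri n

module IdentityContexts (𝒥 : Judgements) where
  open Judgements 𝒥
  open Contexts 𝒥

  -- Elimination for a single type into a context.

  Jᴱ : ∀ {n k l} → Ty n → Tele (3 + n) k → Ext (3 + n ⊞ k) l → Sub (1 + n ⊞ k) l → Sub (3 + n ⊞ k) l
  Jᴱ A Δ []      []       = []
  Jᴱ A Δ (Θ ▹ C) (d ∷ ds) = J A Δ (C [ Jᴱ A Δ Θ ds ++ idₛ ]ᵀ) d ∷ Jᴱ A Δ Θ ds

  -- Path Φ is the context (x : Φ, x′ : Φ, p : Id_Φ(x,x′)), with x, x′ and p interleaved entry by entry;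
  -- src, tgt and path-vars are x, x′ and p in it, zip x x′ p is the substitution with these
  -- components, and rfl is (x, x, r(x)).

  src tgt : ∀ n → Sub (tri n) n
  src zero    = []
  src (suc n) = var (suc (suc zero)) ∷ src n ⊚ wk ⊚ wk ⊚ wk
  tgt zero    = []
  tgt (suc n) = var (suc zero) ∷ tgt n ⊚ wk ⊚ wk ⊚ wk

  path-vars : ∀ n → Sub (tri n) n
  path-vars zero    = []
  path-vars (suc n) = var zero ∷ path-vars n ⊚ wk ⊚ wk ⊚ wk

  zip : ∀ {m n} → Sub m n → Sub m n → Sub m n → Sub m (tri n)
  zip []      []        []      = []
  zip (y ∷ σ) (y′ ∷ σ′) (q ∷ p) = q ∷ y′ ∷ y ∷ zip σ σ′ p

  rs : ∀ {m n} → Ctx n → Sub m n → Sub m n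
  rs []      []      = []
  rs (Φ ▹ D) (y ∷ σ) = r (D [ σ ]ᵀ) y ∷ rs Φ σ

  rfl : ∀ {n} → Ctx n → Sub n (tri n)
  rfl Φ = zip idₛ idₛ (rs Φ idₛ)

  -- Elimination for Id_Φ with post-context Δ into the context Θ: for Φ = (Λ, D), first eliminate along
  -- Id_D over Λ, then along Id_Λ with post-context (y, y′, q, Δ).

  Jᶜ : ∀ {n k l} → Ctx n → Tele (tri n) k → Ext (tri n ⊞ k) l → Sub (n ⊞ k) l → Sub (tri n ⊞ k) l
  -- transport Λ D is p^*(z), in context (Path Λ, z : D(x′)).
  transport : ∀ {n} → Ctx n → Ty n → Tm (suc (tri n))
  Path-step : ∀ {n k} → Ctx n → Ty n → Tele (3 + tri n) k → Tele (tri n) (3 + k)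

  Path-step {n} Λ D Δ =
    D [ src n ]ᵀ ∷ D [ tgt n ]ᵀ [ wk ]ᵀ ∷
    Id (D [ src n ]ᵀ [ wk ]ᵀ [ wk ]ᵀ) (var (suc zero)) (transport Λ D [ var zero ∷ wk ⊚ wk ]) ∷ Δ

  Jᶜ         []      Δ Θ d = d
  Jᶜ {k = k} (Λ ▹ D) Δ Θ d =
    Jᶜ Λ (Path-step Λ D Δ) Θ (Jᴱ D (Δ [ ↑ (↑ (↑ (rfl Λ))) ]ᴰ) (Θ [ lift k (↑ (↑ (↑ (rfl Λ)))) ]ᴱ) d)

  transport {n} Λ D = head (Jᶜ Λ (D [ tgt n ]ᵀ ∷ []) ([] ▹ D [ src n ]ᵀ [ wk ]ᵀ) (var zero ∷ []))

  Path : ∀ {n} → Ctx n → Ctx (tri n)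
  Path []      = []
  Path (Λ ▹ D) = Path Λ ⧺ Path-step Λ D []

module Elimination (S : TypeTheory) where
  open TypeTheory S
  open IdentityContexts judgements
  open Structural S

  zip-⊚ : ∀ {l m n} (σ τ p : Sub m n) (ρ : Sub l m) → zip σ τ p ⊚ ρ ≡ zip (σ ⊚ ρ) (τ ⊚ ρ) (p ⊚ ρ)
  zip-⊚ []      []      []      ρ = refl
  zip-⊚ (a ∷ σ) (b ∷ τ) (q ∷ p) ρ = cong (λ x → q [ ρ ] ∷ b [ ρ ] ∷ a [ ρ ] ∷ x) (zip-⊚ σ τ p ρ)

  ⊚wk³ : ∀ {l m n} (σ : Sub m n) (a b c : Tm l) (τ : Sub l m) → σ ⊚ wk ⊚ wk ⊚ wk ⊚ (a ∷ b ∷ c ∷ τ) ≡ σ ⊚ τ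
  ⊚wk³ σ a b c τ = trans (⊚wk-∷ _ _ _) (trans (⊚wk-∷ _ _ _) (⊚wk-∷ _ _ _))

  src-zip : ∀ {m n} (σ τ p : Sub m n) → src n ⊚ zip σ τ p ≡ σ
  src-zip []      []      []      = refl
  src-zip (a ∷ σ) (b ∷ τ) (q ∷ p) =
    cong₂ _∷_ (var-[] _ _) (trans (⊚wk³ _ _ _ _ _) (src-zip σ τ p))

  tgt-zip : ∀ {m n} (σ τ p : Sub m n) → tgt n ⊚ zip σ τ p ≡ τ
  tgt-zip []      []      []      = refl
  tgt-zip (a ∷ σ) (b ∷ τ) (q ∷ p) =
    cong₂ _∷_ (var-[] _ _) (trans (⊚wk³ _ _ _ _ _) (tgt-zip σ τ p))

  path-vars-zip : ∀ {m n} (σ τ p : Sub m n) → path-vars n ⊚ zip σ τ p ≡ p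
  path-vars-zip []      []      []      = refl
  path-vars-zip (a ∷ σ) (b ∷ τ) (q ∷ p) =
    cong₂ _∷_ (var-[] _ _) (trans (⊚wk³ _ _ _ _ _) (path-vars-zip σ τ p))

  tabulate-wk : ∀ {m n} (f : Fin n → Fin m) → tabulate (λ i → var (f i)) ⊚ wk ≡ tabulate (λ i → var (suc (f i)))
  tabulate-wk f = trans (tabulate-⊚ f wk) (tabulate-cong (λ i → lookup∘tabulate (λ j → var (suc j)) (f i)))

  id-⊚wk³ : ∀ n → idₛ {n} ⊚ wk ⊚ wk ⊚ wk ≡ tabulate (λ i → var (suc (suc (suc i))))
  id-⊚wk³ n = trans (cong (λ x → x ⊚ wk ⊚ wk) (tabulate-wk (λ i → i)))
    (trans (cong (_⊚ wk) (tabulate-wk suc)) (tabulate-wk (λ i → suc (suc i))))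

  zip-⊚wk³ : ∀ {m n} (σ τ p : Sub m n) → zip σ τ p ⊚ wk ⊚ wk ⊚ wk ≡
             zip (σ ⊚ wk ⊚ wk ⊚ wk) (τ ⊚ wk ⊚ wk ⊚ wk) (p ⊚ wk ⊚ wk ⊚ wk)
  zip-⊚wk³ σ τ p = trans (cong (λ x → x ⊚ wk ⊚ wk) (zip-⊚ σ τ p wk))
    (trans (cong (_⊚ wk) (zip-⊚ _ _ _ wk)) (zip-⊚ _ _ _ wk))

  zip-vars : ∀ n → zip (src n) (tgt n) (path-vars n) ≡ idₛ
  zip-vars zero    = refl
  zip-vars (suc n) = cong (λ x → var zero ∷ var (suc zero) ∷ var (suc (suc zero)) ∷ x)
    (trans (sym (zip-⊚wk³ (src n) (tgt n) (path-vars n)))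
      (trans (cong (λ x → x ⊚ wk ⊚ wk ⊚ wk) (zip-vars n)) (id-⊚wk³ (tri n))))

  rs-⊚ : ∀ {l m n} (Φ : Ctx n) (σ : Sub m n) (τ : Sub l m) → rs Φ σ ⊚ τ ≡ rs Φ (σ ⊚ τ)
  rs-⊚ []      []      τ = refl
  rs-⊚ (Φ ▹ D) (a ∷ σ) τ = cong₂ _∷_ (trans (r-[] _ a τ) (cong (λ A → r A (a [ τ ])) ([⊚]ᵀ D σ τ))) (rs-⊚ Φ σ τ)

  rfl-⊚ : ∀ {m n} (Φ : Ctx n) (σ : Sub m n) → rfl Φ ⊚ σ ≡ zip σ σ (rs Φ σ)
  rfl-⊚ Φ σ = trans (zip-⊚ idₛ idₛ (rs Φ idₛ) σ)
    (trans (cong₂ (λ x y → zip x x y) (id-⊚ σ) (rs-⊚ Φ idₛ σ)) (cong (λ x → zip σ σ (rs Φ x)) (id-⊚ σ)))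

  src-rfl : ∀ {n} (Φ : Ctx n) → src n ⊚ rfl Φ ≡ idₛ
  src-rfl Φ = src-zip idₛ idₛ _

  tgt-rfl : ∀ {n} (Φ : Ctx n) → tgt n ⊚ rfl Φ ≡ idₛ
  tgt-rfl Φ = tgt-zip idₛ idₛ _

  rfl-▹ : ∀ {n} (Λ : Ctx n) D → rfl (Λ ▹ D) ≡ r (D [ wk ]ᵀ) (var zero) ∷ var zero ∷ var zero ∷ rfl Λ ⊚ wk
  rfl-▹ Λ D = cong (λ x → r (D [ wk ]ᵀ) (var zero) ∷ var zero ∷ var zero ∷ x) (sym (rfl-⊚ Λ wk))

  ↑³-∷ : ∀ {l m n} (σ : Sub m n) (a b c : Tm l) (τ : Sub l m) →
         ↑ (↑ (↑ σ)) ⊚ (a ∷ b ∷ c ∷ τ) ≡ a ∷ b ∷ c ∷ σ ⊚ τ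
  ↑³-∷ σ a b c τ = trans (↑-∷ (↑ (↑ σ)) a (b ∷ c ∷ τ))
    (cong (a ∷_) (trans (↑-∷ (↑ σ) b (c ∷ τ)) (cong (b ∷_) (↑-∷ σ c τ))))

  Id≡ : ∀ {n} {A A′ : Ty n} {a a′ b b′ : Tm n} → A ≡ A′ → a ≡ a′ → b ≡ b′ → Id A a b ≡ Id A′ a′ b′
  Id≡ refl refl refl = refl

  ↑³-refl-path : ∀ {n} (Λ : Ctx n) D → ↑ (↑ (↑ (rfl Λ))) ⊚ refl-path D ≡ rfl (Λ ▹ D)
  ↑³-refl-path Λ D = trans (↑³-∷ (rfl Λ) _ _ _ wk) (sym (rfl-▹ Λ D))

  ∋-[] : ∀ {m n k} {Γ : Ctx m} {Ξ : Ctx n} {τ ts} (Θ : Ext n k) → Ξ ⊢ Θ ∋ ts → Γ ⊢ τ ⇛ Ξ → Γ ⊢ Θ [ τ ]ᴱ ∋ ts ⊚ τ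
  ∋-[] {ts = []}     []      _           s = id⇛ (dom s)
  ∋-[] {ts = t ∷ ts} (Θ ▹ A) (ext e B a) s =
    ext (∋-[] Θ e s) (subst-type (lift₊⇛ Θ s (cod e)) B)
        (subst-term s a ∶≡ trans ([]-[]ᵀ A (++id-⊚ ts _)) (sym ([⊚]ᵀ A _ _)))

  ∋-[]-≐ : ∀ {m n k} {Γ : Ctx m} {Ξ : Ctx n} {τ ts us} (Θ : Ext n k) → Ξ ⊢ Θ ∋ ts ≐ us → Γ ⊢ τ ⇛ Ξ →
           Γ ⊢ Θ [ τ ]ᴱ ∋ ts ⊚ τ ≐ us ⊚ τ
  ∋-[]-≐ {ts = []}     {us = []}     []      _           s = ⇛-refl (id⇛ (dom s))
  ∋-[]-≐ {ts = t ∷ ts} {us = u ∷ us} (Θ ▹ A) (ext e B a) s =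
    ext (∋-[]-≐ Θ e s) (subst-type (lift₊⇛ Θ s (cod (⇛-left e))) B)
        (subst-term-≐ (⇛-refl s) a ≐≡ trans ([]-[]ᵀ A (++id-⊚ ts _)) (sym ([⊚]ᵀ A _ _)))

  ∋-converts : ∀ {m k} {Γ Γ′ : Ctx m} {ts} (Θ : Ext m k) → Converts Γ Γ′ → Γ ⊢ Θ ∋ ts → Γ′ ⊢ Θ ∋ ts
  ∋-converts Θ c e = ctx-⇛ c (▹▹-converts Θ c (cod e)) e

  ∋-converts-≐ : ∀ {m k} {Γ Γ′ : Ctx m} {ts us} (Θ : Ext m k) → Converts Γ Γ′ → Γ ⊢ Θ ∋ ts ≐ us → Γ′ ⊢ Θ ∋ ts ≐ us
  ∋-converts-≐ Θ c e = ctx-⇛-≐ c (▹▹-converts Θ c (cod (⇛-left e))) e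

  head-∋ : ∀ {m} {Γ : Ctx m} {A} (ts : Sub m 1) → Γ ⊢ ([] ▹ A) ∋ ts → Γ ⊢ head ts ∶ A
  head-∋ (t ∷ []) (ext _ _ a) = a ∶≡ [id]ᵀ _

  head-∋-≐ : ∀ {m} {Γ : Ctx m} {A} (ts us : Sub m 1) → Γ ⊢ ([] ▹ A) ∋ ts ≐ us → Γ ⊢ head ts ≐ head us ∶ A
  head-∋-≐ (t ∷ []) (u ∷ []) (ext _ _ a) = a ≐≡ [id]ᵀ _

  path-wf : ∀ {n} {Γ : Ctx n} {A} → Γ ⊢ A type → ⊢ path Γ A
  path-wf A = context-of A ▹ A ▹ A′ ▹ Id-form (variables (context-of A ▹ A ▹ A′) (suc zero)) (v₀∶ A′)
    where A′ = wk-type A A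

  refl-path⇛ : ∀ {n} {Γ : Ctx n} {A} → Γ ⊢ A type → Γ ▹ A ⊢ refl-path A ⇛ path Γ A
  refl-path⇛ {A = A} B = helper (path-wf B)
    where
    helper : ⊢ path _ A → _
    helper (w ▹ B ▹ B′ ▹ C) =
      ext (ext (ext (wk⇛ B) B (v₀∶ B)) B′ (v₀∶ B ∶≡ sym ([]-[]ᵀ A (wk-∷ _ _)))) C
        (r-intro (v₀∶ B) ∶≡ sym (trans (Id-[] _ _ _ _)
          (Id≡ (trans ([]-[]ᵀ (A [ wk ]ᵀ) (wk-∷ _ _)) ([]-[]ᵀ A (wk-∷ _ _))) (v₁ _ _ _) (v₀ _ _))))

  Jᴱ-elim : ∀ {n k l} {Γ : Ctx n} {A} (Δ : Tele (3 + n) k) (Θ : Ext (3 + n ⊞ k) l) {d} →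
            ⊢ (path Γ A ⧺ Δ) ▹▹ Θ →
            (Γ ▹ A) ⧺ Δ [ refl-path A ]ᴰ ⊢ Θ [ lift k (refl-path A) ]ᴱ ∋ d →
            (path Γ A ⧺ Δ ⊢ Θ ∋ Jᴱ A Δ Θ d) ×
            ((Γ ▹ A) ⧺ Δ [ refl-path A ]ᴰ ⊢ Θ [ lift k (refl-path A) ]ᴱ ∋ Jᴱ A Δ Θ d ⊚ lift k (refl-path A) ≐ d)
  Jᴱ-elim Δ []      {[]}     w       e = id⇛ w , ⇛-refl (id⇛ (dom e))
  Jᴱ-elim {n} {k} {Γ = Γ} {A} Δ (_▹_ {l} Θ C) {d ∷ ds} (w ▹ C∶) (ext e C′∶ d∶) =
    ext es∶ C∶ (J-elim Ces∶ d∶′) ,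
    ext es≐ C′∶ (J-comp Ces∶ d∶′ ≐≡ eq)
    where
    ρ = lift k (refl-path A)
    es = Jᴱ A Δ Θ ds
    ih = Jᴱ-elim Δ Θ w e
    es∶ = proj₁ ih
    es≐ = proj₂ ih
    Ces∶ : path Γ A ⧺ Δ ⊢ C [ es ++ idₛ ]ᵀ type
    Ces∶ = subst-type es∶ C∶
    A∶ : ⊢ path Γ A → Γ ⊢ A type
    A∶ (_ ▹ A ▹ _ ▹ _) = A
    ρ∶ : (Γ ▹ A) ⧺ Δ [ refl-path A ]ᴰ ⊢ ρ ⇛ path Γ A ⧺ Δ
    ρ∶ = lift⇛ Δ (refl-path⇛ (A∶ (⧺-prefix Δ (▹▹-prefix Θ w)))) (▹▹-prefix Θ w)
    eq : C [ es ++ idₛ ]ᵀ [ ρ ]ᵀ ≡ C [ lift₊ l ρ ]ᵀ [ es ⊚ ρ ++ idₛ ]ᵀ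
    eq = trans ([]-[]ᵀ C (++id-⊚ es ρ)) (sym ([⊚]ᵀ C _ _))
    d∶′ : (Γ ▹ A) ⧺ Δ [ refl-path A ]ᴰ ⊢ d ∶ C [ es ++ idₛ ]ᵀ [ ρ ]ᵀ
    d∶′ = conv d∶ (teq≡ refl (sym eq) (subst-type-≐ (⇛-sym es≐) (≐ᵀ-refl C′∶)))

  IsElim : ∀ {n} → Ctx n → Set
  IsElim {n} Φ = ∀ {k l} (Δ : Tele (tri n) k) (Θ : Ext (tri n ⊞ k) l) {d} →
    ⊢ (Path Φ ⧺ Δ) ▹▹ Θ →
    Φ ⧺ Δ [ rfl Φ ]ᴰ ⊢ Θ [ lift k (rfl Φ) ]ᴱ ∋ d →
    (Path Φ ⧺ Δ ⊢ Θ ∋ Jᶜ Φ Δ Θ d) ×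
    (Φ ⧺ Δ [ rfl Φ ]ᴰ ⊢ Θ [ lift k (rfl Φ) ]ᴱ ∋ Jᶜ Φ Δ Θ d ⊚ lift k (rfl Φ) ≐ d)

  record PathFacts {n} (Φ : Ctx n) : Set where
    field
      Path-wf : ⊢ Path Φ
      src∶    : Path Φ ⊢ src n ⇛ Φ
      tgt∶    : Path Φ ⊢ tgt n ⇛ Φ
      rfl∶    : Φ ⊢ rfl Φ ⇛ Path Φ
      elim    : IsElim Φ

  module Step {n} {Λ : Ctx n} (F : PathFacts Λ) {D} (D∶ : Λ ⊢ D type) where
    open PathFacts F

    Ds∶ : Path Λ ⊢ D [ src n ]ᵀ type
    Ds∶ = subst-type src∶ D∶
    Dt∶ : Path Λ ⊢ D [ tgt n ]ᵀ type
    Dt∶ = subst-type tgt∶ D∶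

    src-type : D [ src n ]ᵀ [ rfl Λ ]ᵀ ≡ D
    src-type = trans ([⊚]ᵀ D _ _) ([]-id D (src-rfl Λ))
    tgt-type : D [ tgt n ]ᵀ [ rfl Λ ]ᵀ ≡ D
    tgt-type = trans ([⊚]ᵀ D _ _) ([]-id D (tgt-rfl Λ))
    wk-src-type : D [ src n ]ᵀ [ wk ]ᵀ [ ↑ (rfl Λ) ]ᵀ ≡ D [ wk ]ᵀ
    wk-src-type = trans (trans ([]-[]ᵀ _ (wk-↑ (rfl Λ))) (sym ([⊚]ᵀ _ _ _))) (cong (_[ wk ]ᵀ) src-type)
    wk-tgt-type : D [ tgt n ]ᵀ [ wk ]ᵀ [ ↑ (rfl Λ) ]ᵀ ≡ D [ wk ]ᵀ
    wk-tgt-type = trans (trans ([]-[]ᵀ _ (wk-↑ (rfl Λ))) (sym ([⊚]ᵀ _ _ _))) (cong (_[ wk ]ᵀ) tgt-type)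

    private
      v∶ : Λ ▹ D [ tgt n ]ᵀ [ rfl Λ ]ᵀ ⊢ ([] ▹ D [ src n ]ᵀ [ wk ]ᵀ [ ↑ (rfl Λ) ]ᵀ) ∋ (var zero ∷ [])
      v∶ = ext (id⇛ (context-of R∶ ▹ R∶)) (subst-type (↑⇛ rfl∶ Dt∶) (wk-type Dt∶ Ds∶))
               (v₀∶ R∶ ∶≡ trans (cong (_[ wk ]ᵀ) tgt-type) (trans (sym wk-src-type) (sym ([id]ᵀ _))))
        where R∶ = subst-type rfl∶ Dt∶

      tr-elim = elim (D [ tgt n ]ᵀ ∷ []) ([] ▹ D [ src n ]ᵀ [ wk ]ᵀ) {var zero ∷ []} (Path-wf ▹ Dt∶ ▹ wk-type Dt∶ Ds∶) v∶

    transport∶ : Path Λ ▹ D [ tgt n ]ᵀ ⊢ transport Λ D ∶ D [ src n ]ᵀ [ wk ]ᵀ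
    transport∶ = head-∋ (Jᶜ Λ (D [ tgt n ]ᵀ ∷ []) ([] ▹ D [ src n ]ᵀ [ wk ]ᵀ) (var zero ∷ [])) (proj₁ tr-elim)

    transport-comp : Λ ▹ D ⊢ transport Λ D [ ↑ (rfl Λ) ] ≐ var zero ∶ D [ wk ]ᵀ
    transport-comp = subst (λ A → Λ ▹ A ⊢ transport Λ D [ ↑ (rfl Λ) ] ≐ var zero ∶ D [ wk ]ᵀ) tgt-type
      (eq≡ (head-map ts) refl wk-src-type (head-∋-≐ (ts ⊚ ↑ (rfl Λ)) (var zero ∷ []) (proj₂ tr-elim)))
      where
      ts = Jᶜ Λ (D [ tgt n ]ᵀ ∷ []) ([] ▹ D [ src n ]ᵀ [ wk ]ᵀ) (var zero ∷ [])
      head-map : ∀ {m l} {τ : Sub l m} (ts : Sub m 1) → head (ts ⊚ τ) ≡ head ts [ τ ]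
      head-map (t ∷ []) = refl

    transport-at : ∀ {m} {Γ : Ctx m} {u a} → Γ ⊢ u ⇛ Path Λ → Γ ⊢ a ∶ D [ tgt n ⊚ u ]ᵀ →
                   Γ ⊢ transport Λ D [ a ∷ u ] ∶ D [ src n ⊚ u ]ᵀ
    transport-at u a = subst-term (ext u Dt∶ (a ∶≡ sym ([⊚]ᵀ D _ _))) transport∶ ∶≡
                       trans ([]-[]ᵀ _ (wk-∷ _ _)) ([⊚]ᵀ D _ _)

    transport-rfl : ∀ {m} {Γ : Ctx m} {σ a} → Γ ⊢ σ ⇛ Λ → Γ ⊢ a ∶ D [ σ ]ᵀ →
                    Γ ⊢ transport Λ D [ a ∷ rfl Λ ⊚ σ ] ≐ a ∶ D [ σ ]ᵀ
    transport-rfl s a = eq≡ ([]-[] _ (↑-∷ _ _ _)) (v₀ _ _) ([]-[]ᵀ D (wk-∷ _ _))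
      (subst-term-≐ (⇛-refl (ext s D∶ a)) transport-comp)

    Id-type : Ty (2 + tri n)
    Id-type = Id (D [ src n ]ᵀ [ wk ]ᵀ [ wk ]ᵀ) (var (suc zero)) (transport Λ D [ var zero ∷ wk ⊚ wk ])

    Id-type-at : ∀ {m} (u : Sub m (tri n)) y y′ →
                 Id-type [ y′ ∷ y ∷ u ]ᵀ ≡ Id (D [ src n ⊚ u ]ᵀ) y (transport Λ D [ y′ ∷ u ])
    Id-type-at u y y′ = trans (Id-[] _ _ _ _)
      (Id≡ (trans ([]-[]ᵀ _ (wk-∷ _ _)) (trans ([]-[]ᵀ _ (wk-∷ _ _)) ([⊚]ᵀ D _ _))) (v₁ _ _ _)
           ([]-[] _ (cong₂ _∷_ (v₀ _ _) (trans (⊚wk-∷ _ _ _) (wk-∷ _ _)))))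

    wkwk : ∀ {m} {Γ : Ctx m} {A B} → Γ ⊢ A type → Γ ▹ A ⊢ B type → Γ ▹ A ▹ B ⊢ wk ⊚ wk ⇛ Γ
    wkwk A B = ⇛-comp (wk⇛ A) (wk⇛ B)

    Id-type∶ : Path Λ ▹ D [ src n ]ᵀ ▹ D [ tgt n ]ᵀ [ wk ]ᵀ ⊢ Id-type type
    Id-type∶ = Id-form (variables (Path-wf ▹ Ds∶ ▹ wk-type Ds∶ Dt∶) (suc zero))
      (transport-at (wkwk Ds∶ (wk-type Ds∶ Dt∶)) (v₀∶ (wk-type Ds∶ Dt∶) ∶≡ trans ([⊚]ᵀ _ _ _) ([⊚]ᵀ D _ _))
        ∶≡ trans (sym ([⊚]ᵀ D _ _)) (sym ([⊚]ᵀ _ _ _)))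

    Path-wf′ : ⊢ Path (Λ ▹ D)
    Path-wf′ = Path-wf ▹ Ds∶ ▹ wk-type Ds∶ Dt∶ ▹ Id-type∶

    zip∶ : ∀ {m} {Γ : Ctx m} {u y y′ q} → Γ ⊢ u ⇛ Path Λ → Γ ⊢ y ∶ D [ src n ⊚ u ]ᵀ → Γ ⊢ y′ ∶ D [ tgt n ⊚ u ]ᵀ →
           Γ ⊢ q ∶ Id (D [ src n ⊚ u ]ᵀ) y (transport Λ D [ y′ ∷ u ]) → Γ ⊢ q ∷ y′ ∷ y ∷ u ⇛ Path (Λ ▹ D)
    zip∶ u y y′ q =
      ext (ext (ext u Ds∶ (y ∶≡ sym ([⊚]ᵀ D _ _))) (wk-type Ds∶ Dt∶) (y′ ∶≡ sym (trans ([]-[]ᵀ _ (wk-∷ _ _)) ([⊚]ᵀ D _ _))))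
          Id-type∶ (q ∶≡ sym (Id-type-at _ _ _))

    wk³ : ∀ {m} {Γ : Ctx m} {σ A B C} → Path Λ ⊢ σ ⇛ Γ → Path Λ ⊢ A type → Path Λ ▹ A ⊢ B type → Path Λ ▹ A ▹ B ⊢ C type →
          Path Λ ▹ A ▹ B ▹ C ⊢ σ ⊚ wk ⊚ wk ⊚ wk ⇛ Γ
    wk³ s A B C = ⇛-comp (⇛-comp (⇛-comp s (wk⇛ A)) (wk⇛ B)) (wk⇛ C)

    wk³-type : ∀ {m} (σ : Sub m n) → D [ σ ]ᵀ [ wk ]ᵀ [ wk ]ᵀ [ wk ]ᵀ ≡ D [ σ ⊚ wk ⊚ wk ⊚ wk ]ᵀ
    wk³-type σ = trans (cong (_[ wk ]ᵀ) (trans (cong (_[ wk ]ᵀ) ([⊚]ᵀ D _ _)) ([⊚]ᵀ D _ _))) ([⊚]ᵀ D _ _)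

    src∶′ : Path (Λ ▹ D) ⊢ src (suc n) ⇛ Λ ▹ D
    src∶′ = ext (wk³ src∶ Ds∶ (wk-type Ds∶ Dt∶) Id-type∶) D∶
      (variables Path-wf′ (suc (suc zero)) ∶≡ wk³-type (src n))

    tgt∶′ : Path (Λ ▹ D) ⊢ tgt (suc n) ⇛ Λ ▹ D
    tgt∶′ = ext (wk³ tgt∶ Ds∶ (wk-type Ds∶ Dt∶) Id-type∶) D∶
      (variables Path-wf′ (suc zero) ∶≡ wk³-type (tgt n))

    rfl∶′ : Λ ▹ D ⊢ rfl (Λ ▹ D) ⇛ Path (Λ ▹ D)
    rfl∶′ = ⇛≡ (sym (rfl-▹ Λ D))
      (zip∶ (⇛-comp rfl∶ (wk⇛ D∶)) (v₀∶ D∶ ∶≡ sym s≡) (v₀∶ D∶ ∶≡ sym t≡)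
        (conv (r-intro (v₀∶ D∶)) (teq≡ refl (Id≡ (sym s≡) refl refl)
          (Id-cong (≐ᵀ-refl (wk-type D∶ D∶)) (≐-refl (v₀∶ D∶)) (≐-sym (transport-rfl (wk⇛ D∶) (v₀∶ D∶)))))))
      where
      s≡ : D [ src n ⊚ (rfl Λ ⊚ wk) ]ᵀ ≡ D [ wk ]ᵀ
      s≡ = cong (D [_]ᵀ) (trans (sym (⊚-assoc _ _ _)) (trans (cong (_⊚ wk) (src-rfl Λ)) (id-⊚ wk)))
      t≡ : D [ tgt n ⊚ (rfl Λ ⊚ wk) ]ᵀ ≡ D [ wk ]ᵀ
      t≡ = cong (D [_]ᵀ) (trans (sym (⊚-assoc _ _ _)) (trans (cong (_⊚ wk) (tgt-rfl Λ)) (id-⊚ wk)))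

    restricted : Converts (path Λ D) (Λ ⧺ Path-step Λ D [] [ rfl Λ ]ᴰ)
    restricted = ▹-converts (▹-converts (▹-converts (id-converts (context-of D∶)) e₁) e₂) e₃
      where
      e₁ : Λ ⊢ D ≐ D [ src n ]ᵀ [ rfl Λ ]ᵀ type
      e₁ = teq≡ refl (sym src-type) (≐ᵀ-refl D∶)
      e₂ : Λ ▹ D ⊢ D [ wk ]ᵀ ≐ D [ tgt n ]ᵀ [ wk ]ᵀ [ ↑ (rfl Λ) ]ᵀ type
      e₂ = teq≡ refl (sym wk-tgt-type) (≐ᵀ-refl (wk-type D∶ D∶))
      D′ = wk-type D∶ D∶
      a = variables (context-of D∶ ▹ D∶ ▹ D′) (suc zero)
      b = v₀∶ D′
      wkD : D [ wk ]ᵀ [ wk ]ᵀ ≡ D [ wk ⊚ wk ]ᵀ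
      wkD = [⊚]ᵀ D _ _
      t≐ : Λ ▹ D ▹ D [ wk ]ᵀ ⊢ transport Λ D [ var zero ∷ rfl Λ ⊚ (wk ⊚ wk) ] ≐ var zero ∶ D [ wk ⊚ wk ]ᵀ
      t≐ = transport-rfl (wkwk D∶ D′) (b ∶≡ wkD)
      ↑↑≡ : ↑ (↑ (rfl Λ)) ≡ var zero ∷ var (suc zero) ∷ rfl Λ ⊚ (wk ⊚ wk)
      ↑↑≡ = cong (var zero ∷_) (cong₂ _∷_ (trans (var-[] zero wk) refl) (⊚-assoc _ _ _))
      e₃ : Λ ▹ D ▹ D [ wk ]ᵀ ⊢ Id (D [ wk ]ᵀ [ wk ]ᵀ) (var (suc zero)) (var zero) ≐ Id-type [ ↑ (↑ (rfl Λ)) ]ᵀ type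
      e₃ = teq≡ refl (sym (trans (cong (Id-type [_]ᵀ) ↑↑≡) (Id-type-at _ _ _)))
        (Id-cong (teq≡ refl (sym (trans (cong (D [_]ᵀ) (trans (sym (⊚-assoc _ _ _)) (trans (cong (_⊚ (wk ⊚ wk)) (src-rfl Λ)) (id-⊚ _)))) (sym wkD))) (≐ᵀ-refl (wk-type D′ D′)))
          (≐-refl a) (≐-sym t≐ ≐≡ sym wkD))

    elim′ : IsElim (Λ ▹ D)
    elim′ {k} {l} Δ Θ {d} w d∶ = proj₁ step₂ , coe-≐ eqΔ eqΘ (cong (lift k) rfl≡) (⇛-trans step₃ (proj₂ step₁))
      where
      ρ₁ = ↑ (↑ (↑ (rfl Λ)))
      ρ₂ = refl-path D
      Δ₁ = Δ [ ρ₁ ]ᴰ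
      Θ₁ = Θ [ lift k ρ₁ ]ᴱ
      rfl≡ : ρ₁ ⊚ ρ₂ ≡ rfl (Λ ▹ D)
      rfl≡ = ↑³-refl-path Λ D
      eqΔ : Δ₁ [ ρ₂ ]ᴰ ≡ Δ [ rfl (Λ ▹ D) ]ᴰ
      eqΔ = trans ([⊚]ᴰ Δ _ _) (cong (Δ [_]ᴰ) rfl≡)
      eqΘ : Θ₁ [ lift k ρ₂ ]ᴱ ≡ Θ [ lift k (rfl (Λ ▹ D)) ]ᴱ
      eqΘ = trans ([⊚]ᴱ Θ _ _) (cong (Θ [_]ᴱ) (trans (lift-⊚ k _ _) (cong (lift k) rfl≡)))
      coe : ∀ {m k l} {Γ : Ctx m} {Δ Δ′ : Tele m k} {Θ Θ′ : Ext (m ⊞ k) l} {d} → Δ ≡ Δ′ → Θ ≡ Θ′ →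
            Γ ⧺ Δ′ ⊢ Θ′ ∋ d → Γ ⧺ Δ ⊢ Θ ∋ d
      coe refl refl e = e
      coe-≐ : ∀ {m j k l} {Γ : Ctx m} {Δ Δ′ : Tele m k} {Θ Θ′ : Ext (m ⊞ k) l} {ρ ρ′ : Sub (m ⊞ k) j} {t d} →
              Δ ≡ Δ′ → Θ ≡ Θ′ → ρ ≡ ρ′ → Γ ⧺ Δ ⊢ Θ ∋ t ⊚ ρ ≐ d → Γ ⧺ Δ′ ⊢ Θ′ ∋ t ⊚ ρ′ ≐ d
      coe-≐ refl refl refl e = e
      wΔ : ⊢ Path Λ ⧺ Path-step Λ D Δ
      wΔ = ▹▹-prefix Θ w
      ρ₁∶ : Λ ⧺ Path-step Λ D Δ [ rfl Λ ]ᴰ ⊢ lift k ρ₁ ⇛ Path Λ ⧺ Path-step Λ D Δ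
      ρ₁∶ = lift⇛ (Path-step Λ D Δ) rfl∶ wΔ
      c : Converts (path Λ D ⧺ Δ₁) (Λ ⧺ Path-step Λ D Δ [ rfl Λ ]ᴰ)
      c = sym-converts (⧺-converts Δ₁ (sym-converts restricted) (dom ρ₁∶))
      step₁ = Jᴱ-elim Δ₁ Θ₁ (dom (lift₊⇛ Θ (⇛≡ (⊚-id _) (⇛-comp ρ₁∶ (to c))) w)) (coe eqΔ eqΘ d∶)
      step₂ = elim (Path-step Λ D Δ) Θ w (∋-converts Θ₁ c (proj₁ step₁))
      step₃ : (Λ ▹ D) ⧺ Δ₁ [ ρ₂ ]ᴰ ⊢ Θ₁ [ lift k ρ₂ ]ᴱ ∋
              Jᶜ (Λ ▹ D) Δ Θ d ⊚ lift k (ρ₁ ⊚ ρ₂) ≐ Jᴱ D Δ₁ Θ₁ d ⊚ lift k ρ₂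
      step₃ = ⇛≐≡ (cong (_++ idₛ) (trans (⊚-assoc _ _ _) (cong (Jᶜ (Λ ▹ D) Δ Θ d ⊚_) (lift-⊚ k ρ₁ ρ₂)))) refl
        (∋-[]-≐ Θ₁ (∋-converts-≐ Θ₁ (sym-converts c) (proj₂ step₂)) (lift⇛ Δ₁ (refl-path⇛ D∶) (dom (to c))))

  pathFacts : ∀ {n} {Φ : Ctx n} → ⊢ Φ → PathFacts Φ
  pathFacts []       = record { Path-wf = [] ; src∶ = [] [] ; tgt∶ = [] [] ; rfl∶ = [] [] ; elim = elim-[] }
    where
    elim-[] : IsElim []
    elim-[] {k} Δ Θ {d} w e =
      coe (sym ([id]ᴰ Δ)) (sym (trans (cong (Θ [_]ᴱ) (lift-id k)) ([id]ᴱ Θ))) e ,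
      ⇛≐≡ (cong (_++ idₛ) (sym (trans (cong (d ⊚_) (lift-id k)) (⊚-id d)))) refl (⇛-refl e)
      where
      coe : ∀ {m k l} {Γ : Ctx m} {Δ Δ′ : Tele m k} {Θ Θ′ : Ext (m ⊞ k) l} {d} → Δ ≡ Δ′ → Θ ≡ Θ′ →
            Γ ⧺ Δ′ ⊢ Θ′ ∋ d → Γ ⧺ Δ ⊢ Θ ∋ d
      coe refl refl e = e

  pathFacts (w ▹ D∶) = record { Path-wf = Path-wf′ ; src∶ = src∶′ ; tgt∶ = tgt∶′ ; rfl∶ = rfl∶′ ; elim = elim′ }
    where open Step (pathFacts w) D∶

module Operations (𝒥 : Judgements) where
  open Judgements 𝒥
  open Contexts 𝒥
  open IdentityContexts 𝒥

  -- Projections from a scope extended by a block of l variables.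

  wk₊ : ∀ l {n} → Sub (l + n) n
  wk₊ zero    = idₛ
  wk₊ (suc l) = wk₊ l ⊚ wk

  vars₊ : ∀ l {n} → Sub (l + n) l
  vars₊ zero    = []
  vars₊ (suc l) = var zero ∷ vars₊ l ⊚ wk

  -- The context Φ, and the context Id_Φ(σ,τ), as telescopes over a given scope.

  weaken : ∀ {n} m → Ctx n → Ext m n
  weaken           m []      = []
  weaken {suc n}   m (Φ ▹ A) = weaken m Φ ▹ A [ vars₊ n ]ᵀ

  IdCtx : ∀ {m n} → Ctx n → Sub m n → Sub m n → Ext m n
  IdCtx           []      []      []       = []
  IdCtx {n = suc n} (Φ ▹ D) (y ∷ σ) (y′ ∷ τ) = IdCtx Φ σ τ ▹
    Id (D [ σ ⊚ wk₊ n ]ᵀ) (y [ wk₊ n ]) (transport Φ D [ y′ [ wk₊ n ] ∷ zip (σ ⊚ wk₊ n) (τ ⊚ wk₊ n) (vars₊ n) ])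

  -- Θ followed by Δ; split and join are the two renamings that identify the resulting scopes.

  prepend : ∀ {n l k} → Ext n l → Tele (l + n) k → Tele n (k ⊞ l)
  prepend []      Δ = Δ
  prepend (Θ ▹ A) Δ = prepend Θ (A ∷ Δ)

  join : ∀ l {n k} → Sub ((l + n) ⊞ k) (n ⊞ (k ⊞ l))
  join zero            = idₛ
  join (suc l) {n} {k} = join l {n} {suc k}

  split : ∀ l {n k} → Sub (n ⊞ (k ⊞ l)) ((l + n) ⊞ k)
  split zero            = idₛ
  split (suc l) {n} {k} = split l {n} {suc k}

  -- The telescope (x : Φ, p : Id_Φ(x,b)) followed by Δ.

  path-to : ∀ {m n k} → Ctx n → Sub m n → Tele (n + (n + m)) k → Tele m (k ⊞ n ⊞ n)
  path-to {m} {n} Φ b Δ = prepend (weaken m Φ) (prepend (IdCtx Φ (vars₊ n) (b ⊚ wk₊ n)) Δ)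

  join₂ : ∀ m n k → Sub ((n + (n + m)) ⊞ k) (m ⊞ (k ⊞ n ⊞ n))
  join₂ m n k = join n {m} {k ⊞ n} ⊚ join n {n + m} {k}

  split₂ : ∀ m n k → Sub (m ⊞ (k ⊞ n ⊞ n)) ((n + (n + m)) ⊞ k)
  split₂ m n k = split n {n + m} {k} ⊚ split n {m} {k ⊞ n}

  -- q ∘ p over (y, z : Φ, q : Id_Φ(y,z), x : Φ, p : Id_Φ(x,y)), and at given arguments.

  compose : ∀ {n} → Ctx n → Sub (tri n ⊞ (0 ⊞ n ⊞ n)) n
  compose {n} Φ = Jᶜ Φ (path-to Φ (src n) [])
    (IdCtx Φ (vars₊ n ⊚ wk₊ n ⊚ split₂ (tri n) n 0) (tgt n ⊚ wk₊ n ⊚ wk₊ n ⊚ split₂ (tri n) n 0))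
    (vars₊ n ⊚ split₂ n n 0)

  compose-at : ∀ {m n} → Ctx n → (x y z p q : Sub m n) → Sub m n
  compose-at {n = n} Φ x y z p q = compose Φ ⊚ (join₂ (tri n) n 0 ⊚ (p ++ (x ++ zip y z q)))

  -- h•(p) over (x, x′ : Φ, p : Id_Φ(x,x′)).

  ap : ∀ {m n} → Ctx m → Ctx n → Sub m n → Sub (tri m) n
  ap {m} Φ Ψ h = Jᶜ Φ [] (IdCtx Ψ (h ⊚ src m) (h ⊚ tgt m)) (rs Ψ h)

module OperationLemmas (S : TypeTheory) where
  open TypeTheory S
  open IdentityContexts judgements
  open Operations judgements
  open Structural S
  open Elimination S

  wk₊-++ : ∀ {l m n} (ts : Sub m l) (σ : Sub m n) → wk₊ l ⊚ (ts ++ σ) ≡ σ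
  wk₊-++ []       σ = id-⊚ σ
  wk₊-++ (t ∷ ts) σ = trans (⊚wk-∷ _ t _) (wk₊-++ ts σ)

  vars₊-++ : ∀ {l m n} (ts : Sub m l) (σ : Sub m n) → vars₊ l ⊚ (ts ++ σ) ≡ ts
  vars₊-++ []       σ = refl
  vars₊-++ (t ∷ ts) σ = cong₂ _∷_ (v₀ _ _) (trans (⊚wk-∷ _ t _) (vars₊-++ ts σ))

  wk₊-lift₊ : ∀ l {m n} (σ : Sub m n) → wk₊ l ⊚ lift₊ l σ ≡ σ ⊚ wk₊ l
  wk₊-lift₊ zero    σ = trans (id-⊚ σ) (sym (⊚-id σ))
  wk₊-lift₊ (suc l) σ = trans (⊚wk-∷ _ _ _) (trans (sym (⊚-assoc _ _ _)) (trans (cong (_⊚ wk) (wk₊-lift₊ l σ)) (⊚-assoc _ _ _)))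

  vars₊-lift₊ : ∀ l {m n} (σ : Sub m n) → vars₊ l ⊚ lift₊ l σ ≡ vars₊ l
  vars₊-lift₊ zero    σ = refl
  vars₊-lift₊ (suc l) σ = cong₂ _∷_ (v₀ _ _) (trans (⊚wk-∷ _ _ _) (trans (sym (⊚-assoc _ _ _)) (cong (_⊚ wk) (vars₊-lift₊ l σ))))

  weaken-[] : ∀ {n l m} (Φ : Ctx n) (σ : Sub l m) → weaken m Φ [ σ ]ᴱ ≡ weaken l Φ
  weaken-[] []      σ = refl
  weaken-[] {suc n} (Φ ▹ A) σ = cong₂ _▹_ (weaken-[] Φ σ) ([]-[]ᵀ A (vars₊-lift₊ n σ))

  ⊚wk₊-lift₊ : ∀ {l m n k} (ρ : Sub n k) (σ : Sub m n) → ρ ⊚ wk₊ l ⊚ lift₊ l σ ≡ ρ ⊚ σ ⊚ wk₊ l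
  ⊚wk₊-lift₊ {l} ρ σ = trans (⊚-assoc _ _ _) (trans (cong (ρ ⊚_) (wk₊-lift₊ l σ)) (sym (⊚-assoc _ _ _)))

  ⊚wk₊-++ : ∀ {l m n k} (ρ : Sub n k) (ts : Sub m l) (σ : Sub m n) → ρ ⊚ wk₊ l ⊚ (ts ++ σ) ≡ ρ ⊚ σ
  ⊚wk₊-++ ρ ts σ = trans (⊚-assoc _ _ _) (cong (ρ ⊚_) (wk₊-++ ts σ))

  IdCtx-[] : ∀ {n l m} (Φ : Ctx n) (σ τ : Sub m n) (ρ : Sub l m) → IdCtx Φ σ τ [ ρ ]ᴱ ≡ IdCtx Φ (σ ⊚ ρ) (τ ⊚ ρ)
  IdCtx-[] []      []      []      ρ = refl
  IdCtx-[] {suc n} (Φ ▹ D) (y ∷ σ) (y′ ∷ τ) ρ = cong₂ _▹_ (IdCtx-[] Φ σ τ ρ)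
    (trans (Id-[] _ _ _ _) (Id≡ ([]-[]ᵀ D (⊚wk₊-lift₊ σ ρ))
      (trans ([]-[] y (wk₊-lift₊ n ρ)) (sym ([⊚] y _ _)))
      ([]-[] _ (cong₂ _∷_ (trans ([]-[] y′ (wk₊-lift₊ n ρ)) (sym ([⊚] y′ _ _)))
        (trans (zip-⊚ _ _ _ _) (trans (cong₂ (λ a b → zip a b _) (⊚wk₊-lift₊ σ ρ) (⊚wk₊-lift₊ τ ρ))
          (cong (zip _ _) (vars₊-lift₊ n ρ))))))))

  prepend-[] : ∀ {n m l k} (Θ : Ext n l) (Δ : Tele (l + n) k) (σ : Sub m n) →
               prepend Θ Δ [ σ ]ᴰ ≡ prepend (Θ [ σ ]ᴱ) (Δ [ lift₊ l σ ]ᴰ)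
  prepend-[] []      Δ σ = refl
  prepend-[] (Θ ▹ A) Δ σ = prepend-[] Θ (A ∷ Δ) σ

  join-split : ∀ l {n k} → join l {n} {k} ⊚ split l {n} {k} ≡ idₛ
  join-split zero    = id-⊚ _
  join-split (suc l) {n} {k} = join-split l {n} {suc k}

  split-join : ∀ l {n k} → split l {n} {k} ⊚ join l {n} {k} ≡ idₛ
  split-join zero    = id-⊚ _
  split-join (suc l) {n} {k} = split-join l {n} {suc k}

  join-lift : ∀ l {n m k} (σ : Sub m n) → join l {n} {k} ⊚ lift k (lift₊ l σ) ≡ lift (k ⊞ l) σ ⊚ join l {m} {k}
  join-lift zero    σ = trans (id-⊚ _) (sym (⊚-id _))
  join-lift (suc l) {k = k} σ = join-lift l {k = suc k} σ

  split-lift : ∀ l {n m k} (σ : Sub m n) → split l {n} {k} ⊚ lift (k ⊞ l) σ ≡ lift k (lift₊ l σ) ⊚ split l {m} {k}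
  split-lift zero    σ = trans (id-⊚ _) (sym (⊚-id _))
  split-lift (suc l) {k = k} σ = split-lift l {k = suc k} σ

  ⊚-slide : ∀ {a b c d e} (α : Sub b a) (β : Sub c b) (γ : Sub d c) {δ : Sub e b} {ε : Sub d e} →
            β ⊚ γ ≡ δ ⊚ ε → α ⊚ β ⊚ γ ≡ α ⊚ δ ⊚ ε
  ⊚-slide α β γ eq = trans (⊚-assoc _ _ _) (trans (cong (α ⊚_) eq) (sym (⊚-assoc _ _ _)))

  ⊚-cancel : ∀ {a b c} (α : Sub b a) {β : Sub c b} {γ : Sub b c} → β ⊚ γ ≡ idₛ → α ⊚ β ⊚ γ ≡ α
  ⊚-cancel α eq = trans (⊚-assoc _ _ _) (trans (cong (α ⊚_) eq) (⊚-id α))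

  join₂-lift : ∀ {n m′ m k} (σ : Sub m m′) →
               join₂ m′ n k ⊚ lift k (lift₊ n (lift₊ n σ)) ≡ lift (k ⊞ n ⊞ n) σ ⊚ join₂ m n k
  join₂-lift {n} {m′} {m} {k} σ = trans (⊚-slide _ _ _ (join-lift n {k = k} (lift₊ n σ)))
    (trans (cong (_⊚ join n {n + m} {k}) (join-lift n {m′} {m} {k ⊞ n} σ)) (⊚-assoc _ _ _))

  split₂-lift : ∀ {n m′ m k} (σ : Sub m m′) →
                split₂ m′ n k ⊚ lift (k ⊞ n ⊞ n) σ ≡ lift k (lift₊ n (lift₊ n σ)) ⊚ split₂ m n k
  split₂-lift {n} {m′} {m} {k} σ = trans (⊚-slide _ _ _ (split-lift n {m′} {m} {k ⊞ n} σ))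
    (trans (cong (_⊚ split n {m} {k ⊞ n}) (split-lift n {k = k} (lift₊ n σ))) (⊚-assoc _ _ _))

  split₂-join₂ : ∀ m n k → split₂ m n k ⊚ join₂ m n k ≡ idₛ
  split₂-join₂ m n k = trans (sym (⊚-assoc _ _ _)) (trans (cong (_⊚ join n {n + m} {k}) (⊚-cancel _ (split-join n {m} {k ⊞ n}))) (split-join n))

  path-to-[] : ∀ {m m′ n k} (Φ : Ctx n) (b : Sub m n) (Δ : Tele (n + (n + m)) k) (σ : Sub m′ m) →
               path-to Φ b Δ [ σ ]ᴰ ≡ path-to Φ (b ⊚ σ) (Δ [ lift₊ n (lift₊ n σ) ]ᴰ)
  path-to-[] {m} {m′} {n} Φ b Δ σ = trans (prepend-[] (weaken m Φ) _ σ)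
    (cong₂ prepend (weaken-[] Φ σ) (trans (prepend-[] (IdCtx Φ _ _) Δ _)
      (cong (λ Θ → prepend Θ _) (trans (IdCtx-[] Φ _ _ _) (cong₂ (IdCtx Φ) (vars₊-lift₊ n σ) (⊚wk₊-lift₊ b σ))))))

  wk₊⇛ : ∀ {n l} {Γ : Ctx n} (Θ : Ext n l) → ⊢ Γ ▹▹ Θ → Γ ▹▹ Θ ⊢ wk₊ l ⇛ Γ
  wk₊⇛ []      w        = id⇛ w
  wk₊⇛ (Θ ▹ A) (w ▹ A∶) = ⇛-comp (wk₊⇛ Θ w) (wk⇛ A∶)

  join⇛ : ∀ {n l k} {Γ : Ctx n} (Θ : Ext n l) (Δ : Tele (l + n) k) → ⊢ (Γ ▹▹ Θ) ⧺ Δ →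
          (Γ ▹▹ Θ) ⧺ Δ ⊢ join l {n} {k} ⇛ Γ ⧺ prepend Θ Δ
  join⇛ []      Δ w = id⇛ w
  join⇛ (Θ ▹ A) Δ w = join⇛ Θ (A ∷ Δ) w

  split⇛ : ∀ {n l k} {Γ : Ctx n} (Θ : Ext n l) (Δ : Tele (l + n) k) → ⊢ (Γ ▹▹ Θ) ⧺ Δ →
           Γ ⧺ prepend Θ Δ ⊢ split l {n} {k} ⇛ (Γ ▹▹ Θ) ⧺ Δ
  split⇛ []      Δ w = id⇛ w
  split⇛ (Θ ▹ A) Δ w = split⇛ Θ (A ∷ Δ) w

  prepend-wf : ∀ {n l k} {Γ : Ctx n} (Θ : Ext n l) (Δ : Tele (l + n) k) → ⊢ (Γ ▹▹ Θ) ⧺ Δ → ⊢ Γ ⧺ prepend Θ Δ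
  prepend-wf []      Δ w = w
  prepend-wf (Θ ▹ A) Δ w = prepend-wf Θ (A ∷ Δ) w

  weaken-wf : ∀ {m n} {Γ : Ctx m} {Φ : Ctx n} → ⊢ Γ → ⊢ Φ →
              (⊢ Γ ▹▹ weaken m Φ) × (Γ ▹▹ weaken m Φ ⊢ vars₊ n ⇛ Φ)
  weaken-wf w []       = w , [] w
  weaken-wf w (_▹_ {A = A} v A∶) =
    proj₁ ih ▹ A′ , ext (⇛-comp (proj₂ ih) (wk⇛ A′)) A∶ (v₀∶ A′ ∶≡ [⊚]ᵀ A _ _)
    where
    ih = weaken-wf w v
    A′ = subst-type (proj₂ ih) A∶

  weaken-++ : ∀ {l m n} {Γ : Ctx l} {Ξ : Ctx m} {Φ : Ctx n} {τ a} → Γ ⊢ τ ⇛ Ξ → Γ ⊢ a ⇛ Φ → Γ ⊢ a ++ τ ⇛ Ξ ▹▹ weaken m Φ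
  weaken-++ s ([] w) = s
  weaken-++ s (ext {A = A} {σ = σ} a A∶ t) =
    ext (weaken-++ s a) (subst-type (proj₂ (weaken-wf (cod s) (cod a))) A∶) (t ∶≡ sym ([]-[]ᵀ A (vars₊-++ σ _)))

  weaken-++-≐ : ∀ {l m n} {Γ : Ctx l} {Ξ : Ctx m} {Φ : Ctx n} {τ τ′ a a′} → Γ ⊢ τ ≐ τ′ ⇛ Ξ → Γ ⊢ a ≐ a′ ⇛ Φ →
                Γ ⊢ a ++ τ ≐ a′ ++ τ′ ⇛ Ξ ▹▹ weaken m Φ
  weaken-++-≐ s ([] w) = s
  weaken-++-≐ s (ext {A = A} {σ = σ} a A∶ t) =
    ext (weaken-++-≐ s a) (subst-type (proj₂ (weaken-wf (cod (⇛-left s)) (cod (⇛-left a)))) A∶) (t ≐≡ sym ([]-[]ᵀ A (vars₊-++ σ _)))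

  module IdStep {n} {Φ : Ctx n} (w : ⊢ Φ) {D} (D∶ : Φ ⊢ D type) = Step (pathFacts w) D∶

  IdTy : ∀ {m n} → Ctx n → Ty n → Sub m n → Sub m n → Tm m → Tm m → Ty (n + m)
  IdTy {n = n} Φ D σ τ y y′ =
    Id (D [ σ ⊚ wk₊ n ]ᵀ) (y [ wk₊ n ]) (transport Φ D [ y′ [ wk₊ n ] ∷ zip (σ ⊚ wk₊ n) (τ ⊚ wk₊ n) (vars₊ n) ])

  IdTy-++ : ∀ {l m n} (Φ : Ctx n) D (σ τ : Sub m n) y y′ (ts : Sub l n) (ρ : Sub l m) →
            IdTy Φ D σ τ y y′ [ ts ++ ρ ]ᵀ ≡
            Id (D [ σ ⊚ ρ ]ᵀ) (y [ ρ ]) (transport Φ D [ y′ [ ρ ] ∷ zip (σ ⊚ ρ) (τ ⊚ ρ) ts ])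
  IdTy-++ Φ D σ τ y y′ ts ρ = trans (Id-[] _ _ _ _) (Id≡ ([]-[]ᵀ D (⊚wk₊-++ σ ts ρ)) ([]-[] y (wk₊-++ ts ρ))
    ([]-[] _ (cong₂ _∷_ ([]-[] y′ (wk₊-++ ts ρ))
      (trans (zip-⊚ _ _ _ _) (trans (cong₂ (λ a b → zip a b _) (⊚wk₊-++ σ ts ρ) (⊚wk₊-++ τ ts ρ)) (cong (zip _ _) (vars₊-++ ts ρ)))))))

  IdCtx-wf : ∀ {m n} {Γ : Ctx m} {Φ : Ctx n} {σ τ} → ⊢ Γ → Γ ⊢ σ ⇛ Φ → Γ ⊢ τ ⇛ Φ →
             (⊢ Γ ▹▹ IdCtx Φ σ τ) × (Γ ▹▹ IdCtx Φ σ τ ⊢ zip (σ ⊚ wk₊ n) (τ ⊚ wk₊ n) (vars₊ n) ⇛ Path Φ)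
  IdCtx-wf w ([] _) ([] _) = w , [] w
  IdCtx-wf {n = suc n} {Γ} {Φ ▹ D} {y ∷ σ} {y′ ∷ τ} w (ext s D∶ y∶) (ext t _ y′∶) =
    proj₁ ih ▹ T∶ ,
    ⇛≡ (cong₂ (λ a u → var zero ∷ a ∷ u) ([⊚] y′ _ _) (cong₂ _∷_ ([⊚] y _ _)
         (trans (zip-⊚ _ _ _ wk) (cong₂ (λ a b → zip a b (vars₊ n ⊚ wk)) (⊚-assoc _ _ _) (⊚-assoc _ _ _)))))
       (zip∶ (⇛-comp u (wk⇛ T∶))
         (tm≡ refl eq₁ (subst-term (wk⇛ T∶) (subst-term W y∶)))
         (tm≡ refl eq₂ (subst-term (wk⇛ T∶) (subst-term W y′∶)))
         (v₀∶ T∶ ∶≡ trans (Id-[] _ _ _ _) (Id≡ (trans (cong (_[ wk ]ᵀ) (sym ([⊚]ᵀ D _ _))) eq₁) refl ([⊚] _ _ _))))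
    where
    ih = IdCtx-wf w s t
    u = proj₂ ih
    open IdStep (cod s) D∶
    W = wk₊⇛ (IdCtx Φ σ τ) (proj₁ ih)
    us≡ : src n ⊚ zip (σ ⊚ wk₊ n) (τ ⊚ wk₊ n) (vars₊ n) ≡ σ ⊚ wk₊ n
    us≡ = src-zip _ _ _
    ut≡ : tgt n ⊚ zip (σ ⊚ wk₊ n) (τ ⊚ wk₊ n) (vars₊ n) ≡ τ ⊚ wk₊ n
    ut≡ = tgt-zip (σ ⊚ wk₊ n) _ _
    T∶ : Γ ▹▹ IdCtx Φ σ τ ⊢ IdTy Φ D σ τ y y′ type
    T∶ = Id-form (subst-term W y∶ ∶≡ [⊚]ᵀ D _ _)
      (transport-at u (subst-term W y′∶ ∶≡ trans ([⊚]ᵀ D _ _) (cong (D [_]ᵀ) (sym ut≡))) ∶≡ cong (D [_]ᵀ) us≡)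
    eq₁ : D [ σ ]ᵀ [ wk₊ n ]ᵀ [ wk ]ᵀ ≡ D [ src n ⊚ (zip (σ ⊚ wk₊ n) (τ ⊚ wk₊ n) (vars₊ n) ⊚ wk) ]ᵀ
    eq₁ = trans (cong (_[ wk ]ᵀ) ([⊚]ᵀ D _ _)) (trans ([⊚]ᵀ D _ _) (cong (D [_]ᵀ) (trans (cong (_⊚ wk) (sym us≡)) (⊚-assoc _ _ _))))
    eq₂ : D [ τ ]ᵀ [ wk₊ n ]ᵀ [ wk ]ᵀ ≡ D [ tgt n ⊚ (zip (σ ⊚ wk₊ n) (τ ⊚ wk₊ n) (vars₊ n) ⊚ wk) ]ᵀ
    eq₂ = trans (cong (_[ wk ]ᵀ) ([⊚]ᵀ D _ _)) (trans ([⊚]ᵀ D _ _) (cong (D [_]ᵀ) (trans (cong (_⊚ wk) (sym ut≡)) (⊚-assoc _ _ _))))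

  IdCtx-++ : ∀ {l m n} {Γ : Ctx l} {Ξ : Ctx m} {Φ : Ctx n} {ρ σ τ p} → ⊢ Φ → Ξ ⊢ σ ⇛ Φ → Ξ ⊢ τ ⇛ Φ → Γ ⊢ ρ ⇛ Ξ →
             Γ ⊢ zip (σ ⊚ ρ) (τ ⊚ ρ) p ⇛ Path Φ → Γ ⊢ p ++ ρ ⇛ Ξ ▹▹ IdCtx Φ σ τ
  IdCtx-++ {p = []} [] ([] _) ([] _) r u = r
  IdCtx-++ {Φ = Φ ▹ D} {ρ} {y ∷ σ} {y′ ∷ τ} {q ∷ p} (w ▹ D∶) (ext s _ y∶) (ext t _ y′∶) r (ext (ext (ext u _ _) _ _) _ q∶)
    with proj₁ (IdCtx-wf (cod r) (ext s D∶ y∶) (ext t D∶ y′∶))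
  ... | _ ▹ T∶ = ext (IdCtx-++ w s t r u) T∶
    (q∶ ∶≡ trans (Step.Id-type-at (pathFacts w) D∶ _ _ _) (trans (Id≡ (cong (D [_]ᵀ) (src-zip _ _ p)) refl refl) (sym (IdTy-++ Φ D σ τ y y′ p ρ))))

  IdCtx-++-≐ : ∀ {l m n} {Γ : Ctx l} {Ξ : Ctx m} {Φ : Ctx n} {ρ ρ′ σ τ p p′} → ⊢ Φ → Ξ ⊢ σ ⇛ Φ → Ξ ⊢ τ ⇛ Φ → Γ ⊢ ρ ≐ ρ′ ⇛ Ξ →
               Γ ⊢ zip (σ ⊚ ρ) (τ ⊚ ρ) p ≐ zip (σ ⊚ ρ′) (τ ⊚ ρ′) p′ ⇛ Path Φ → Γ ⊢ p ++ ρ ≐ p′ ++ ρ′ ⇛ Ξ ▹▹ IdCtx Φ σ τ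
  IdCtx-++-≐ {p = []} {[]} [] ([] _) ([] _) r u = r
  IdCtx-++-≐ {Φ = Φ ▹ D} {ρ} {ρ′} {y ∷ σ} {y′ ∷ τ} {q ∷ p} {q′ ∷ p′} (w ▹ D∶) (ext s _ y∶) (ext t _ y′∶) r (ext (ext (ext u _ _) _ _) _ q∶)
    with proj₁ (IdCtx-wf (cod (⇛-left r)) (ext s D∶ y∶) (ext t D∶ y′∶))
  ... | _ ▹ T∶ = ext (IdCtx-++-≐ w s t r u) T∶
    (q∶ ≐≡ trans (Step.Id-type-at (pathFacts w) D∶ _ _ _) (trans (Id≡ (cong (D [_]ᵀ) (src-zip _ _ p)) refl refl) (sym (IdTy-++ Φ D σ τ y y′ p ρ))))

  zip-++ : ∀ {l m n} (σ τ : Sub m n) (p : Sub l n) (ρ : Sub l m) →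
           zip (σ ⊚ wk₊ n) (τ ⊚ wk₊ n) (vars₊ n) ⊚ (p ++ ρ) ≡ zip (σ ⊚ ρ) (τ ⊚ ρ) p
  zip-++ σ τ p ρ = trans (zip-⊚ _ _ _ _) (trans (cong₂ (λ a b → zip a b _) (⊚wk₊-++ σ p ρ) (⊚wk₊-++ τ p ρ)) (cong (zip _ _) (vars₊-++ p ρ)))

  zip-id : ∀ {m n} (σ τ p : Sub m n) → zip (σ ⊚ wk₊ n) (τ ⊚ wk₊ n) (vars₊ n) ⊚ (p ++ idₛ) ≡ zip σ τ p
  zip-id σ τ p = trans (zip-++ σ τ p idₛ) (cong₂ (λ a b → zip a b p) (⊚-id σ) (⊚-id τ))

  ∋⇒zip : ∀ {m n} {Γ : Ctx m} {Φ : Ctx n} {σ τ p} → Γ ⊢ σ ⇛ Φ → Γ ⊢ τ ⇛ Φ → Γ ⊢ IdCtx Φ σ τ ∋ p → Γ ⊢ zip σ τ p ⇛ Path Φ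
  ∋⇒zip {p = p} s t e = ⇛≡ (zip-id _ _ p) (⇛-comp (proj₂ (IdCtx-wf (dom s) s t)) e)

  ∋⇒zip-≐ : ∀ {m n} {Γ : Ctx m} {Φ : Ctx n} {σ τ p p′} → Γ ⊢ σ ⇛ Φ → Γ ⊢ τ ⇛ Φ → Γ ⊢ IdCtx Φ σ τ ∋ p ≐ p′ →
            Γ ⊢ zip σ τ p ≐ zip σ τ p′ ⇛ Path Φ
  ∋⇒zip-≐ {p = p} {p′} s t e = ⇛≐≡ (zip-id _ _ p) (zip-id _ _ p′) (⇛-comp-≐ (⇛-refl (proj₂ (IdCtx-wf (dom s) s t))) e)

  zip⇒∋ : ∀ {m n} {Γ : Ctx m} {Φ : Ctx n} {σ τ p} → Γ ⊢ σ ⇛ Φ → Γ ⊢ τ ⇛ Φ → Γ ⊢ zip σ τ p ⇛ Path Φ → Γ ⊢ IdCtx Φ σ τ ∋ p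
  zip⇒∋ {p = p} s t u = IdCtx-++ (cod s) s t (id⇛ (dom s)) (⇛≡ (cong₂ (λ a b → zip a b p) (sym (⊚-id _)) (sym (⊚-id _))) u)

  zip⇒∋-≐ : ∀ {m n} {Γ : Ctx m} {Φ : Ctx n} {σ τ p p′} → Γ ⊢ σ ⇛ Φ → Γ ⊢ τ ⇛ Φ → Γ ⊢ zip σ τ p ≐ zip σ τ p′ ⇛ Path Φ →
            Γ ⊢ IdCtx Φ σ τ ∋ p ≐ p′
  zip⇒∋-≐ {p = p} {p′} s t u = IdCtx-++-≐ (cod s) s t (⇛-refl (id⇛ (dom s)))
    (⇛≐≡ (cong₂ (λ a b → zip a b p) (sym (⊚-id _)) (sym (⊚-id _))) (cong₂ (λ a b → zip a b p′) (sym (⊚-id _)) (sym (⊚-id _))) u)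

module PathLemmas (S : TypeTheory) where
  open TypeTheory S
  open IdentityContexts judgements public
  open Operations judgements public
  open Structural S public
  open Elimination S public
  open OperationLemmas S public

  zip≡ : ∀ {m n} {σ σ′ τ τ′ p p′ : Sub m n} → σ ≡ σ′ → τ ≡ τ′ → p ≡ p′ → zip σ τ p ≡ zip σ′ τ′ p′
  zip≡ refl refl refl = refl

  zip-src : ∀ {m n} {Γ : Ctx m} {Φ : Ctx n} {σ τ p} → ⊢ Φ → Γ ⊢ zip σ τ p ⇛ Path Φ → Γ ⊢ σ ⇛ Φ
  zip-src w u = ⇛≡ (src-zip _ _ _) (⇛-comp (PathFacts.src∶ (pathFacts w)) u)

  zip-tgt : ∀ {m n} {Γ : Ctx m} {Φ : Ctx n} {σ τ p} → ⊢ Φ → Γ ⊢ zip σ τ p ⇛ Path Φ → Γ ⊢ τ ⇛ Φ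
  zip-tgt {σ = σ} w u = ⇛≡ (tgt-zip σ _ _) (⇛-comp (PathFacts.tgt∶ (pathFacts w)) u)

  zip-src-≐ : ∀ {m n} {Γ : Ctx m} {Φ : Ctx n} {σ τ p σ′ τ′ p′} → ⊢ Φ → Γ ⊢ zip σ τ p ≐ zip σ′ τ′ p′ ⇛ Path Φ → Γ ⊢ σ ≐ σ′ ⇛ Φ
  zip-src-≐ w u = ⇛≐≡ (src-zip _ _ _) (src-zip _ _ _) (⇛-comp-≐ (⇛-refl (PathFacts.src∶ (pathFacts w))) u)

  zip-tgt-≐ : ∀ {m n} {Γ : Ctx m} {Φ : Ctx n} {σ τ p σ′ τ′ p′} → ⊢ Φ → Γ ⊢ zip σ τ p ≐ zip σ′ τ′ p′ ⇛ Path Φ → Γ ⊢ τ ≐ τ′ ⇛ Φ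
  zip-tgt-≐ {σ = σ} {σ′ = σ′} w u = ⇛≐≡ (tgt-zip σ _ _) (tgt-zip σ′ _ _) (⇛-comp-≐ (⇛-refl (PathFacts.tgt∶ (pathFacts w))) u)

  rs⇛ : ∀ {m n} {Γ : Ctx m} {Φ : Ctx n} {σ} → Γ ⊢ σ ⇛ Φ → Γ ⊢ zip σ σ (rs Φ σ) ⇛ Path Φ
  rs⇛ s = ⇛≡ (rfl-⊚ _ _) (⇛-comp (PathFacts.rfl∶ (pathFacts (cod s))) s)

  rs-≐ : ∀ {m n} {Γ : Ctx m} {Φ : Ctx n} {σ τ} → Γ ⊢ σ ≐ τ ⇛ Φ → Γ ⊢ zip σ σ (rs Φ σ) ≐ zip τ τ (rs Φ τ) ⇛ Path Φ
  rs-≐ s = ⇛≐≡ (rfl-⊚ _ _) (rfl-⊚ _ _) (⇛-comp-≐ (⇛-refl (PathFacts.rfl∶ (pathFacts (cod (⇛-left s))))) s)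

  zip-≐ : ∀ {m n} {Γ : Ctx m} {Φ : Ctx n} {σ σ′ τ τ′ p} → ⊢ Φ → Γ ⊢ zip σ τ p ⇛ Path Φ →
          Γ ⊢ σ ≐ σ′ ⇛ Φ → Γ ⊢ τ ≐ τ′ ⇛ Φ → Γ ⊢ zip σ τ p ≐ zip σ′ τ′ p ⇛ Path Φ
  zip-≐ {p = []} [] ([] v) ([] _) ([] _) = [] v
  zip-≐ {Φ = Φ ▹ D} {σ = a ∷ σ} {τ = b ∷ τ} {p = q ∷ p} (w ▹ D∶) (ext (ext (ext u A∶ y) B∶ y′) C∶ q∶) (ext s _ e) (ext t _ e′) =
    ext (ext (ext (zip-≐ w u s t) A∶ (e ≐≡ sym ([]-[]ᵀ D (src-zip _ _ p)))) B∶
      (e′ ≐≡ sym (trans ([]-[]ᵀ _ (wk-∷ _ _)) ([]-[]ᵀ D (tgt-zip σ _ p))))) C∶ (≐-refl q∶)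

  unique₁ : ∀ {n k} {Φ : Ctx n} → ⊢ Φ → (Δ : Tele (tri n) k) → ∀ {B a b q q′} →
            Path Φ ⧺ Δ ⊢ q ∶ Id B a b → Path Φ ⧺ Δ ⊢ q′ ∶ Id B a b →
            Φ ⧺ Δ [ rfl Φ ]ᴰ ⊢ q [ lift k (rfl Φ) ] ≐ q′ [ lift k (rfl Φ) ] ∶ Id B a b [ lift k (rfl Φ) ]ᵀ →
            Path Φ ⧺ Δ ⊢ q ≐ q′ ∶ Id B a b
  unique₁ {n} {k} {Φ} w Δ {B} {a} {b} {q} {q′} q∶ q′∶ e =
    reflect (head-∋ (Jᶜ Φ Δ ([] ▹ M) d) (proj₁ (elim Δ ([] ▹ M) {d} (context-of M∶ ▹ M∶) d∶)))
    where
    open PathFacts (pathFacts w)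
    ρ = lift k (rfl Φ)
    M = Id (Id B a b) q q′
    M∶ = Id-form q∶ q′∶
    d = r (Id B a b [ ρ ]ᵀ) (q [ ρ ]) ∷ []
    ρ∶ = lift⇛ Δ rfl∶ (context-of M∶)
    d∶ : Φ ⧺ Δ [ rfl Φ ]ᴰ ⊢ ([] ▹ M [ ρ ]ᵀ) ∋ d
    d∶ = ext (id⇛ (dom ρ∶)) (subst-type ρ∶ M∶)
      (conv (r-intro (left-term e)) (teq≡ refl (trans (sym (Id-[] _ _ _ _)) (sym ([id]ᵀ _)))
        (Id-cong (≐ᵀ-refl (type-of (left-term e))) (≐-refl (left-term e)) e)))

  unique : ∀ {n k l} {Φ : Ctx n} {Ψ : Ctx l} → ⊢ Φ → ⊢ Ψ → (Δ : Tele (tri n) k) {f g : Sub (tri n ⊞ k) l} (p p′ : Sub (tri n ⊞ k) l) →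
           Path Φ ⧺ Δ ⊢ zip f g p ⇛ Path Ψ → Path Φ ⧺ Δ ⊢ zip f g p′ ⇛ Path Ψ →
           Φ ⧺ Δ [ rfl Φ ]ᴰ ⊢ zip f g p ⊚ lift k (rfl Φ) ≐ zip f g p′ ⊚ lift k (rfl Φ) ⇛ Path Ψ →
           Path Φ ⧺ Δ ⊢ zip f g p ≐ zip f g p′ ⇛ Path Ψ
  unique w [] Δ {[]} {[]} [] [] u _ _ = ⇛-refl u
  unique {k = k} {Φ = Φ} {Ψ = Ψ ▹ D} w (v ▹ D∶) Δ {y ∷ f} {y′ ∷ g} (q ∷ p) (q′ ∷ p′)
    (ext (ext (ext u A∶ y∶) B∶ y′∶) C∶ q∶) (ext (ext (ext u′ _ _) _ _) _ q′∶) (ext (ext (ext e _ _) _ _) _ q≐) =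
    ext front C∶ (unique₁ w Δ (q∶ ∶≡ T≡) (conv q′∶ (≐ᵀ-sym (subst-type-≐ front (≐ᵀ-refl C∶))) ∶≡ T≡)
                     (q≐ ≐≡ trans (sym ([⊚]ᵀ _ _ _)) (cong (_[ lift k (rfl Φ) ]ᵀ) T≡)) ≐≡ sym T≡)
    where
    open Step (pathFacts v) D∶
    ih = unique w v Δ p p′ u u′ e
    front : _ ⊢ y′ ∷ y ∷ zip f g p ≐ y′ ∷ y ∷ zip f g p′ ⇛ _
    front = ext (ext ih A∶ (≐-refl y∶)) B∶ (≐-refl y′∶)
    T≡ : Id-type [ y′ ∷ y ∷ zip f g p ]ᵀ ≡ _
    T≡ = Id-type-at _ _ _

  unique-≐ : ∀ {n k l} {Φ : Ctx n} {Ψ : Ctx l} → ⊢ Φ → ⊢ Ψ → (Δ : Tele (tri n) k) {f g f′ g′ : Sub (tri n ⊞ k) l} (p p′ : Sub (tri n ⊞ k) l) →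
           Path Φ ⧺ Δ ⊢ zip f g p ⇛ Path Ψ → Path Φ ⧺ Δ ⊢ zip f′ g′ p′ ⇛ Path Ψ →
           Path Φ ⧺ Δ ⊢ f ≐ f′ ⇛ Ψ → Path Φ ⧺ Δ ⊢ g ≐ g′ ⇛ Ψ →
           Φ ⧺ Δ [ rfl Φ ]ᴰ ⊢ zip f g p ⊚ lift k (rfl Φ) ≐ zip f′ g′ p′ ⊚ lift k (rfl Φ) ⇛ Path Ψ →
           Path Φ ⧺ Δ ⊢ zip f g p ≐ zip f′ g′ p′ ⇛ Path Ψ
  unique-≐ w v Δ p p′ u u′ s t e =
    ⇛-trans (unique w v Δ p p′ u (⇛-right z) (⇛-trans e (⇛-comp-≐ z (⇛-refl (lift⇛ Δ (PathFacts.rfl∶ (pathFacts w)) (dom u)))))) (⇛-sym z)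
    where z = zip-≐ v u′ (⇛-sym s) (⇛-sym t)

  module PathTo {m n} {Γ : Ctx m} {Φ : Ctx n} (v : ⊢ Φ) {b : Sub m n} (b∶ : Γ ⊢ b ⇛ Φ) where
    W = weaken m Φ
    I = IdCtx Φ (vars₊ n) (b ⊚ wk₊ n)

    private
      W∶ = weaken-wf (dom b∶) v
      wkW = wk₊⇛ W (proj₁ W∶)
      I∶ = IdCtx-wf (proj₁ W∶) (proj₂ W∶) (⇛-comp b∶ wkW)

    Total : Ctx (n + (n + m))
    Total = (Γ ▹▹ W) ▹▹ I

    Total-wf : ⊢ Total
    Total-wf = proj₁ I∶

    point : Total ⊢ vars₊ n ⊚ wk₊ n ⇛ Φ
    point = ⇛-comp (proj₂ W∶) (wk₊⇛ I Total-wf)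

    below : Total ⊢ wk₊ n ⊚ wk₊ n ⇛ Γ
    below = ⇛-comp wkW (wk₊⇛ I Total-wf)

    the-path : Total ⊢ zip (vars₊ n ⊚ wk₊ n) (b ⊚ wk₊ n ⊚ wk₊ n) (vars₊ n) ⇛ Path Φ
    the-path = proj₂ I∶

    split₂⇛ : ∀ {k} (Δ : Tele (n + (n + m)) k) → ⊢ Total ⧺ Δ → Γ ⧺ path-to Φ b Δ ⊢ split₂ m n k ⇛ Total ⧺ Δ
    split₂⇛ Δ w = ⇛-comp (split⇛ I Δ w) (split⇛ W (prepend I Δ) (prepend-wf I Δ w))

    join₂⇛ : ∀ {k} (Δ : Tele (n + (n + m)) k) → ⊢ Total ⧺ Δ → Total ⧺ Δ ⊢ join₂ m n k ⇛ Γ ⧺ path-to Φ b Δ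
    join₂⇛ Δ w = ⇛-comp (join⇛ W (prepend I Δ) (prepend-wf I Δ w)) (join⇛ I Δ w)

    path-to-wf : ∀ {k} (Δ : Tele (n + (n + m)) k) → ⊢ Total ⧺ Δ → ⊢ Γ ⧺ path-to Φ b Δ
    path-to-wf Δ w = prepend-wf W (prepend I Δ) (prepend-wf I Δ w)

    pair⇛ : ∀ {l} {Ξ : Ctx l} {τ a p} → Ξ ⊢ τ ⇛ Γ → Ξ ⊢ zip a (b ⊚ τ) p ⇛ Path Φ → Ξ ⊢ p ++ (a ++ τ) ⇛ Total
    pair⇛ {τ = τ} {a} {p} t u = IdCtx-++ v (proj₂ W∶) (⇛-comp b∶ wkW) (weaken-++ t (zip-src v u))
      (⇛≡ (zip≡ (sym (vars₊-++ a τ)) (sym (⊚wk₊-++ b a τ)) refl) u)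

    pair-≐ : ∀ {l} {Ξ : Ctx l} {τ a p τ′ a′ p′} → Ξ ⊢ τ ≐ τ′ ⇛ Γ → Ξ ⊢ zip a (b ⊚ τ) p ≐ zip a′ (b ⊚ τ′) p′ ⇛ Path Φ →
             Ξ ⊢ p ++ (a ++ τ) ≐ p′ ++ (a′ ++ τ′) ⇛ Total
    pair-≐ {τ = τ} {a} {p} {τ′} {a′} t u = IdCtx-++-≐ v (proj₂ W∶) (⇛-comp b∶ wkW) (weaken-++-≐ t (zip-src-≐ v u))
      (⇛≐≡ (zip≡ (sym (vars₊-++ a τ)) (sym (⊚wk₊-++ b a τ)) refl) (zip≡ (sym (vars₊-++ a′ τ′)) (sym (⊚wk₊-++ b a′ τ′)) refl) u)

  wk₂-++ : ∀ {l m n} (p a : Sub m l) (τ : Sub m n) → wk₊ l ⊚ wk₊ l ⊚ (p ++ (a ++ τ)) ≡ τ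
  wk₂-++ p a τ = trans (⊚wk₊-++ _ p _) (wk₊-++ a τ)

  point-++ : ∀ {l m n} (p a : Sub m l) (τ : Sub m n) → vars₊ l ⊚ wk₊ l ⊚ (p ++ (a ++ τ)) ≡ a
  point-++ p a τ = trans (⊚wk₊-++ _ p _) (vars₊-++ a τ)

  ⊚≡ : ∀ {k l m n} (α : Sub m n) {β : Sub l m} {γ : Sub k l} {δ : Sub k m} → β ⊚ γ ≡ δ → α ⊚ β ⊚ γ ≡ α ⊚ δ
  ⊚≡ α eq = trans (⊚-assoc _ _ _) (cong (α ⊚_) eq)

  wk₂-lift₊ : ∀ l {m n} (σ : Sub m n) → wk₊ l ⊚ wk₊ l ⊚ lift₊ l (lift₊ l σ) ≡ σ ⊚ (wk₊ l ⊚ wk₊ l)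
  wk₂-lift₊ l σ = trans (⊚-slide _ _ _ (wk₊-lift₊ l (lift₊ l σ))) (trans (cong (_⊚ wk₊ l) (wk₊-lift₊ l σ)) (⊚-assoc _ _ _))

  point-lift₊ : ∀ l {m n} (σ : Sub m n) → vars₊ l ⊚ wk₊ l ⊚ lift₊ l (lift₊ l σ) ≡ vars₊ l ⊚ wk₊ l
  point-lift₊ l σ = trans (⊚-slide _ _ _ (wk₊-lift₊ l (lift₊ l σ))) (cong (_⊚ wk₊ l) (vars₊-lift₊ l σ))

  lift₊₂-++ : ∀ {l j m n} (σ : Sub m n) (p a : Sub l j) (τ : Sub l m) →
              lift₊ j (lift₊ j σ) ⊚ (p ++ (a ++ τ)) ≡ p ++ (a ++ σ ⊚ τ)
  lift₊₂-++ {j = j} σ p a τ = trans (lift₊-++ (lift₊ j σ) p _) (cong (p ++_) (lift₊-++ σ a τ))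

  ++₂-⊚ : ∀ {l j m n} (p a : Sub m j) (τ : Sub m n) (ρ : Sub l m) →
          (p ++ (a ++ τ)) ⊚ ρ ≡ p ⊚ ρ ++ (a ⊚ ρ ++ τ ⊚ ρ)
  ++₂-⊚ p a τ ρ = trans (++-⊚ p _ ρ) (cong (p ⊚ ρ ++_) (++-⊚ a τ ρ))

  compose-⊚ : ∀ {l m n} (Φ : Ctx n) (x y z p q : Sub m n) (ρ : Sub l m) →
              compose-at Φ x y z p q ⊚ ρ ≡ compose-at Φ (x ⊚ ρ) (y ⊚ ρ) (z ⊚ ρ) (p ⊚ ρ) (q ⊚ ρ)
  compose-⊚ {n = n} Φ x y z p q ρ = ⊚≡ (compose Φ) (⊚≡ (join₂ (tri n) n 0)
    (trans (++₂-⊚ p x (zip y z q) ρ) (cong (λ u → p ⊚ ρ ++ (x ⊚ ρ ++ u)) (zip-⊚ y z q ρ))))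

  module Compose {n} {Φ : Ctx n} (v : ⊢ Φ) where
    open PathFacts (pathFacts v)
    N = tri n
    Δ = path-to Φ (src n) []
    K = 0 ⊞ n ⊞ n
    module X = PathTo v src∶
    module R = PathTo v (id⇛ v)

    X∶ : ⊢ Path Φ ⧺ Δ
    X∶ = X.path-to-wf [] X.Total-wf

    sX = X.split₂⇛ [] X.Total-wf
    sR = R.split₂⇛ [] R.Total-wf

    a z : Sub (N ⊞ K) n
    a = vars₊ n ⊚ wk₊ n ⊚ split₂ N n 0
    z = tgt n ⊚ wk₊ n ⊚ wk₊ n ⊚ split₂ N n 0

    a∶ : Path Φ ⧺ Δ ⊢ a ⇛ Φ
    a∶ = ⇛-comp X.point sX

    z∶ : Path Φ ⧺ Δ ⊢ z ⇛ Φ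
    z∶ = ⇛≡ (cong (_⊚ split₂ N n 0) (sym (⊚-assoc _ _ _))) (⇛-comp (⇛-comp tgt∶ X.below) sX)

    Δ-rfl : Δ [ rfl Φ ]ᴰ ≡ path-to Φ idₛ []
    Δ-rfl = trans (path-to-[] Φ (src n) [] (rfl Φ)) (cong (λ b → path-to Φ b []) (src-rfl Φ))

    ρ = lift K (rfl Φ)
    ρ₂ = lift₊ n (lift₊ n (rfl Φ))

    aR zR pR : Sub (n ⊞ K) n
    aR = vars₊ n ⊚ wk₊ n ⊚ split₂ n n 0
    zR = idₛ ⊚ wk₊ n ⊚ wk₊ n ⊚ split₂ n n 0
    pR = vars₊ n ⊚ split₂ n n 0

    a-ρ : a ⊚ ρ ≡ aR
    a-ρ = trans (⊚-slide _ _ _ (split₂-lift {n} {N} {n} {0} (rfl Φ))) (cong (_⊚ split₂ n n 0) (point-lift₊ n (rfl Φ)))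

    z-ρ : z ⊚ ρ ≡ zR
    z-ρ = trans (⊚-slide _ _ _ (split₂-lift {n} {N} {n} {0} (rfl Φ))) (cong (_⊚ split₂ n n 0)
      (trans (⊚-slide _ _ _ (wk₊-lift₊ n (lift₊ n (rfl Φ)))) (cong (_⊚ wk₊ n)
        (trans (⊚-slide _ _ _ (wk₊-lift₊ n (rfl Φ))) (cong (_⊚ wk₊ n) (tgt-rfl Φ))))))

    p∶ : Φ ⧺ path-to Φ idₛ [] ⊢ zip aR zR pR ⇛ Path Φ
    p∶ = ⇛≡ (zip-⊚ _ _ _ _) (⇛-comp R.the-path sR)

    p∋ : Φ ⧺ Δ [ rfl Φ ]ᴰ ⊢ IdCtx Φ a z [ ρ ]ᴱ ∋ pR
    p∋ = coe (sym Δ-rfl) (sym (trans (IdCtx-[] Φ a z ρ) (cong₂ (IdCtx Φ) a-ρ z-ρ))) (zip⇒∋ (zip-src v p∶) (zip-tgt v p∶) p∶)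
      where
      coe : ∀ {m k l} {Γ : Ctx m} {Δ Δ′ : Tele m k} {Θ Θ′ : Ext (m ⊞ k) l} {d} → Δ ≡ Δ′ → Θ ≡ Θ′ →
            Γ ⧺ Δ ⊢ Θ ∋ d → Γ ⧺ Δ′ ⊢ Θ′ ∋ d
      coe refl refl e = e

    private
      result = elim Δ (IdCtx Φ a z) {pR} (proj₁ (IdCtx-wf X∶ a∶ z∶)) p∋

    compose⇛ : Path Φ ⧺ Δ ⊢ zip a z (compose Φ) ⇛ Path Φ
    compose⇛ = ∋⇒zip a∶ z∶ (proj₁ result)

    compose-comp : Φ ⧺ path-to Φ idₛ [] ⊢ zip aR zR (compose Φ ⊚ ρ) ≐ zip aR zR pR ⇛ Path Φ
    compose-comp = subst (λ D → Φ ⧺ D ⊢ zip aR zR (compose Φ ⊚ ρ) ≐ zip aR zR pR ⇛ Path Φ) Δ-rfl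
      (⇛≐≡ (zip≡ a-ρ z-ρ refl) (zip≡ a-ρ z-ρ refl)
        (∋⇒zip-≐ (⇛-comp a∶ ρ∶) (⇛-comp z∶ ρ∶)
          (subst (λ (Θ : Ext (n ⊞ K) n) → Φ ⧺ Δ [ rfl Φ ]ᴰ ⊢ Θ ∋ compose Φ ⊚ ρ ≐ pR) (IdCtx-[] Φ a z ρ) (proj₂ result))))
      where ρ∶ = lift⇛ Δ rfl∶ X∶

    arg : ∀ {m} (x y z p q : Sub m n) → Sub m (N ⊞ K)
    arg x y z p q = join₂ N n 0 ⊚ (p ++ (x ++ zip y z q))

    split-arg : ∀ {m} (x y z p q : Sub m n) → split₂ N n 0 ⊚ arg x y z p q ≡ p ++ (x ++ zip y z q)
    split-arg x y z p q = trans (sym (⊚-assoc _ _ _)) (trans (cong (_⊚ (p ++ (x ++ zip y z q))) (split₂-join₂ N n 0)) (id-⊚ _))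

    a-arg : ∀ {m} (x y z p q : Sub m n) → a ⊚ arg x y z p q ≡ x
    a-arg x y z p q = trans (⊚≡ (vars₊ n ⊚ wk₊ n) (split-arg x y z p q)) (point-++ p x _)

    z-arg : ∀ {m} (x y w p q : Sub m n) → z ⊚ arg x y w p q ≡ w
    z-arg x y w p q = trans (⊚≡ (tgt n ⊚ wk₊ n ⊚ wk₊ n) (split-arg x y w p q)) (trans (⊚wk₊-++ _ p _) (trans (⊚wk₊-++ _ x _) (tgt-zip y w q)))

    arg⇛ : ∀ {m} {Γ : Ctx m} {x y z p q} → Γ ⊢ zip x y p ⇛ Path Φ → Γ ⊢ zip y z q ⇛ Path Φ →
           Γ ⊢ arg x y z p q ⇛ Path Φ ⧺ Δ
    arg⇛ u t = ⇛-comp (X.join₂⇛ [] X.Total-wf) (X.pair⇛ t (⇛≡ (zip≡ refl (sym (src-zip _ _ _)) refl) u))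

    arg-≐ : ∀ {m} {Γ : Ctx m} {x y z p q x′ y′ z′ p′ q′} → Γ ⊢ zip x y p ≐ zip x′ y′ p′ ⇛ Path Φ →
            Γ ⊢ zip y z q ≐ zip y′ z′ q′ ⇛ Path Φ → Γ ⊢ arg x y z p q ≐ arg x′ y′ z′ p′ q′ ⇛ Path Φ ⧺ Δ
    arg-≐ u t = ⇛-comp-≐ (⇛-refl (X.join₂⇛ [] X.Total-wf))
      (X.pair-≐ t (⇛≐≡ (zip≡ refl (sym (src-zip _ _ _)) refl) (zip≡ refl (sym (src-zip _ _ _)) refl) u))

    compose-at⇛ : ∀ {m} {Γ : Ctx m} {x y z p q} → Γ ⊢ zip x y p ⇛ Path Φ → Γ ⊢ zip y z q ⇛ Path Φ →
                  Γ ⊢ zip x z (compose-at Φ x y z p q) ⇛ Path Φ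
    compose-at⇛ {x = x} {y} {z} {p} {q} u t =
      ⇛≡ (trans (zip-⊚ _ _ _ _) (zip≡ (a-arg x y z p q) (z-arg x y z p q) refl)) (⇛-comp compose⇛ (arg⇛ u t))

    compose-at-≐ : ∀ {m} {Γ : Ctx m} {x y z p q x′ y′ z′ p′ q′} → Γ ⊢ zip x y p ≐ zip x′ y′ p′ ⇛ Path Φ →
                   Γ ⊢ zip y z q ≐ zip y′ z′ q′ ⇛ Path Φ →
                   Γ ⊢ zip x z (compose-at Φ x y z p q) ≐ zip x′ z′ (compose-at Φ x′ y′ z′ p′ q′) ⇛ Path Φ
    compose-at-≐ {x = x} {y} {z} {p} {q} {x′} {y′} {z′} {p′} {q′} u t =
      ⇛≐≡ (trans (zip-⊚ _ _ _ _) (zip≡ (a-arg x y z p q) (z-arg x y z p q) refl))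
          (trans (zip-⊚ _ _ _ _) (zip≡ (a-arg x′ y′ z′ p′ q′) (z-arg x′ y′ z′ p′ q′) refl))
        (⇛-comp-≐ (⇛-refl compose⇛) (arg-≐ u t))

    compose-idˡ : ∀ {m} {Γ : Ctx m} {x y p} → Γ ⊢ zip x y p ⇛ Path Φ →
                  Γ ⊢ zip x y (compose-at Φ x y y p (rs Φ y)) ≐ zip x y p ⇛ Path Φ
    compose-idˡ {x = x} {y} {p} u =
      ⇛≐≡ (trans (zip-⊚ _ _ _ _) (zip≡ a≡ z≡ c≡)) (trans (zip-⊚ _ _ _ _) (zip≡ a≡ z≡ p≡))
        (⇛-comp-≐ compose-comp (⇛-refl (⇛-comp (R.join₂⇛ [] R.Total-wf) (R.pair⇛ (zip-tgt v u) (⇛≡ (zip≡ refl (sym (id-⊚ y)) refl) u)))))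
      where
      t = join₂ n n 0 ⊚ (p ++ (x ++ y))
      st : split₂ n n 0 ⊚ t ≡ p ++ (x ++ y)
      st = trans (sym (⊚-assoc _ _ _)) (trans (cong (_⊚ (p ++ (x ++ y))) (split₂-join₂ n n 0)) (id-⊚ _))
      a≡ : aR ⊚ t ≡ x
      a≡ = trans (⊚≡ (vars₊ n ⊚ wk₊ n) st) (point-++ p _ _)
      z≡ : zR ⊚ t ≡ y
      z≡ = trans (⊚≡ (idₛ ⊚ wk₊ n ⊚ wk₊ n) st) (trans (⊚wk₊-++ _ p _) (trans (⊚wk₊-++ _ x _) (id-⊚ y)))
      p≡ : pR ⊚ t ≡ p
      p≡ = trans (⊚≡ (vars₊ n) st) (vars₊-++ p _)
      c≡ : compose Φ ⊚ ρ ⊚ t ≡ compose-at Φ x y y p (rs Φ y)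
      c≡ = ⊚≡ (compose Φ) (trans (sym (⊚-assoc _ _ _)) (trans (cong (_⊚ (p ++ (x ++ y))) (sym (join₂-lift {n} {N} {n} {0} (rfl Φ))))
        (⊚≡ (join₂ N n 0) (trans (lift₊₂-++ (rfl Φ) p x y) (cong (λ u → p ++ (x ++ u)) (rfl-⊚ Φ y))))))

  zip-η : ∀ {m n} (u : Sub m (tri n)) → zip (src n ⊚ u) (tgt n ⊚ u) (path-vars n ⊚ u) ≡ u
  zip-η {n = n} u = trans (sym (zip-⊚ (src n) (tgt n) (path-vars n) u)) (trans (cong (_⊚ u) (zip-vars n)) (id-⊚ u))

  unique-map : ∀ {n k l} {Φ : Ctx n} {Ψ : Ctx l} → ⊢ Φ → ⊢ Ψ → (Δ : Tele (tri n) k) (u u′ : Sub (tri n ⊞ k) (tri l)) →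
               Path Φ ⧺ Δ ⊢ u ⇛ Path Ψ → Path Φ ⧺ Δ ⊢ u′ ⇛ Path Ψ →
               Path Φ ⧺ Δ ⊢ src l ⊚ u ≐ src l ⊚ u′ ⇛ Ψ → Path Φ ⧺ Δ ⊢ tgt l ⊚ u ≐ tgt l ⊚ u′ ⇛ Ψ →
               Φ ⧺ Δ [ rfl Φ ]ᴰ ⊢ u ⊚ lift k (rfl Φ) ≐ u′ ⊚ lift k (rfl Φ) ⇛ Path Ψ →
               Path Φ ⧺ Δ ⊢ u ≐ u′ ⇛ Path Ψ
  unique-map {k = k} {l} {Φ} w v Δ u u′ u∶ u′∶ s t e = ⇛≐≡ (zip-η u) (zip-η u′)
    (unique-≐ w v Δ (path-vars l ⊚ u) (path-vars l ⊚ u′) (⇛≡ (sym (zip-η u)) u∶) (⇛≡ (sym (zip-η u′)) u′∶) s t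
      (⇛≐≡ (cong (_⊚ lift k (rfl Φ)) (sym (zip-η u))) (cong (_⊚ lift k (rfl Φ)) (sym (zip-η u′))) e))

  record Presentation {n k} (Φ : Ctx n) (Δ : Tele (tri n) k) {M M′} (Y : Ctx M) (Z : Ctx M′) (ρ : Sub M′ M) : Set where
    field
      s    : Sub (tri n ⊞ k) M
      j    : Sub M (tri n ⊞ k)
      sZ   : Sub (n ⊞ k) M′
      s∶   : Path Φ ⧺ Δ ⊢ s ⇛ Y
      j∶   : Y ⊢ j ⇛ Path Φ ⧺ Δ
      sZ∶  : Φ ⧺ Δ [ rfl Φ ]ᴰ ⊢ sZ ⇛ Z
      sj   : s ⊚ j ≡ idₛ
      s-ρ  : s ⊚ lift k (rfl Φ) ≡ ρ ⊚ sZ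

  unique-in : ∀ {n k l M M′} {Φ : Ctx n} {Ψ : Ctx l} {Δ : Tele (tri n) k} {Y : Ctx M} {Z : Ctx M′} {ρ} →
              ⊢ Φ → ⊢ Ψ → Presentation Φ Δ Y Z ρ → (u u′ : Sub M (tri l)) →
              Y ⊢ u ⇛ Path Ψ → Y ⊢ u′ ⇛ Path Ψ →
              Y ⊢ src l ⊚ u ≐ src l ⊚ u′ ⇛ Ψ → Y ⊢ tgt l ⊚ u ≐ tgt l ⊚ u′ ⇛ Ψ →
              Z ⊢ u ⊚ ρ ≐ u′ ⊚ ρ ⇛ Path Ψ → Y ⊢ u ≐ u′ ⇛ Path Ψ
  unique-in {Δ = Δ} w v P u u′ u∶ u′∶ es et e = ⇛≐≡ (⊚-cancel u sj) (⊚-cancel u′ sj) (⇛-comp-≐ X≐ (⇛-refl j∶))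
    where
    open Presentation P
    X≐ = unique-map w v Δ (u ⊚ s) (u′ ⊚ s) (⇛-comp u∶ s∶) (⇛-comp u′∶ s∶)
      (⇛≐≡ (⊚-assoc _ _ _) (⊚-assoc _ _ _) (⇛-comp-≐ es (⇛-refl s∶)))
      (⇛≐≡ (⊚-assoc _ _ _) (⊚-assoc _ _ _) (⇛-comp-≐ et (⇛-refl s∶)))
      (⇛≐≡ (sym (⊚-slide _ _ _ s-ρ)) (sym (⊚-slide _ _ _ s-ρ)) (⇛-comp-≐ e (⇛-refl sZ∶)))

  present₁ : ∀ {n} {Φ : Ctx n} (v : ⊢ Φ) →
             Presentation Φ (path-to Φ (src n) [])
               (PathTo.Total v (PathFacts.src∶ (pathFacts v)))
               (PathTo.Total v (⇛-comp (PathFacts.src∶ (pathFacts v)) (PathFacts.rfl∶ (pathFacts v))))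
               (lift₊ n (lift₊ n (rfl Φ)))
  present₁ {n} {Φ} v = record
    { s = split₂ (tri n) n 0 ; j = join₂ (tri n) n 0 ; sZ = split₂ n n 0
    ; s∶ = X.split₂⇛ [] X.Total-wf ; j∶ = X.join₂⇛ [] X.Total-wf
    ; sZ∶ = subst (λ D → Φ ⧺ D ⊢ split₂ n n 0 ⇛ R.Total) (sym (path-to-[] Φ (src n) [] (rfl Φ))) (R.split₂⇛ [] R.Total-wf)
    ; sj = split₂-join₂ (tri n) n 0 ; s-ρ = split₂-lift {n} {tri n} {n} {0} (rfl Φ) }
    where
    open PathFacts (pathFacts v)
    module X = PathTo v src∶
    module R = PathTo v (⇛-comp src∶ rfl∶)

  ++-vars : ∀ l {a} → vars₊ l ++ wk₊ l ≡ idₛ {l + a}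
  ++-vars zero    = refl
  ++-vars (suc l) = cong (var zero ∷_) (trans (sym (++-⊚ (vars₊ l) (wk₊ l) wk)) (trans (cong (_⊚ wk) (++-vars l)) (id-⊚ wk)))

  lift₊-split : ∀ l {a b} (σ : Sub a b) → lift₊ l σ ≡ vars₊ l ++ σ ⊚ wk₊ l
  lift₊-split l σ = trans (trans (sym (⊚-id (lift₊ l σ))) (cong (lift₊ l σ ⊚_) (sym (++-vars l)))) (lift₊-++ σ (vars₊ l) (wk₊ l))

  lift₊₂-split : ∀ l {a b} (σ : Sub a b) → lift₊ l (lift₊ l σ) ≡ vars₊ l ++ (vars₊ l ⊚ wk₊ l ++ σ ⊚ (wk₊ l ⊚ wk₊ l))
  lift₊₂-split l σ = trans (lift₊-split l (lift₊ l σ)) (cong (vars₊ l ++_) (trans (cong (_⊚ wk₊ l) (lift₊-split l σ))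
    (trans (++-⊚ (vars₊ l) (σ ⊚ wk₊ l) (wk₊ l)) (cong (vars₊ l ⊚ wk₊ l ++_) (⊚-assoc _ _ _)))))

  module Two {n} {Φ : Ctx n} (v : ⊢ Φ) where
    open PathFacts (pathFacts v) public
    module X = PathTo v src∶
    module R = PathTo v (⇛-comp src∶ rfl∶)
    module X₂ = PathTo v X.point
    ρ₁ : Sub (n + (n + n)) (n + (n + tri n))
    ρ₁ = lift₊ n (lift₊ n (rfl Φ))
    ρ₁∶ : R.Total ⊢ ρ₁ ⇛ X.Total
    ρ₁∶ = ⇛≡ (sym ρ₁≡) (X.pair⇛ (⇛-comp rfl∶ R.below)
            (⇛≡ (zip≡ refl (trans (cong (_⊚ wk₊ n) (⊚-assoc _ _ _)) (trans (⊚-assoc _ _ _) (trans (cong (src n ⊚_) (⊚-assoc _ _ _)) refl))) refl) R.the-path))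
      where
      ρ₁≡ : ρ₁ ≡ vars₊ n ++ (vars₊ n ⊚ wk₊ n ++ rfl Φ ⊚ (wk₊ n ⊚ wk₊ n))
      ρ₁≡ = lift₊₂-split n (rfl Φ)
    module R₂ = PathTo v (⇛-comp X.point ρ₁∶)

    Δ₂ : Tele (n + (n + tri n)) (0 ⊞ n ⊞ n)
    Δ₂ = path-to Φ (vars₊ n ⊚ wk₊ n) []

    present₂ : Presentation Φ (path-to Φ (src n) Δ₂) X₂.Total R₂.Total (lift₊ n (lift₊ n ρ₁))
    present₂ = record
      { s = s₂ ⊚ s₁
      ; j = j₁ ⊚ j₂
      ; sZ = split₂ (n + (n + n)) n 0 ⊚ split₂ n n (0 ⊞ n ⊞ n)
      ; s∶ = ⇛-comp (X₂.split₂⇛ [] X₂.Total-wf) (X.split₂⇛ Δ₂ w)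
      ; j∶ = ⇛-comp (X.join₂⇛ Δ₂ w) (X₂.join₂⇛ [] X₂.Total-wf)
      ; sZ∶ = ⇛-comp (R₂.split₂⇛ [] R₂.Total-wf)
          (subst (λ D → Φ ⧺ D ⊢ split₂ n n (0 ⊞ n ⊞ n) ⇛ R.Total ⧺ path-to Φ (vars₊ n ⊚ wk₊ n ⊚ ρ₁) [])
            (sym (trans (path-to-[] Φ (src n) Δ₂ (rfl Φ)) (cong (path-to Φ _) (path-to-[] Φ _ [] ρ₁))))
            (R.split₂⇛ (path-to Φ (vars₊ n ⊚ wk₊ n ⊚ ρ₁) []) (R₂.path-to-wf [] R₂.Total-wf)))
      ; sj = trans (sym (⊚-assoc _ _ _)) (trans (cong (_⊚ j₂) (⊚-cancel s₂ (split₂-join₂ (tri n) n (0 ⊞ n ⊞ n)))) (split₂-join₂ (n + (n + tri n)) n 0))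
      ; s-ρ = trans (⊚-slide s₂ s₁ _ (split₂-lift {n} {tri n} {n} {0 ⊞ n ⊞ n} (rfl Φ)))
                (trans (cong (_⊚ split₂ n n (0 ⊞ n ⊞ n)) (split₂-lift {n} {n + (n + tri n)} {n + (n + n)} {0} ρ₁)) (⊚-assoc _ _ _)) }
      where
      w = X₂.path-to-wf [] X₂.Total-wf
      s₁ = split₂ (tri n) n (0 ⊞ n ⊞ n)
      s₂ = split₂ (n + (n + tri n)) n 0
      j₁ = join₂ (tri n) n (0 ⊞ n ⊞ n)
      j₂ = join₂ (n + (n + tri n)) n 0

module GroupoidLaws (S : TypeTheory) where
  open TypeTheory S
  open PathLemmas S public

  cong₃ : ∀ {a b c d} {A : Set a} {B : Set b} {C : Set c} {D : Set d} (F : A → B → C → D) {x x′ y y′ z z′} →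
          x ≡ x′ → y ≡ y′ → z ≡ z′ → F x y z ≡ F x′ y′ z′
  cong₃ F refl refl refl = refl

  cong₅ : ∀ {A B : Set} (F : A → A → A → A → A → B) {x₁ x₂ x₃ x₄ x₅ y₁ y₂ y₃ y₄ y₅} →
          x₁ ≡ y₁ → x₂ ≡ y₂ → x₃ ≡ y₃ → x₄ ≡ y₄ → x₅ ≡ y₅ → F x₁ x₂ x₃ x₄ x₅ ≡ F y₁ y₂ y₃ y₄ y₅
  cong₅ F refl refl refl refl refl = refl

  cong₇ : ∀ {A B : Set} (F : A → A → A → A → A → A → A → B) {x₁ x₂ x₃ x₄ x₅ x₆ x₇ y₁ y₂ y₃ y₄ y₅ y₆ y₇} →
          x₁ ≡ y₁ → x₂ ≡ y₂ → x₃ ≡ y₃ → x₄ ≡ y₄ → x₅ ≡ y₅ → x₆ ≡ y₆ → x₇ ≡ y₇ →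
          F x₁ x₂ x₃ x₄ x₅ x₆ x₇ ≡ F y₁ y₂ y₃ y₄ y₅ y₆ y₇
  cong₇ F refl refl refl refl refl refl refl = refl

  ≡⇒≐ : ∀ {m n} {Γ : Ctx m} {Φ : Ctx n} {σ τ} → σ ≡ τ → Γ ⊢ σ ⇛ Φ → Γ ⊢ σ ≐ τ ⇛ Φ
  ≡⇒≐ refl s = ⇛-refl s

  Apᵖ : ∀ {m n} → Ctx m → Ctx n → Sub m n → Sub (tri m) (tri n)
  Apᵖ {m} Φ Ψ h = zip (h ⊚ src m) (h ⊚ tgt m) (ap Φ Ψ h)

  Apᵖ-zip : ∀ {l m n} (Φ : Ctx m) (Ψ : Ctx n) h (σ τ p : Sub l m) →
            Apᵖ Φ Ψ h ⊚ zip σ τ p ≡ zip (h ⊚ σ) (h ⊚ τ) (ap Φ Ψ h ⊚ zip σ τ p)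
  Apᵖ-zip Φ Ψ h σ τ p = trans (zip-⊚ _ _ _ _) (zip≡ (⊚≡ h (src-zip σ τ p)) (⊚≡ h (tgt-zip σ τ p)) refl)

  module Ap {m n} {Φ : Ctx m} {Ψ : Ctx n} (v : ⊢ Φ) {h : Sub m n} (h∶ : Φ ⊢ h ⇛ Ψ) where
    open PathFacts (pathFacts v)
    private
      s∶ = ⇛-comp h∶ src∶
      t∶ = ⇛-comp h∶ tgt∶
      d∋ : Φ ⊢ IdCtx Ψ (h ⊚ src m) (h ⊚ tgt m) [ rfl Φ ]ᴱ ∋ rs Ψ h
      d∋ = subst (λ (Θ : Ext m n) → Φ ⊢ Θ ∋ rs Ψ h) (sym (trans (IdCtx-[] Ψ _ _ (rfl Φ))
             (cong₂ (IdCtx Ψ) (trans (⊚≡ h (src-rfl Φ)) (⊚-id h)) (trans (⊚≡ h (tgt-rfl Φ)) (⊚-id h)))))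
             (zip⇒∋ h∶ h∶ (rs⇛ h∶))
      result = elim [] (IdCtx Ψ (h ⊚ src m) (h ⊚ tgt m)) {rs Ψ h} (proj₁ (IdCtx-wf Path-wf s∶ t∶)) d∋

    ap⇛ : Path Φ ⊢ Apᵖ Φ Ψ h ⇛ Path Ψ
    ap⇛ = ∋⇒zip s∶ t∶ (proj₁ result)

    ap-rfl : Φ ⊢ Apᵖ Φ Ψ h ⊚ rfl Φ ≐ rfl Ψ ⊚ h ⇛ Path Ψ
    ap-rfl = ⇛≐≡ (sym (zip-⊚ _ _ _ _)) (trans (zip≡ (trans (⊚≡ h (src-rfl Φ)) (⊚-id h)) (trans (⊚≡ h (tgt-rfl Φ)) (⊚-id h)) refl) (sym (rfl-⊚ Ψ h)))
      (∋⇒zip-≐ (⇛-comp s∶ rfl∶) (⇛-comp t∶ rfl∶)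
        (subst (λ (Θ : Ext m n) → Φ ⊢ Θ ∋ ap Φ Ψ h ⊚ rfl Φ ≐ rs Ψ h) (IdCtx-[] Ψ _ _ (rfl Φ)) (proj₂ result)))

  unique-path : ∀ {n l} {Φ : Ctx n} {Ψ : Ctx l} → ⊢ Φ → ⊢ Ψ → (u u′ : Sub (tri n) (tri l)) →
                Path Φ ⊢ u ⇛ Path Ψ → Path Φ ⊢ u′ ⇛ Path Ψ →
                Path Φ ⊢ src l ⊚ u ≐ src l ⊚ u′ ⇛ Ψ → Path Φ ⊢ tgt l ⊚ u ≐ tgt l ⊚ u′ ⇛ Ψ →
                Φ ⊢ u ⊚ rfl Φ ≐ u′ ⊚ rfl Φ ⇛ Path Ψ → Path Φ ⊢ u ≐ u′ ⇛ Path Ψ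
  unique-path w v u u′ = unique-map w v [] u u′

  src-Apᵖ : ∀ {m n} (Φ : Ctx m) (Ψ : Ctx n) h → src n ⊚ Apᵖ Φ Ψ h ≡ h ⊚ src m
  src-Apᵖ Φ Ψ h = src-zip _ _ _
  tgt-Apᵖ : ∀ {m n} (Φ : Ctx m) (Ψ : Ctx n) h → tgt n ⊚ Apᵖ Φ Ψ h ≡ h ⊚ tgt m
  tgt-Apᵖ {m} Φ Ψ h = tgt-zip (h ⊚ src m) _ _

  ap-≐ : ∀ {m n} {Φ : Ctx m} {Ψ : Ctx n} {h h′} → ⊢ Φ → Φ ⊢ h ≐ h′ ⇛ Ψ → Path Φ ⊢ Apᵖ Φ Ψ h ≐ Apᵖ Φ Ψ h′ ⇛ Path Ψ
  ap-≐ {Φ = Φ} {Ψ} {h} {h′} v e = unique-path v w (Apᵖ Φ Ψ h) (Apᵖ Φ Ψ h′) (Ap.ap⇛ v (⇛-left e)) (Ap.ap⇛ v (⇛-right e))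
    (⇛≐≡ (sym (src-Apᵖ Φ Ψ h)) (sym (src-Apᵖ Φ Ψ h′)) (⇛-comp-≐ e (⇛-refl src∶)))
    (⇛≐≡ (sym (tgt-Apᵖ Φ Ψ h)) (sym (tgt-Apᵖ Φ Ψ h′)) (⇛-comp-≐ e (⇛-refl tgt∶)))
    (⇛-trans (Ap.ap-rfl v (⇛-left e)) (⇛-trans (⇛-comp-≐ (⇛-refl (PathFacts.rfl∶ (pathFacts w))) e) (⇛-sym (Ap.ap-rfl v (⇛-right e)))))
    where
    open PathFacts (pathFacts v)
    w = cod (⇛-left e)

  ap-id : ∀ {m} {Φ : Ctx m} → ⊢ Φ → Path Φ ⊢ Apᵖ Φ Φ idₛ ≐ idₛ ⇛ Path Φ
  ap-id {m} {Φ} v = unique-path v v (Apᵖ Φ Φ idₛ) idₛ (Ap.ap⇛ v (id⇛ v)) (id⇛ Path-wf)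
    (≡⇒≐ (trans s≡ (sym (⊚-id _))) (⇛≡ (sym s≡) src∶)) (≡⇒≐ (trans t≡ (sym (⊚-id _))) (⇛≡ (sym t≡) tgt∶))
    (⇛-trans (Ap.ap-rfl v (id⇛ v)) (≡⇒≐ (trans (⊚-id _) (sym (id-⊚ _))) (⇛-comp rfl∶ (id⇛ v))))
    where
    open PathFacts (pathFacts v)
    s≡ = trans (src-Apᵖ Φ Φ idₛ) (id-⊚ (src m))
    t≡ = trans (tgt-Apᵖ Φ Φ idₛ) (id-⊚ (tgt m))

  ap-∘ : ∀ {l m n} {Φ : Ctx l} {Ψ : Ctx m} {Ξ : Ctx n} {g h} → Ψ ⊢ g ⇛ Ξ → Φ ⊢ h ⇛ Ψ →
         Path Φ ⊢ Apᵖ Φ Ξ (g ⊚ h) ≐ Apᵖ Ψ Ξ g ⊚ Apᵖ Φ Ψ h ⇛ Path Ξ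
  ap-∘ {Φ = Φ} {Ψ} {Ξ} {g} {h} g∶ h∶ = unique-path v (cod g∶) (Apᵖ Φ Ξ (g ⊚ h)) (Apᵖ Ψ Ξ g ⊚ Apᵖ Φ Ψ h) gh∶ g∘h∶
    (≡⇒≐ (trans (src-Apᵖ Φ Ξ _) (sym (trans (sym (⊚-assoc _ _ _)) (trans (cong (_⊚ Apᵖ Φ Ψ h) (src-Apᵖ Ψ Ξ g))
      (trans (⊚≡ g (src-Apᵖ Φ Ψ h)) (sym (⊚-assoc _ _ _))))))) (⇛-comp (PathFacts.src∶ (pathFacts (cod g∶))) gh∶))
    (≡⇒≐ (trans (tgt-Apᵖ Φ Ξ _) (sym (trans (sym (⊚-assoc _ _ _)) (trans (cong (_⊚ Apᵖ Φ Ψ h) (tgt-Apᵖ Ψ Ξ g))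
      (trans (⊚≡ g (tgt-Apᵖ Φ Ψ h)) (sym (⊚-assoc _ _ _))))))) (⇛-comp (PathFacts.tgt∶ (pathFacts (cod g∶))) gh∶))
    (⇛-trans (Ap.ap-rfl v (⇛-comp g∶ h∶)) (⇛-sym (⇛-trans (⇛≐≡ (sym (⊚-assoc _ _ _)) (sym (⊚-assoc _ _ _)) (⇛-comp-≐ (⇛-refl (Ap.ap⇛ w g∶)) (Ap.ap-rfl v h∶)))
      (⇛≐≡ refl (⊚-assoc _ _ _) (⇛-comp-≐ (Ap.ap-rfl w g∶) (⇛-refl h∶))))))
    where
    v = dom h∶
    w = dom g∶
    gh∶ = Ap.ap⇛ v (⇛-comp g∶ h∶)
    g∘h∶ = ⇛-comp (Ap.ap⇛ w g∶) (Ap.ap⇛ v h∶)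

  compose-at≡ : ∀ {m n} (Φ : Ctx n) {x y z p q x′ y′ z′ p′ q′ : Sub m n} → x ≡ x′ → y ≡ y′ → z ≡ z′ → p ≡ p′ → q ≡ q′ →
                compose-at Φ x y z p q ≡ compose-at Φ x′ y′ z′ p′ q′
  compose-at≡ Φ refl refl refl refl refl = refl

  compose-idʳ : ∀ {m n} {Γ : Ctx m} {Φ : Ctx n} {x z q} → ⊢ Φ → Γ ⊢ zip x z q ⇛ Path Φ →
                Γ ⊢ zip x z (compose-at Φ x x z (rs Φ x) q) ≐ zip x z q ⇛ Path Φ
  compose-idʳ {n = n} {Φ = Φ} {x} {z} {q} v u =
    ⇛≐≡ (trans (zip-⊚ _ _ _ _) (zip≡ (src-zip x z q) (tgt-zip x z q) (trans (compose-⊚ Φ (src n) (src n) (tgt n) (rs Φ (src n)) (path-vars n) _) c≡))) (id-⊚ _) (⇛-comp-≐ generic (⇛-refl u))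
    where
    open PathFacts (pathFacts v)
    module C = Compose v
    c≡ : compose-at Φ (src n ⊚ zip x z q) (src n ⊚ zip x z q) (tgt n ⊚ zip x z q) (rs Φ (src n) ⊚ zip x z q) (path-vars n ⊚ zip x z q) ≡ compose-at Φ x x z (rs Φ x) q
    c≡ = compose-at≡ Φ (src-zip x z q) (src-zip x z q) (tgt-zip x z q) (trans (rs-⊚ Φ (src n) (zip x z q)) (cong (rs Φ) (src-zip x z q))) (path-vars-zip x z q)
    pv∶ : Path Φ ⊢ zip (src n) (tgt n) (path-vars n) ⇛ Path Φ
    pv∶ = ⇛≡ (sym (zip-vars n)) (id⇛ Path-wf)
    L = zip (src n) (tgt n) (compose-at Φ (src n) (src n) (tgt n) (rs Φ (src n)) (path-vars n))
    L∶ : Path Φ ⊢ L ⇛ Path Φ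
    L∶ = C.compose-at⇛ (rs⇛ src∶) pv∶
    generic : Path Φ ⊢ L ≐ idₛ ⇛ Path Φ
    generic = unique-path v v L idₛ L∶ (id⇛ Path-wf)
      (≡⇒≐ (trans (src-zip _ _ _) (sym (⊚-id _))) (⇛-comp src∶ L∶))
      (≡⇒≐ (trans (tgt-zip (src n) _ _) (sym (⊚-id _))) (⇛-comp tgt∶ L∶))
      (⇛≐≡ (sym (trans (zip-⊚ _ _ _ _) (zip≡ (src-rfl Φ) (tgt-rfl Φ) (trans (compose-⊚ Φ (src n) (src n) (tgt n) (rs Φ (src n)) (path-vars n) (rfl Φ)) c≡′)))) (sym (id-⊚ _))
        (C.compose-idˡ (rs⇛ (id⇛ v))))
      where
      c≡′ : compose-at Φ (src n ⊚ rfl Φ) (src n ⊚ rfl Φ) (tgt n ⊚ rfl Φ) (rs Φ (src n) ⊚ rfl Φ) (path-vars n ⊚ rfl Φ) ≡ compose-at Φ idₛ idₛ idₛ (rs Φ idₛ) (rs Φ idₛ)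
      c≡′ = compose-at≡ Φ (src-rfl Φ) (src-rfl Φ) (tgt-rfl Φ) (trans (rs-⊚ Φ (src n) (rfl Φ)) (cong (rs Φ) (src-rfl Φ))) (path-vars-zip idₛ idₛ (rs Φ idₛ))

  -- Two families of paths over (y, z : Φ, q : Id_Φ(y,z), x : Φ, p : Id_Φ(x,y)) agree if they do at q = r(y).

  path-induction : ∀ {m n} {Φ : Ctx m} {Ψ : Ctx n} → ⊢ Φ → ⊢ Ψ →
    (F G : ∀ {l} (x y z p q : Sub l m) → Sub l (tri n)) →
    (∀ {k l} (x y z p q : Sub l m) (ρ : Sub k l) → F x y z p q ⊚ ρ ≡ F (x ⊚ ρ) (y ⊚ ρ) (z ⊚ ρ) (p ⊚ ρ) (q ⊚ ρ)) →
    (∀ {k l} (x y z p q : Sub l m) (ρ : Sub k l) → G x y z p q ⊚ ρ ≡ G (x ⊚ ρ) (y ⊚ ρ) (z ⊚ ρ) (p ⊚ ρ) (q ⊚ ρ)) →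
    (∀ {l} {Γ : Ctx l} {x y z p q} → Γ ⊢ zip x y p ⇛ Path Φ → Γ ⊢ zip y z q ⇛ Path Φ → Γ ⊢ F x y z p q ⇛ Path Ψ) →
    (∀ {l} {Γ : Ctx l} {x y z p q} → Γ ⊢ zip x y p ⇛ Path Φ → Γ ⊢ zip y z q ⇛ Path Φ → Γ ⊢ G x y z p q ⇛ Path Ψ) →
    (∀ {l} (x y z p q : Sub l m) → src n ⊚ F x y z p q ≡ src n ⊚ G x y z p q) →
    (∀ {l} (x y z p q : Sub l m) → tgt n ⊚ F x y z p q ≡ tgt n ⊚ G x y z p q) →
    (∀ {l} {Γ : Ctx l} {x y p} → Γ ⊢ zip x y p ⇛ Path Φ → Γ ⊢ F x y y p (rs Φ y) ≐ G x y y p (rs Φ y) ⇛ Path Ψ) →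
    ∀ {l} {Γ : Ctx l} {x y z p q} → Γ ⊢ zip x y p ⇛ Path Φ → Γ ⊢ zip y z q ⇛ Path Φ →
    Γ ⊢ F x y z p q ≐ G x y z p q ⇛ Path Ψ
  path-induction {m} {n} {Φ} {Ψ} v w F G F-⊚ G-⊚ F⇛ G⇛ same-src same-tgt at-rfl {l} {x = x′} {y′} {z′} {p′} {q′} a b =
    ⇛≐≡ (trans (F-⊚ x y z p q t) (eq F)) (trans (G-⊚ x y z p q t) (eq G))
      (⇛-comp-≐ generic (⇛-refl (X.pair⇛ b (⇛≡ (zip≡ refl (sym (src-zip y′ z′ q′)) refl) a))))
    where
    open PathFacts (pathFacts v)
    module X = PathTo v src∶
    module R = PathTo v (⇛-comp src∶ rfl∶)
    x y z p q : Sub (m + (m + tri m)) m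
    x = vars₊ m ⊚ wk₊ m
    p = vars₊ m
    π : Sub (m + (m + tri m)) (tri m)
    π = wk₊ m ⊚ wk₊ m
    y = src m ⊚ π
    z = tgt m ⊚ π
    q = path-vars m ⊚ π
    p∶ : X.Total ⊢ zip x y p ⇛ Path Φ
    p∶ = ⇛≡ (zip≡ refl (⊚-assoc _ _ _) refl) X.the-path
    q∶ : X.Total ⊢ zip y z q ⇛ Path Φ
    q∶ = ⇛≡ (sym (zip-η π)) X.below
    ρ = lift₊ m (lift₊ m (rfl Φ))
    π-ρ : π ⊚ ρ ≡ rfl Φ ⊚ (wk₊ m ⊚ wk₊ m)
    π-ρ = wk₂-lift₊ m (rfl Φ)
    y-ρ : y ⊚ ρ ≡ wk₊ m ⊚ wk₊ m
    y-ρ = trans (⊚≡ _ π-ρ) (trans (sym (⊚-assoc _ _ _)) (trans (cong (_⊚ (wk₊ m ⊚ wk₊ m)) (src-rfl Φ)) (id-⊚ _)))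
    z-ρ : z ⊚ ρ ≡ wk₊ m ⊚ wk₊ m
    z-ρ = trans (⊚≡ _ π-ρ) (trans (sym (⊚-assoc _ _ _)) (trans (cong (_⊚ (wk₊ m ⊚ wk₊ m)) (tgt-rfl Φ)) (id-⊚ _)))
    q-ρ : q ⊚ ρ ≡ rs Φ (wk₊ m ⊚ wk₊ m)
    q-ρ = trans (⊚≡ _ π-ρ) (trans (sym (⊚-assoc _ _ _)) (trans (cong (_⊚ (wk₊ m ⊚ wk₊ m)) (path-vars-zip idₛ idₛ (rs Φ idₛ))) (trans (rs-⊚ Φ idₛ _) (cong (rs Φ) (id-⊚ _)))))

    pR∶ : R.Total ⊢ zip (x ⊚ ρ) (wk₊ m ⊚ wk₊ m) (p ⊚ ρ) ⇛ Path Φ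
    pR∶ = ⇛≡ (zip≡ (sym (point-lift₊ m (rfl Φ))) (trans (cong (λ a → a ⊚ wk₊ m ⊚ wk₊ m) (src-rfl Φ)) (cong (_⊚ wk₊ m) (id-⊚ _))) (sym (vars₊-lift₊ m _))) R.the-path

    generic : X.Total ⊢ F x y z p q ≐ G x y z p q ⇛ Path Ψ
    generic = unique-in v w (present₁ v) (F x y z p q) (G x y z p q) F∶ (G⇛ p∶ q∶)
      (≡⇒≐ (same-src x y z p q) (⇛-comp (PathFacts.src∶ (pathFacts w)) F∶))
      (≡⇒≐ (same-tgt x y z p q) (⇛-comp (PathFacts.tgt∶ (pathFacts w)) F∶))
      (⇛≐≡ (sym (trans (F-⊚ x y z p q ρ) (eqR F))) (sym (trans (G-⊚ x y z p q ρ) (eqR G))) (at-rfl pR∶))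
      where
      F∶ = F⇛ p∶ q∶
      eqR : (F : ∀ {l} (x y z p q : Sub l m) → Sub l (tri n)) →
            F (x ⊚ ρ) (y ⊚ ρ) (z ⊚ ρ) (p ⊚ ρ) (q ⊚ ρ) ≡ F (x ⊚ ρ) (wk₊ m ⊚ wk₊ m) (wk₊ m ⊚ wk₊ m) (p ⊚ ρ) (rs Φ (wk₊ m ⊚ wk₊ m))
      eqR F = cong₅ F refl y-ρ z-ρ refl q-ρ
    t = p′ ++ (x′ ++ zip y′ z′ q′)
    π-t : π ⊚ t ≡ zip y′ z′ q′
    π-t = wk₂-++ p′ x′ (zip y′ z′ q′)
    eq : (F : ∀ {l} (x y z p q : Sub l m) → Sub l (tri n)) → F (x ⊚ t) (y ⊚ t) (z ⊚ t) (p ⊚ t) (q ⊚ t) ≡ F x′ y′ z′ p′ q′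
    eq F = cong₅ F (point-++ p′ x′ _) (trans (⊚≡ (src m) π-t) (src-zip y′ z′ q′)) (trans (⊚≡ (tgt m) π-t) (tgt-zip y′ z′ q′))
             (vars₊-++ p′ (x′ ++ zip y′ z′ q′)) (trans (⊚≡ (path-vars m) π-t) (path-vars-zip y′ z′ q′))

  module ApCompose {m n} {Φ : Ctx m} {Ψ : Ctx n} {h : Sub m n} (h∶ : Φ ⊢ h ⇛ Ψ) where
    v = dom h∶
    w = cod h∶
    module C = Compose v
    module D = Compose w

    A : ∀ {l} (σ τ p : Sub l m) → Sub l n
    A σ τ p = ap Φ Ψ h ⊚ zip σ τ p

    A⇛ : ∀ {l} {Γ : Ctx l} {σ τ p} → Γ ⊢ zip σ τ p ⇛ Path Φ → Γ ⊢ zip (h ⊚ σ) (h ⊚ τ) (A σ τ p) ⇛ Path Ψ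
    A⇛ u = ⇛≡ (Apᵖ-zip Φ Ψ h _ _ _) (⇛-comp (Ap.ap⇛ v h∶) u)

    A-≐ : ∀ {l} {Γ : Ctx l} {σ τ p σ′ τ′ p′} → Γ ⊢ zip σ τ p ≐ zip σ′ τ′ p′ ⇛ Path Φ →
          Γ ⊢ zip (h ⊚ σ) (h ⊚ τ) (A σ τ p) ≐ zip (h ⊚ σ′) (h ⊚ τ′) (A σ′ τ′ p′) ⇛ Path Ψ
    A-≐ u = ⇛≐≡ (Apᵖ-zip Φ Ψ h _ _ _) (Apᵖ-zip Φ Ψ h _ _ _) (⇛-comp-≐ (⇛-refl (Ap.ap⇛ v h∶)) u)

    A-rs : ∀ {l} {Γ : Ctx l} {σ} → Γ ⊢ σ ⇛ Φ →
           Γ ⊢ zip (h ⊚ σ) (h ⊚ σ) (A σ σ (rs Φ σ)) ≐ zip (h ⊚ σ) (h ⊚ σ) (rs Ψ (h ⊚ σ)) ⇛ Path Ψ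
    A-rs {σ = σ} s = ⇛≐≡ (trans (⊚≡ (Apᵖ Φ Ψ h) (rfl-⊚ Φ σ)) (Apᵖ-zip Φ Ψ h _ _ _)) (trans (⊚-assoc _ _ _) (rfl-⊚ Ψ _))
      (⇛-comp-≐ (Ap.ap-rfl v h∶) (⇛-refl s))

    LHS RHS : ∀ {l} (x y z p q : Sub l m) → Sub l (tri n)
    LHS x y z p q = zip (h ⊚ x) (h ⊚ z) (A x z (compose-at Φ x y z p q))
    RHS x y z p q = zip (h ⊚ x) (h ⊚ z) (compose-at Ψ (h ⊚ x) (h ⊚ y) (h ⊚ z) (A x y p) (A y z q))

    A-⊚ : ∀ {k l} (σ τ p : Sub l m) (ρ : Sub k l) → A σ τ p ⊚ ρ ≡ A (σ ⊚ ρ) (τ ⊚ ρ) (p ⊚ ρ)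
    A-⊚ σ τ p ρ = ⊚≡ (ap Φ Ψ h) (zip-⊚ σ τ p ρ)

    LHS-⊚ : ∀ {k l} (x y z p q : Sub l m) (ρ : Sub k l) → LHS x y z p q ⊚ ρ ≡ LHS (x ⊚ ρ) (y ⊚ ρ) (z ⊚ ρ) (p ⊚ ρ) (q ⊚ ρ)
    LHS-⊚ x y z p q ρ = trans (zip-⊚ _ _ _ ρ) (zip≡ (⊚-assoc _ _ _) (⊚-assoc _ _ _)
      (trans (A-⊚ x z _ ρ) (cong (A (x ⊚ ρ) (z ⊚ ρ)) (compose-⊚ Φ x y z p q ρ))))

    RHS-⊚ : ∀ {k l} (x y z p q : Sub l m) (ρ : Sub k l) → RHS x y z p q ⊚ ρ ≡ RHS (x ⊚ ρ) (y ⊚ ρ) (z ⊚ ρ) (p ⊚ ρ) (q ⊚ ρ)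
    RHS-⊚ x y z p q ρ = trans (zip-⊚ _ _ _ ρ) (zip≡ (⊚-assoc _ _ _) (⊚-assoc _ _ _)
      (trans (compose-⊚ Ψ (h ⊚ x) (h ⊚ y) (h ⊚ z) (A x y p) (A y z q) ρ) (compose-at≡ Ψ (⊚-assoc h x ρ) (⊚-assoc h y ρ) (⊚-assoc h z ρ) (A-⊚ x y p ρ) (A-⊚ y z q ρ))))

    LHS⇛ : ∀ {l} {Γ : Ctx l} {x y z p q} → Γ ⊢ zip x y p ⇛ Path Φ → Γ ⊢ zip y z q ⇛ Path Φ → Γ ⊢ LHS x y z p q ⇛ Path Ψ
    LHS⇛ a b = A⇛ (C.compose-at⇛ a b)

    RHS⇛ : ∀ {l} {Γ : Ctx l} {x y z p q} → Γ ⊢ zip x y p ⇛ Path Φ → Γ ⊢ zip y z q ⇛ Path Φ → Γ ⊢ RHS x y z p q ⇛ Path Ψ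
    RHS⇛ a b = D.compose-at⇛ (A⇛ a) (A⇛ b)

    at-rfl : ∀ {l} {Γ : Ctx l} {x y p} → Γ ⊢ zip x y p ⇛ Path Φ → Γ ⊢ LHS x y y p (rs Φ y) ≐ RHS x y y p (rs Φ y) ⇛ Path Ψ
    at-rfl a = ⇛-trans (A-≐ (C.compose-idˡ a))
      (⇛-sym (⇛-trans (D.compose-at-≐ (⇛-refl (A⇛ a)) (A-rs (zip-tgt v a))) (D.compose-idˡ (A⇛ a))))

    ap-compose : ∀ {l} {Γ : Ctx l} {x y z p q} → Γ ⊢ zip x y p ⇛ Path Φ → Γ ⊢ zip y z q ⇛ Path Φ →
                 Γ ⊢ LHS x y z p q ≐ RHS x y z p q ⇛ Path Ψ
    ap-compose = path-induction v w LHS RHS LHS-⊚ RHS-⊚ LHS⇛ RHS⇛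
      (λ x y z p q → trans (src-zip _ _ _) (sym (src-zip _ _ _)))
      (λ x y z p q → trans (tgt-zip (h ⊚ x) _ _) (sym (tgt-zip (h ⊚ x) _ _))) at-rfl

  module ComposeAssoc {m} {Φ : Ctx m} (v : ⊢ Φ) where
    module C = Compose v
    open Two v

    LHS RHS : ∀ {l} (x y z w p q s : Sub l m) → Sub l (tri m)
    LHS x y z w p q s = zip x w (compose-at Φ x y w p (compose-at Φ y z w q s))
    RHS x y z w p q s = zip x w (compose-at Φ x z w (compose-at Φ x y z p q) s)

    LHS-⊚ : ∀ {k l} (x y z w p q s : Sub l m) (ρ : Sub k l) →
            LHS x y z w p q s ⊚ ρ ≡ LHS (x ⊚ ρ) (y ⊚ ρ) (z ⊚ ρ) (w ⊚ ρ) (p ⊚ ρ) (q ⊚ ρ) (s ⊚ ρ)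
    LHS-⊚ x y z w p q s ρ = trans (zip-⊚ _ _ _ ρ) (cong (zip _ _) (trans (compose-⊚ Φ x y w p (compose-at Φ y z w q s) ρ) (cong (compose-at Φ (x ⊚ ρ) (y ⊚ ρ) (w ⊚ ρ) (p ⊚ ρ)) (compose-⊚ Φ y z w q s ρ))))
    RHS-⊚ : ∀ {k l} (x y z w p q s : Sub l m) (ρ : Sub k l) →
            RHS x y z w p q s ⊚ ρ ≡ RHS (x ⊚ ρ) (y ⊚ ρ) (z ⊚ ρ) (w ⊚ ρ) (p ⊚ ρ) (q ⊚ ρ) (s ⊚ ρ)
    RHS-⊚ x y z w p q s ρ = trans (zip-⊚ _ _ _ ρ) (cong (zip _ _) (trans (compose-⊚ Φ x z w (compose-at Φ x y z p q) s ρ) (cong (λ a → compose-at Φ (x ⊚ ρ) (z ⊚ ρ) (w ⊚ ρ) a (s ⊚ ρ)) (compose-⊚ Φ x y z p q ρ))))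

    at-rfl : ∀ {l} {Γ : Ctx l} {x y z p q} → Γ ⊢ zip x y p ⇛ Path Φ → Γ ⊢ zip y z q ⇛ Path Φ →
             Γ ⊢ LHS x y z z p q (rs Φ z) ≐ RHS x y z z p q (rs Φ z) ⇛ Path Φ
    at-rfl a b = ⇛-trans (C.compose-at-≐ (⇛-refl a) (C.compose-idˡ b)) (⇛-sym (C.compose-idˡ (C.compose-at⇛ a b)))

    private
      x y z w p q s : Sub (m + (m + (m + (m + tri m)))) m
      x = vars₊ m ⊚ wk₊ m
      p = vars₊ m
      π : Sub (m + (m + (m + (m + tri m)))) (m + (m + tri m))
      π = wk₊ m ⊚ wk₊ m
      y = vars₊ m ⊚ wk₊ m ⊚ π
      q = vars₊ m ⊚ π
      ϖ : Sub (m + (m + (m + (m + tri m)))) (tri m)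
      ϖ = wk₊ m ⊚ wk₊ m ⊚ π
      z = src m ⊚ ϖ
      w = tgt m ⊚ ϖ
      s = path-vars m ⊚ ϖ
      p∶ : X₂.Total ⊢ zip x y p ⇛ Path Φ
      p∶ = ⇛≡ (zip≡ refl (⊚-assoc _ _ _) refl) X₂.the-path
      q∶ : X₂.Total ⊢ zip y z q ⇛ Path Φ
      q∶ = ⇛≡ (trans (zip-⊚ _ _ _ _) (zip≡ refl (trans (cong (_⊚ π) (⊚-assoc _ _ _)) (⊚-assoc _ _ _)) refl)) (⇛-comp X.the-path X₂.below)
      s∶ : X₂.Total ⊢ zip z w s ⇛ Path Φ
      s∶ = ⇛≡ (sym (zip-η ϖ)) (⇛-comp X.below X₂.below)

      ρ = lift₊ m (lift₊ m ρ₁)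
      πR : Sub (m + (m + (m + (m + m)))) m
      πR = wk₊ m ⊚ wk₊ m ⊚ (wk₊ m ⊚ wk₊ m)
      ϖ-ρ : ϖ ⊚ ρ ≡ rfl Φ ⊚ πR
      ϖ-ρ = trans (⊚-slide _ _ _ (wk₂-lift₊ m ρ₁)) (trans (cong (_⊚ (wk₊ m ⊚ wk₊ m)) (wk₂-lift₊ m (rfl Φ))) (⊚-assoc _ _ _))
      along : ∀ (a : Sub (tri m) m) {b} → a ⊚ rfl Φ ≡ b → a ⊚ ϖ ⊚ ρ ≡ b ⊚ πR
      along a eq = trans (⊚≡ _ ϖ-ρ) (trans (sym (⊚-assoc _ _ _)) (cong (_⊚ πR) eq))
      z-ρ : z ⊚ ρ ≡ πR
      z-ρ = trans (along (src m) (src-rfl Φ)) (id-⊚ _)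
      w-ρ : w ⊚ ρ ≡ πR
      w-ρ = trans (along (tgt m) (tgt-rfl Φ)) (id-⊚ _)
      s-ρ′ : s ⊚ ρ ≡ rs Φ πR
      s-ρ′ = trans (along (path-vars m) (path-vars-zip idₛ idₛ (rs Φ idₛ))) (trans (rs-⊚ Φ idₛ _) (cong (rs Φ) (id-⊚ _)))

      ρ∶ : R₂.Total ⊢ ρ ⇛ X₂.Total
      ρ∶ = ⇛≡ (sym ρ≡) (X₂.pair⇛ (⇛-comp ρ₁∶ R₂.below)
            (⇛≡ (zip≡ refl (trans (⊚-assoc _ _ _) (⊚-assoc _ _ _)) refl) R₂.the-path))
        where
        ρ≡ : ρ ≡ vars₊ m ++ (vars₊ m ⊚ wk₊ m ++ ρ₁ ⊚ (wk₊ m ⊚ wk₊ m))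
        ρ≡ = lift₊₂-split m ρ₁

      p∶R = ⇛≡ (trans (zip-⊚ _ _ _ _) refl) (⇛-comp p∶ ρ∶)
      q∶R = ⇛≡ (trans (zip-⊚ _ _ _ _) (zip≡ refl z-ρ refl)) (⇛-comp q∶ ρ∶)

      generic : X₂.Total ⊢ LHS x y z w p q s ≐ RHS x y z w p q s ⇛ Path Φ
      generic = unique-in v v present₂ (LHS x y z w p q s) (RHS x y z w p q s) L∶ (C.compose-at⇛ (C.compose-at⇛ p∶ q∶) s∶)
        (≡⇒≐ (trans (src-zip _ _ _) (sym (src-zip _ _ _))) (⇛-comp src∶ L∶))
        (≡⇒≐ (trans (tgt-zip x _ _) (sym (tgt-zip x _ _))) (⇛-comp tgt∶ L∶))
        (⇛≐≡ (sym (trans (LHS-⊚ x y z w p q s ρ) (eq LHS))) (sym (trans (RHS-⊚ x y z w p q s ρ) (eq RHS))) (at-rfl p∶R q∶R))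
        where
        L∶ = C.compose-at⇛ p∶ (C.compose-at⇛ q∶ s∶)
        M = m + (m + (m + (m + m)))
        eq : (F : (x y z w p q s : Sub M m) → Sub M (tri m)) →
             F (x ⊚ ρ) (y ⊚ ρ) (z ⊚ ρ) (w ⊚ ρ) (p ⊚ ρ) (q ⊚ ρ) (s ⊚ ρ) ≡ F (x ⊚ ρ) (y ⊚ ρ) πR πR (p ⊚ ρ) (q ⊚ ρ) (rs Φ πR)
        eq F = cong₇ F refl refl z-ρ w-ρ refl refl s-ρ′

    compose-assoc : ∀ {l} {Γ : Ctx l} {x y z w p q s} → Γ ⊢ zip x y p ⇛ Path Φ → Γ ⊢ zip y z q ⇛ Path Φ → Γ ⊢ zip z w s ⇛ Path Φ →
                    Γ ⊢ LHS x y z w p q s ≐ RHS x y z w p q s ⇛ Path Φ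
    compose-assoc {l} {x = x′} {y′} {z′} {w′} {p′} {q′} {s′} a b c =
      ⇛≐≡ (trans (LHS-⊚ x y z w p q s t) (eq LHS)) (trans (RHS-⊚ x y z w p q s t) (eq RHS))
        (⇛-comp-≐ generic (⇛-refl (X₂.pair⇛ (X.pair⇛ c (⇛≡ (zip≡ refl (sym (src-zip z′ w′ s′)) refl) b))
          (⇛≡ (zip≡ refl (sym (point-++ q′ y′ _)) refl) a))))
      where
      t₀ = q′ ++ (y′ ++ zip z′ w′ s′)
      t = p′ ++ (x′ ++ t₀)
      π-t : π ⊚ t ≡ t₀
      π-t = wk₂-++ p′ x′ t₀
      ϖ-t : ϖ ⊚ t ≡ zip z′ w′ s′
      ϖ-t = trans (⊚≡ _ π-t) (wk₂-++ q′ y′ _)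
      eq : (F : (x y z w p q s : Sub l m) → Sub l (tri m)) →
           F (x ⊚ t) (y ⊚ t) (z ⊚ t) (w ⊚ t) (p ⊚ t) (q ⊚ t) (s ⊚ t) ≡ F x′ y′ z′ w′ p′ q′ s′
      eq F = cong₇ F (point-++ p′ x′ t₀) (trans (⊚≡ (vars₊ m ⊚ wk₊ m) π-t) (point-++ q′ y′ _))
               (trans (⊚≡ (src m) ϖ-t) (src-zip z′ w′ s′)) (trans (⊚≡ (tgt m) ϖ-t) (tgt-zip z′ w′ s′))
               (vars₊-++ p′ (x′ ++ t₀)) (trans (⊚≡ (vars₊ m) π-t) (vars₊-++ q′ (y′ ++ zip z′ w′ s′)))
               (trans (⊚≡ (path-vars m) ϖ-t) (path-vars-zip z′ w′ s′))

  module Interchange {m n} {Φ : Ctx m} {Ψ : Ctx n} {h h′ β : Sub m n} (h∶ : Φ ⊢ h ⇛ Ψ) (h′∶ : Φ ⊢ h′ ⇛ Ψ)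
                     (β∶ : Φ ⊢ zip h h′ β ⇛ Path Ψ) where
    v = dom h∶
    w = cod h∶
    module D = Compose w
    module H = ApCompose h∶
    module H′ = ApCompose h′∶
    open PathFacts (pathFacts v)

    LHS RHS : ∀ {l} (x y p : Sub l m) → Sub l (tri n)
    LHS x y p = zip (h ⊚ x) (h′ ⊚ y) (compose-at Ψ (h ⊚ x) (h ⊚ y) (h′ ⊚ y) (H.A x y p) (β ⊚ y))
    RHS x y p = zip (h ⊚ x) (h′ ⊚ y) (compose-at Ψ (h ⊚ x) (h′ ⊚ x) (h′ ⊚ y) (β ⊚ x) (H′.A x y p))

    LHS-⊚ : ∀ {k l} (x y p : Sub l m) (ρ : Sub k l) → LHS x y p ⊚ ρ ≡ LHS (x ⊚ ρ) (y ⊚ ρ) (p ⊚ ρ)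
    LHS-⊚ x y p ρ = trans (zip-⊚ _ _ _ ρ) (zip≡ (⊚-assoc _ _ _) (⊚-assoc _ _ _)
      (trans (compose-⊚ Ψ (h ⊚ x) (h ⊚ y) (h′ ⊚ y) (H.A x y p) (β ⊚ y) ρ) (compose-at≡ Ψ (⊚-assoc h x ρ) (⊚-assoc h y ρ) (⊚-assoc h′ y ρ) (H.A-⊚ x y p ρ) (⊚-assoc β y ρ))))
    RHS-⊚ : ∀ {k l} (x y p : Sub l m) (ρ : Sub k l) → RHS x y p ⊚ ρ ≡ RHS (x ⊚ ρ) (y ⊚ ρ) (p ⊚ ρ)
    RHS-⊚ x y p ρ = trans (zip-⊚ _ _ _ ρ) (zip≡ (⊚-assoc _ _ _) (⊚-assoc _ _ _)
      (trans (compose-⊚ Ψ (h ⊚ x) (h′ ⊚ x) (h′ ⊚ y) (β ⊚ x) (H′.A x y p) ρ) (compose-at≡ Ψ (⊚-assoc h x ρ) (⊚-assoc h′ x ρ) (⊚-assoc h′ y ρ) (⊚-assoc β x ρ) (H′.A-⊚ x y p ρ))))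

    β-at : ∀ {l} {Γ : Ctx l} {x} → Γ ⊢ x ⇛ Φ → Γ ⊢ zip (h ⊚ x) (h′ ⊚ x) (β ⊚ x) ⇛ Path Ψ
    β-at s = ⇛≡ (zip-⊚ _ _ _ _) (⇛-comp β∶ s)

    LHS⇛ : ∀ {l} {Γ : Ctx l} {x y p} → Γ ⊢ zip x y p ⇛ Path Φ → Γ ⊢ LHS x y p ⇛ Path Ψ
    LHS⇛ u = D.compose-at⇛ (H.A⇛ u) (β-at (zip-tgt v u))
    RHS⇛ : ∀ {l} {Γ : Ctx l} {x y p} → Γ ⊢ zip x y p ⇛ Path Φ → Γ ⊢ RHS x y p ⇛ Path Ψ
    RHS⇛ u = D.compose-at⇛ (β-at (zip-src v u)) (H′.A⇛ u)

    at-rfl : ∀ {l} {Γ : Ctx l} {x} → Γ ⊢ x ⇛ Φ → Γ ⊢ LHS x x (rs Φ x) ≐ RHS x x (rs Φ x) ⇛ Path Ψ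
    at-rfl s = ⇛-trans (⇛-trans (D.compose-at-≐ (H.A-rs s) (⇛-refl (β-at s))) (compose-idʳ w (β-at s)))
      (⇛-sym (⇛-trans (D.compose-at-≐ (⇛-refl (β-at s)) (H′.A-rs s)) (D.compose-idˡ (β-at s))))

    interchange : ∀ {l} {Γ : Ctx l} {x y p} → Γ ⊢ zip x y p ⇛ Path Φ → Γ ⊢ LHS x y p ≐ RHS x y p ⇛ Path Ψ
    interchange {l} {x = x} {y} {p} u =
      ⇛≐≡ (trans (LHS-⊚ _ _ _ t) (eq LHS)) (trans (RHS-⊚ _ _ _ t) (eq RHS)) (⇛-comp-≐ generic (⇛-refl u))
      where
      t = zip x y p
      eq : (F : (x y p : Sub l m) → Sub l (tri n)) → F (src m ⊚ t) (tgt m ⊚ t) (path-vars m ⊚ t) ≡ F x y p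
      eq F = cong₃ F (src-zip x y p) (tgt-zip x y p) (path-vars-zip x y p)
      L = LHS (src m) (tgt m) (path-vars m)
      R = RHS (src m) (tgt m) (path-vars m)
      pv∶ : Path Φ ⊢ zip (src m) (tgt m) (path-vars m) ⇛ Path Φ
      pv∶ = ⇛≡ (sym (zip-vars m)) (id⇛ Path-wf)
      L∶ = LHS⇛ pv∶
      eq′ : (F : (x y p : Sub m m) → Sub m (tri n)) → F (src m ⊚ rfl Φ) (tgt m ⊚ rfl Φ) (path-vars m ⊚ rfl Φ) ≡ F idₛ idₛ (rs Φ idₛ)
      eq′ F = cong₃ F (src-rfl Φ) (tgt-rfl Φ) (path-vars-zip idₛ idₛ (rs Φ idₛ))
      generic : Path Φ ⊢ L ≐ R ⇛ Path Ψ
      generic = unique-path v w L R L∶ (RHS⇛ pv∶)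
        (≡⇒≐ (trans (src-zip _ _ _) (sym (src-zip _ _ _))) (⇛-comp (PathFacts.src∶ (pathFacts w)) L∶))
        (≡⇒≐ (trans (tgt-zip (h ⊚ src m) _ _) (sym (tgt-zip (h ⊚ src m) _ _))) (⇛-comp (PathFacts.tgt∶ (pathFacts w)) L∶))
        (⇛≐≡ (sym (trans (LHS-⊚ _ _ _ (rfl Φ)) (eq′ LHS))) (sym (trans (RHS-⊚ _ _ _ (rfl Φ)) (eq′ RHS))) (at-rfl (id⇛ v)))

module Congruence (S : TypeTheory) where
  open TypeTheory S
  open GroupoidLaws S public

  ctx-wf : ∀ {n} {Γ Γ′ : Ctx n} → ⊢ Γ ≐ Γ′ → ⊢ Γ
  ctx-wf []      = []
  ctx-wf (c ▹ e) = ctx-wf c ▹ left-type e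

  ⧺-prefix-≐ : ∀ {n k} {Γ Γ′ : Ctx n} (Δ Δ′ : Tele n k) → ⊢ Γ ⧺ Δ ≐ Γ′ ⧺ Δ′ → ⊢ Γ ≐ Γ′
  ⧺-prefix-≐ []      []        c = c
  ⧺-prefix-≐ (A ∷ Δ) (A′ ∷ Δ′) c with ⧺-prefix-≐ Δ Δ′ c
  ... | b ▹ _ = b

  ▹▹-prefix-≐ : ∀ {n k} {Γ Γ′ : Ctx n} (Θ Θ′ : Ext n k) → ⊢ Γ ▹▹ Θ ≐ Γ′ ▹▹ Θ′ → ⊢ Γ ≐ Γ′
  ▹▹-prefix-≐ []      []        c       = c
  ▹▹-prefix-≐ (Θ ▹ A) (Θ′ ▹ A′) (c ▹ e) = ▹▹-prefix-≐ Θ Θ′ c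

  ↑-≐ : ∀ {m n} {Γ : Ctx m} {Ξ : Ctx n} {σ σ′ A} → Γ ⊢ σ ≐ σ′ ⇛ Ξ → Ξ ⊢ A type → Γ ▹ A [ σ ]ᵀ ⊢ ↑ σ ≐ ↑ σ′ ⇛ Ξ ▹ A
  ↑-≐ {A = A} s A∶ = ext (⇛-comp-≐ s (⇛-refl (wk⇛ B∶))) A∶ (≐-refl (v₀∶ B∶) ≐≡ [⊚]ᵀ A _ _)
    where B∶ = subst-type (⇛-left s) A∶

  ⧺-≐ : ∀ {m n k} {Γ Γ′ : Ctx m} {Ξ Ξ′ : Ctx n} {σ σ′} (Δ Δ′ : Tele n k) → ⊢ Γ ≐ Γ′ → ⊢ Ξ ⧺ Δ ≐ Ξ′ ⧺ Δ′ →
        Γ ⊢ σ ≐ σ′ ⇛ Ξ → (⊢ Γ ⧺ Δ [ σ ]ᴰ ≐ Γ′ ⧺ Δ′ [ σ′ ]ᴰ) × (Γ ⧺ Δ [ σ ]ᴰ ⊢ lift k σ ≐ lift k σ′ ⇛ Ξ ⧺ Δ)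
  ⧺-≐ []      []        c e s = c , s
  ⧺-≐ (A ∷ Δ) (A′ ∷ Δ′) c e s with ⧺-prefix-≐ Δ Δ′ e
  ... | _ ▹ a = ⧺-≐ Δ Δ′ (c ▹ subst-type-≐ s a) e (↑-≐ s (left-type a))

  ▹▹-≐ : ∀ {m n k} {Γ Γ′ : Ctx m} {Ξ Ξ′ : Ctx n} {σ σ′} (Θ Θ′ : Ext n k) → ⊢ Γ ≐ Γ′ → ⊢ Ξ ▹▹ Θ ≐ Ξ′ ▹▹ Θ′ →
         Γ ⊢ σ ≐ σ′ ⇛ Ξ → (⊢ Γ ▹▹ Θ [ σ ]ᴱ ≐ Γ′ ▹▹ Θ′ [ σ′ ]ᴱ) × (Γ ▹▹ Θ [ σ ]ᴱ ⊢ lift₊ k σ ≐ lift₊ k σ′ ⇛ Ξ ▹▹ Θ)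
  ▹▹-≐ []      []        c e       s = c , s
  ▹▹-≐ (Θ ▹ A) (Θ′ ▹ A′) c (e ▹ a) s with ▹▹-≐ Θ Θ′ c e s
  ... | d , t = d ▹ subst-type-≐ t a , ↑-≐ t (left-type a)

  Jᴱ-cong : ∀ {n k l} {Γ : Ctx n} {A A′} (Δ Δ′ : Tele (3 + n) k) (Θ Θ′ : Ext (3 + n ⊞ k) l) {d d′} →
            ⊢ (path Γ A ⧺ Δ) ▹▹ Θ ≐ (path Γ A′ ⧺ Δ′) ▹▹ Θ′ →
            (Γ ▹ A) ⧺ Δ [ refl-path A ]ᴰ ⊢ Θ [ lift k (refl-path A) ]ᴱ ∋ d ≐ d′ →
            path Γ A ⧺ Δ ⊢ Θ ∋ Jᴱ A Δ Θ d ≐ Jᴱ A′ Δ′ Θ′ d′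
  Jᴱ-cong Δ Δ′ []      []        {[]}     {[]}       c       e = ⇛-refl (id⇛ (ctx-wf c))
  Jᴱ-cong {k = k} {A = A} Δ Δ′ (_▹_ {l} Θ C) (Θ′ ▹ C′) {d ∷ ds} {d′ ∷ ds′} (c ▹ C≐) (ext e C∶ d≐) =
    ext ih (left-type C≐) (J-cong (▹▹-prefix-≐ Θ Θ′ c) (subst-type-≐ ih C≐) d≐′)
    where
    ρ = lift k (refl-path A)
    es = Jᴱ A Δ Θ ds
    ih = Jᴱ-cong Δ Δ′ Θ Θ′ c e
    eq : C [ es ++ idₛ ]ᵀ [ ρ ]ᵀ ≡ C [ lift₊ l ρ ]ᵀ [ es ⊚ ρ ++ idₛ ]ᵀ
    eq = trans ([]-[]ᵀ C (++id-⊚ es ρ)) (sym ([⊚]ᵀ C _ _))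
    d≐′ : _ ⊢ d ≐ d′ ∶ C [ es ++ idₛ ]ᵀ [ ρ ]ᵀ
    d≐′ = conv-≐ d≐ (teq≡ refl (sym eq) (subst-type-≐ (⇛-sym (proj₂ (Jᴱ-elim Δ Θ (ctx-wf c) (⇛-left e)))) (≐ᵀ-refl C∶)))

  record CtxCong {n} (Φ Φ′ : Ctx n) : Set where
    field
      Path-cong : ⊢ Path Φ ≐ Path Φ′
      rs-cong   : ∀ {m} {Γ : Ctx m} {σ} → Γ ⊢ σ ⇛ Φ → Γ ⊢ zip σ σ (rs Φ σ) ≐ zip σ σ (rs Φ′ σ) ⇛ Path Φ
      J-congᶜ   : ∀ {k l} (Δ Δ′ : Tele (tri n) k) (Θ Θ′ : Ext (tri n ⊞ k) l) {d d′} →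
                  ⊢ (Path Φ ⧺ Δ) ▹▹ Θ ≐ (Path Φ′ ⧺ Δ′) ▹▹ Θ′ →
                  Φ ⧺ Δ [ rfl Φ ]ᴰ ⊢ Θ [ lift k (rfl Φ) ]ᴱ ∋ d ≐ d′ →
                  Path Φ ⧺ Δ ⊢ Θ ∋ Jᶜ Φ Δ Θ d ≐ Jᶜ Φ′ Δ′ Θ′ d′

  ctxCong : ∀ {n} {Φ Φ′ : Ctx n} → ⊢ Φ ≐ Φ′ → CtxCong Φ Φ′
  ctxCong [] = record
    { Path-cong = [] ; rs-cong = λ { ([] w) → [] w }
    ; J-congᶜ = λ {k} Δ Δ′ Θ Θ′ {d} {d′} c e → coe ([id]ᴰ Δ) (trans (cong (Θ [_]ᴱ) (lift-id k)) ([id]ᴱ Θ)) e }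
    where
    coe : ∀ {m k l} {Γ : Ctx m} {Δ Δ′ : Tele m k} {Θ Θ′ : Ext (m ⊞ k) l} {d d′} → Δ ≡ Δ′ → Θ ≡ Θ′ →
          Γ ⧺ Δ ⊢ Θ ∋ d ≐ d′ → Γ ⧺ Δ′ ⊢ Θ′ ∋ d ≐ d′
    coe refl refl e = e
  ctxCong {suc n} {Λ ▹ D} {Λ′ ▹ D′} (c ▹ D≐) = record
    { Path-cong = Path-cong′ ; rs-cong = rs-cong′ ; J-congᶜ = J-cong′ }
    where
    open CtxCong (ctxCong c)
    w = ctx-wf c
    D∶ = left-type D≐
    open PathFacts (pathFacts w)
    open Step (pathFacts w) D∶
    s≐ = subst-type-≐ (⇛-refl src∶) D≐
    t≐ = subst-type-≐ (⇛-refl tgt∶) D≐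
    wkt≐ = subst-type-≐ (⇛-refl (wk⇛ Ds∶)) t≐
    tr-cong : Path Λ ▹ D [ tgt n ]ᵀ ⊢ transport Λ D ≐ transport Λ′ D′ ∶ D [ src n ]ᵀ [ wk ]ᵀ
    tr-cong = head-∋-≐ (Jᶜ Λ (D [ tgt n ]ᵀ ∷ []) ([] ▹ D [ src n ]ᵀ [ wk ]ᵀ) (var zero ∷ []))
      (Jᶜ Λ′ (D′ [ tgt n ]ᵀ ∷ []) ([] ▹ D′ [ src n ]ᵀ [ wk ]ᵀ) (var zero ∷ []))
      (J-congᶜ (D [ tgt n ]ᵀ ∷ []) (D′ [ tgt n ]ᵀ ∷ []) ([] ▹ D [ src n ]ᵀ [ wk ]ᵀ) ([] ▹ D′ [ src n ]ᵀ [ wk ]ᵀ)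
        {var zero ∷ []} {var zero ∷ []}
        (Path-cong ▹ t≐ ▹ subst-type-≐ (⇛-refl (wk⇛ Dt∶)) s≐) (⇛-refl v∶))
      where
      R∶ = subst-type rfl∶ Dt∶
      v∶ : Λ ▹ D [ tgt n ]ᵀ [ rfl Λ ]ᵀ ⊢ ([] ▹ D [ src n ]ᵀ [ wk ]ᵀ [ ↑ (rfl Λ) ]ᵀ) ∋ (var zero ∷ [])
      v∶ = ext (id⇛ (context-of R∶ ▹ R∶)) (subst-type (↑⇛ rfl∶ Dt∶) (wk-type Dt∶ Ds∶))
               (v₀∶ R∶ ∶≡ trans (cong (_[ wk ]ᵀ) tgt-type) (trans (sym wk-src-type) (sym ([id]ᵀ _))))
    Id-type≐ : Path Λ ▹ D [ src n ]ᵀ ▹ D [ tgt n ]ᵀ [ wk ]ᵀ ⊢ Id-type ≐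
               Id (D′ [ src n ]ᵀ [ wk ]ᵀ [ wk ]ᵀ) (var (suc zero)) (transport Λ′ D′ [ var zero ∷ wk ⊚ wk ]) type
    Id-type≐ = Id-cong (subst-type-≐ (⇛-refl (wk⇛ B∶)) (subst-type-≐ (⇛-refl (wk⇛ Ds∶)) s≐))
      (≐-refl (variables (Path-wf ▹ Ds∶ ▹ B∶) (suc zero)))
      (subst-term-≐ (⇛-refl (ext (wkwk Ds∶ B∶) Dt∶ (v₀∶ B∶ ∶≡ [⊚]ᵀ _ _ _))) tr-cong ≐≡
        trans ([]-[]ᵀ _ (wk-∷ _ _)) (sym ([⊚]ᵀ _ _ _)))
      where B∶ = wk-type Ds∶ Dt∶
    Path-cong′ : ⊢ Path (Λ ▹ D) ≐ Path (Λ′ ▹ D′)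
    Path-cong′ = Path-cong ▹ s≐ ▹ wkt≐ ▹ Id-type≐
    rs-cong′ : ∀ {m} {Γ : Ctx m} {σ} → Γ ⊢ σ ⇛ Λ ▹ D → Γ ⊢ zip σ σ (rs (Λ ▹ D) σ) ≐ zip σ σ (rs (Λ′ ▹ D′) σ) ⇛ Path (Λ ▹ D)
    rs-cong′ {σ = y ∷ σ} (ext s _ y∶) with rs⇛ (ext s D∶ y∶)
    ... | ext (ext (ext u A∶ a∶) B∶ b∶) C∶ q∶ = ext (ext (ext (rs-cong s) A∶ (≐-refl a∶)) B∶ (≐-refl b∶)) C∶
      (conv-≐ (r-cong (subst-type-≐ (⇛-refl s) D≐) (≐-refl y∶))
        (teq≡ refl (sym (trans (Id-type-at _ _ _) (Id≡ (cong (D [_]ᵀ) (src-zip σ σ (rs Λ σ))) refl refl)))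
          (Id-cong (≐ᵀ-refl (type-of y∶)) (≐-refl y∶) (≐-sym (eq≡ (cong (λ u → transport Λ D [ y ∷ u ]) (rfl-⊚ Λ σ)) refl refl (transport-rfl s y∶))))))
    J-cong′ : ∀ {k l} (Δ Δ′ : Tele (3 + tri n) k) (Θ Θ′ : Ext (3 + tri n ⊞ k) l) {d d′} →
              ⊢ (Path (Λ ▹ D) ⧺ Δ) ▹▹ Θ ≐ (Path (Λ′ ▹ D′) ⧺ Δ′) ▹▹ Θ′ →
              (Λ ▹ D) ⧺ Δ [ rfl (Λ ▹ D) ]ᴰ ⊢ Θ [ lift k (rfl (Λ ▹ D)) ]ᴱ ∋ d ≐ d′ →
              Path (Λ ▹ D) ⧺ Δ ⊢ Θ ∋ Jᶜ (Λ ▹ D) Δ Θ d ≐ Jᶜ (Λ′ ▹ D′) Δ′ Θ′ d′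
    J-cong′ {k} {l} Δ Δ′ Θ Θ′ {d} {d′} e d≐ =
      J-congᶜ (Path-step Λ D Δ) (Path-step Λ′ D′ Δ′) Θ Θ′ e (∋-converts-≐ Θ₁ cv inner)
      where
      ρ₁ = ↑ (↑ (↑ (rfl Λ)))
      ρ₁′ = ↑ (↑ (↑ (rfl Λ′)))
      ρ₂ = refl-path D
      Δ₁ = Δ [ ρ₁ ]ᴰ
      Θ₁ = Θ [ lift k ρ₁ ]ᴱ
      rfl≐ : Λ ⊢ rfl Λ ≐ rfl Λ′ ⇛ Path Λ
      rfl≐ = rs-cong (id⇛ w)
      wΔ = ▹▹-prefix Θ (ctx-wf e)
      cv : Converts (path Λ D ⧺ Δ₁) (Λ ⧺ Path-step Λ D Δ [ rfl Λ ]ᴰ)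
      cv = sym-converts (⧺-converts Δ₁ (sym-converts restricted) (dom (lift⇛ (Path-step Λ D Δ) rfl∶ wΔ)))
      path≐ : ⊢ path Λ D ≐ path Λ D′
      path≐ = ctx-refl w ▹ D≐ ▹ e′ ▹ Id-cong (subst-type-≐ (⇛-refl (wk⇛ (left-type e′))) e′)
                (≐-refl (variables (w ▹ D∶ ▹ left-type e′) (suc zero))) (≐-refl (v₀∶ (left-type e′)))
        where e′ = subst-type-≐ (⇛-refl (wk⇛ D∶)) D≐
      ρ₁≐ : path Λ D ⊢ ρ₁ ≐ ρ₁′ ⇛ Path (Λ ▹ D)
      ρ₁≐ = ctx-⇛-≐ (sym-converts restricted) (id-converts Path-wf′)
              (proj₂ (⧺-≐ (Path-step Λ D []) (Path-step Λ D []) (ctx-refl w) (ctx-refl Path-wf′) rfl≐))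
      Δ≐ = ⧺-≐ Δ Δ′ path≐ (▹▹-prefix-≐ Θ Θ′ e) ρ₁≐
      rfl≡ : ρ₁ ⊚ ρ₂ ≡ rfl (Λ ▹ D)
      rfl≡ = ↑³-refl-path Λ D
      coe : ∀ {m k l} {Γ : Ctx m} {Δ Δ′ : Tele m k} {Θ Θ′ : Ext (m ⊞ k) l} {d d′} → Δ ≡ Δ′ → Θ ≡ Θ′ →
            Γ ⧺ Δ′ ⊢ Θ′ ∋ d ≐ d′ → Γ ⧺ Δ ⊢ Θ ∋ d ≐ d′
      coe refl refl e = e
      inner = Jᴱ-cong Δ₁ (Δ′ [ ρ₁′ ]ᴰ) Θ₁ (Θ′ [ lift k ρ₁′ ]ᴱ) (proj₁ (▹▹-≐ Θ Θ′ (proj₁ Δ≐) e (proj₂ Δ≐)))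
        (coe (trans ([⊚]ᴰ Δ _ _) (cong (Δ [_]ᴰ) rfl≡)) (trans ([⊚]ᴱ Θ _ _) (cong (Θ [_]ᴱ) (trans (lift-⊚ k _ _) (cong (lift k) rfl≡)))) d≐)

  Path-converts : ∀ {n} {Φ Φ′ : Ctx n} → ⊢ Φ ≐ Φ′ → Converts (Path Φ) (Path Φ′)
  Path-converts c = ≐-converts (CtxCong.Path-cong (ctxCong c))

  to-Path : ∀ {m n} {Γ : Ctx m} {Φ Φ′ : Ctx n} {u} → ⊢ Φ ≐ Φ′ → Γ ⊢ u ⇛ Path Φ → Γ ⊢ u ⇛ Path Φ′
  to-Path c u = ctx-⇛ (id-converts (dom u)) (Path-converts c) u

  to-Path-≐ : ∀ {m n} {Γ : Ctx m} {Φ Φ′ : Ctx n} {u u′} → ⊢ Φ ≐ Φ′ → Γ ⊢ u ≐ u′ ⇛ Path Φ → Γ ⊢ u ≐ u′ ⇛ Path Φ′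
  to-Path-≐ c u = ctx-⇛-≐ (id-converts (dom (⇛-left u))) (Path-converts c) u

  ap-ctx : ∀ {m n} {Φ Φ′ : Ctx m} {Ψ Ψ′ : Ctx n} {h} → ⊢ Φ ≐ Φ′ → ⊢ Ψ ≐ Ψ′ → Φ ⊢ h ⇛ Ψ →
           Path Φ ⊢ Apᵖ Φ Ψ h ≐ Apᵖ Φ′ Ψ′ h ⇛ Path Ψ
  ap-ctx {Φ = Φ} {Φ′} {Ψ} {Ψ′} {h} c d h∶ =
    unique-path v w (Apᵖ Φ Ψ h) (Apᵖ Φ′ Ψ′ h) a∶ (ctx-⇛ (sym-converts (Path-converts c)) (sym-converts (Path-converts d)) (Ap.ap⇛ v′ h∶′))
      (≡⇒≐ (trans (src-Apᵖ Φ Ψ h) (sym (src-Apᵖ Φ′ Ψ′ h))) (⇛-comp (PathFacts.src∶ (pathFacts w)) a∶))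
      (≡⇒≐ (trans (tgt-Apᵖ Φ Ψ h) (sym (tgt-Apᵖ Φ′ Ψ′ h))) (⇛-comp (PathFacts.tgt∶ (pathFacts w)) a∶))
      (⇛-trans (Ap.ap-rfl v h∶) (⇛-trans (⇛≐≡ (sym (rfl-⊚ Ψ h)) (sym (rfl-⊚ Ψ′ h)) (CtxCong.rs-cong (ctxCong d) h∶))
        (⇛-sym (⇛-trans
          (⇛-comp-≐ (⇛-refl (ctx-⇛ (sym-converts (Path-converts c)) (sym-converts (Path-converts d)) (Ap.ap⇛ v′ h∶′))) (CtxCong.rs-cong (ctxCong c) (id⇛ v)))
          (ctx-⇛-≐ (sym-converts (≐-converts c)) (sym-converts (Path-converts d)) (Ap.ap-rfl v′ h∶′))))))
    where
    v = dom h∶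
    w = cod h∶
    h∶′ = ctx-⇛ (≐-converts c) (≐-converts d) h∶
    v′ = dom h∶′
    a∶ = Ap.ap⇛ v h∶

  compose-ctx : ∀ {m n} {Γ : Ctx m} {Φ Φ′ : Ctx n} {x y z p q} → ⊢ Φ ≐ Φ′ →
                Γ ⊢ zip x y p ⇛ Path Φ → Γ ⊢ zip y z q ⇛ Path Φ →
                Γ ⊢ zip x z (compose-at Φ x y z p q) ≐ zip x z (compose-at Φ′ x y z p q) ⇛ Path Φ
  compose-ctx {n = n} {Φ = Φ} {Φ′} c = path-induction v v (F Φ) (F Φ′) (F-⊚ Φ) (F-⊚ Φ′) C.compose-at⇛ F⇛
    (λ x y z p q → trans (src-zip x z _) (sym (src-zip x z _)))
    (λ x y z p q → trans (tgt-zip x z _) (sym (tgt-zip x z _))) at-rfl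
    where
    v = ctx-wf c
    v′ = ctx-wf (ctx-sym c)
    module C = Compose v
    module C′ = Compose v′
    F : Ctx n → ∀ {l} (x y z p q : Sub l n) → Sub l (tri n)
    F Φ x y z p q = zip x z (compose-at Φ x y z p q)
    F-⊚ : ∀ Φ {k l} (x y z p q : Sub l n) (ρ : Sub k l) → F Φ x y z p q ⊚ ρ ≡ F Φ (x ⊚ ρ) (y ⊚ ρ) (z ⊚ ρ) (p ⊚ ρ) (q ⊚ ρ)
    F-⊚ Φ x y z p q ρ = trans (zip-⊚ _ _ _ ρ) (cong (zip (x ⊚ ρ) (z ⊚ ρ)) (compose-⊚ Φ x y z p q ρ))
    F⇛ : ∀ {l} {Γ : Ctx l} {x y z p q} → Γ ⊢ zip x y p ⇛ Path Φ → Γ ⊢ zip y z q ⇛ Path Φ → Γ ⊢ F Φ′ x y z p q ⇛ Path Φ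
    F⇛ a b = to-Path (ctx-sym c) (C′.compose-at⇛ (to-Path c a) (to-Path c b))
    at-rfl : ∀ {l} {Γ : Ctx l} {x y p} → Γ ⊢ zip x y p ⇛ Path Φ → Γ ⊢ F Φ x y y p (rs Φ y) ≐ F Φ′ x y y p (rs Φ y) ⇛ Path Φ
    at-rfl a = ⇛-trans (C.compose-idˡ a) (⇛-sym (to-Path-≐ (ctx-sym c)
      (⇛-trans (C′.compose-at-≐ (⇛-refl (to-Path c a)) (to-Path-≐ c (CtxCong.rs-cong (ctxCong c) (zip-tgt v a))))
        (C′.compose-idˡ (to-Path c a)))))

-- Strict categories, presented by cells together with a relation of equality on the cells of each
-- dimension.  The equality of arrows relates arrows between possibly different (but then equal)
-- pairs of objects, and an arrow can be cast along equalities of its end points.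

record Category : Set₁ where
  infix  4 _≋_ _≈_
  infixr 9 _∘_
  field
    Ob  : Set
    _≋_ : Ob → Ob → Set
    Hom : Ob → Ob → Set
    _≈_ : ∀ {A B A′ B′} → Hom A B → Hom A′ B′ → Set

    ≋-refl  : ∀ {A} → A ≋ A
    ≋-sym   : ∀ {A B} → A ≋ B → B ≋ A
    ≋-trans : ∀ {A B C} → A ≋ B → B ≋ C → A ≋ C

    ≈-refl  : ∀ {A B} {f : Hom A B} → f ≈ f
    ≈-sym   : ∀ {A B A′ B′} {f : Hom A B} {g : Hom A′ B′} → f ≈ g → g ≈ f
    ≈-trans : ∀ {A B A′ B′ A″ B″} {f : Hom A B} {g : Hom A′ B′} {h : Hom A″ B″} → f ≈ g → g ≈ h → f ≈ h
    ≈-dom   : ∀ {A B A′ B′} {f : Hom A B} {g : Hom A′ B′} → f ≈ g → A ≋ A′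
    ≈-cod   : ∀ {A B A′ B′} {f : Hom A B} {g : Hom A′ B′} → f ≈ g → B ≋ B′
    cast    : ∀ {A B A′ B′} → A ≋ A′ → B ≋ B′ → Hom A B → Hom A′ B′
    cast-≈  : ∀ {A B A′ B′} (a : A ≋ A′) (b : B ≋ B′) (f : Hom A B) → cast a b f ≈ f

    id  : ∀ {A} → Hom A A
    _∘_ : ∀ {A B C} → Hom B C → Hom A B → Hom A C
    id-≈ : ∀ {A A′} → A ≋ A′ → id {A} ≈ id {A′}
    ∘-≈  : ∀ {A B C A′ B′ C′} {g : Hom B C} {f : Hom A B} {g′ : Hom B′ C′} {f′ : Hom A′ B′} →
           g ≈ g′ → f ≈ f′ → g ∘ f ≈ g′ ∘ f′

    identityˡ : ∀ {A B} (f : Hom A B) → id ∘ f ≈ f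
    identityʳ : ∀ {A B} (f : Hom A B) → f ∘ id ≈ f
    assoc     : ∀ {A B C D} (h : Hom C D) (g : Hom B C) (f : Hom A B) → (h ∘ g) ∘ f ≈ h ∘ (g ∘ f)

record Functor (E B : Category) : Set where
  private
    module E = Category E
    module B = Category B
  field
    F₀   : E.Ob → B.Ob
    F₁   : ∀ {x y} → E.Hom x y → B.Hom (F₀ x) (F₀ y)
    F₀-≋ : ∀ {x y} → x E.≋ y → F₀ x B.≋ F₀ y
    F₁-≈ : ∀ {x y x′ y′} {f : E.Hom x y} {g : E.Hom x′ y′} → f E.≈ g → F₁ f B.≈ F₁ g
    F-id : ∀ {x} → F₁ (E.id {x}) B.≈ B.id {F₀ x}
    F-∘  : ∀ {x y z} (g : E.Hom y z) (f : E.Hom x y) → F₁ (g E.∘ f) B.≈ F₁ g B.∘ F₁ f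

module Fibrations {E B : Category} (P : Functor E B) where
  private
    module E = Category E
    module B = Category B
  open Functor P

  IsCartesian : ∀ {y z} → E.Hom y z → Set
  IsCartesian {y} {z} f = ∀ {x} (g : E.Hom x z) (k : B.Hom (F₀ x) (F₀ y)) → F₁ g B.≈ F₁ f B.∘ k →
    Σ[ k′ ∈ E.Hom x y ] (g E.≈ f E.∘ k′) × (F₁ k′ B.≈ k) ×
      (∀ (k″ : E.Hom x y) → g E.≈ f E.∘ k″ → F₁ k″ B.≈ k → k″ E.≈ k′)

  -- By lift-≈ the chosen liftings depend only on equality classes of objects and arrows.

  record ClovenFibration : Set where
    field
      pullback       : ∀ z {b} → B.Hom b (F₀ z) → E.Ob
      lift           : ∀ z {b} (f : B.Hom b (F₀ z)) → E.Hom (pullback z f) z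
      lift-over      : ∀ z {b} (f : B.Hom b (F₀ z)) → F₁ (lift z f) B.≈ f
      lift-cartesian : ∀ z {b} (f : B.Hom b (F₀ z)) → IsCartesian (lift z f)
      lift-≈         : ∀ {z z′ b b′} {f : B.Hom b (F₀ z)} {f′ : B.Hom b′ (F₀ z′)} →
                       z E.≋ z′ → f B.≈ f′ → lift z f E.≈ lift z′ f′

  record IsSplit (C : ClovenFibration) : Set where
    open ClovenFibration C
    field
      lift-id : ∀ z → lift z B.id E.≈ E.id {z}
      lift-∘  : ∀ z {a b} (f : B.Hom b (F₀ z)) (g : B.Hom a b) (g′ : B.Hom a (F₀ (pullback z f))) → g′ B.≈ g →
                lift z (f B.∘ g) E.≈ lift z f E.∘ lift (pullback z f) g′

-- Strict 2-categories, in the same style.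

record TwoCategory : Set₁ where
  field cells₁ : Category
  open Category cells₁ public
  infix  4 _⇒_ _≈₂_
  infixr 9 _•_ _▷_ _◁_
  field
    _⇒_  : ∀ {A B} → Hom A B → Hom A B → Set
    _≈₂_ : ∀ {A B A′ B′} {f g : Hom A B} {f′ g′ : Hom A′ B′} → f ⇒ g → f′ ⇒ g′ → Set

    ≈₂-refl  : ∀ {A B} {f g : Hom A B} {α : f ⇒ g} → α ≈₂ α
    ≈₂-sym   : ∀ {A B A′ B′} {f g : Hom A B} {f′ g′ : Hom A′ B′} {α : f ⇒ g} {β : f′ ⇒ g′} → α ≈₂ β → β ≈₂ α
    ≈₂-trans : ∀ {A B A′ B′ A″ B″} {f g : Hom A B} {f′ g′ : Hom A′ B′} {f″ g″ : Hom A″ B″}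
               {α : f ⇒ g} {β : f′ ⇒ g′} {γ : f″ ⇒ g″} → α ≈₂ β → β ≈₂ γ → α ≈₂ γ
    ≈₂-dom   : ∀ {A B A′ B′} {f g : Hom A B} {f′ g′ : Hom A′ B′} {α : f ⇒ g} {β : f′ ⇒ g′} → α ≈₂ β → f ≈ f′
    ≈₂-cod   : ∀ {A B A′ B′} {f g : Hom A B} {f′ g′ : Hom A′ B′} {α : f ⇒ g} {β : f′ ⇒ g′} → α ≈₂ β → g ≈ g′
    cast₂    : ∀ {A B A′ B′} {f g : Hom A B} {f′ g′ : Hom A′ B′} → f ≈ f′ → g ≈ g′ → f ⇒ g → f′ ⇒ g′
    cast₂-≈  : ∀ {A B A′ B′} {f g : Hom A B} {f′ g′ : Hom A′ B′} (a : f ≈ f′) (b : g ≈ g′) (α : f ⇒ g) →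
               cast₂ a b α ≈₂ α

    id₂ : ∀ {A B} {f : Hom A B} → f ⇒ f
    _•_ : ∀ {A B} {f g h : Hom A B} → g ⇒ h → f ⇒ g → f ⇒ h
    _▷_ : ∀ {A B C} (h : Hom B C) {f g : Hom A B} → f ⇒ g → h ∘ f ⇒ h ∘ g
    _◁_ : ∀ {A B C} {f g : Hom B C} → f ⇒ g → (k : Hom A B) → f ∘ k ⇒ g ∘ k

    id₂-≈ : ∀ {A B A′ B′} {f : Hom A B} {f′ : Hom A′ B′} → f ≈ f′ → id₂ {f = f} ≈₂ id₂ {f = f′}
    •-≈   : ∀ {A B A′ B′} {f g h : Hom A B} {f′ g′ h′ : Hom A′ B′}
            {β : g ⇒ h} {α : f ⇒ g} {β′ : g′ ⇒ h′} {α′ : f′ ⇒ g′} → β ≈₂ β′ → α ≈₂ α′ → β • α ≈₂ β′ • α′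
    ▷-≈   : ∀ {A B C A′ B′ C′} {h : Hom B C} {h′ : Hom B′ C′} {f g : Hom A B} {f′ g′ : Hom A′ B′}
            {α : f ⇒ g} {α′ : f′ ⇒ g′} → h ≈ h′ → α ≈₂ α′ → h ▷ α ≈₂ h′ ▷ α′
    ◁-≈   : ∀ {A B C A′ B′ C′} {f g : Hom B C} {f′ g′ : Hom B′ C′} {k : Hom A B} {k′ : Hom A′ B′}
            {α : f ⇒ g} {α′ : f′ ⇒ g′} → α ≈₂ α′ → k ≈ k′ → α ◁ k ≈₂ α′ ◁ k′

    •-identityˡ : ∀ {A B} {f g : Hom A B} (α : f ⇒ g) → id₂ • α ≈₂ α
    •-identityʳ : ∀ {A B} {f g : Hom A B} (α : f ⇒ g) → α • id₂ ≈₂ α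
    •-assoc     : ∀ {A B} {f g h k : Hom A B} (γ : h ⇒ k) (β : g ⇒ h) (α : f ⇒ g) → (γ • β) • α ≈₂ γ • (β • α)

    ▷-id₂ : ∀ {A B C} (h : Hom B C) (f : Hom A B) → h ▷ id₂ {f = f} ≈₂ id₂ {f = h ∘ f}
    ▷-•   : ∀ {A B C} (h : Hom B C) {f g k : Hom A B} (β : g ⇒ k) (α : f ⇒ g) → h ▷ (β • α) ≈₂ (h ▷ β) • (h ▷ α)
    ▷-id  : ∀ {A B} {f g : Hom A B} (α : f ⇒ g) → id ▷ α ≈₂ α
    ▷-∘   : ∀ {A B C D} (k : Hom C D) (h : Hom B C) {f g : Hom A B} (α : f ⇒ g) → (k ∘ h) ▷ α ≈₂ k ▷ (h ▷ α)

    ◁-id₂ : ∀ {A B C} (f : Hom B C) (k : Hom A B) → id₂ {f = f} ◁ k ≈₂ id₂ {f = f ∘ k}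
    ◁-•   : ∀ {A B C} {f g h : Hom B C} (β : g ⇒ h) (α : f ⇒ g) (k : Hom A B) → (β • α) ◁ k ≈₂ (β ◁ k) • (α ◁ k)
    ◁-id  : ∀ {A B} {f g : Hom A B} (α : f ⇒ g) → α ◁ id ≈₂ α
    ◁-∘   : ∀ {A B C D} {f g : Hom C D} (α : f ⇒ g) (h : Hom B C) (k : Hom A B) → α ◁ (h ∘ k) ≈₂ (α ◁ h) ◁ k

    ▷-◁         : ∀ {A B C D} (h : Hom C D) {f g : Hom B C} (α : f ⇒ g) (k : Hom A B) → (h ▷ α) ◁ k ≈₂ h ▷ (α ◁ k)
    interchange : ∀ {A B C} {h h′ : Hom B C} {f f′ : Hom A B} (β : h ⇒ h′) (α : f ⇒ f′) →
                  (β ◁ f′) • (h ▷ α) ≈₂ (h′ ▷ α) • (β ◁ f)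

  hom : Ob → Ob → Category
  hom A B = record
    { Ob = Hom A B ; _≋_ = λ f g → f ≈ g ; Hom = _⇒_ ; _≈_ = λ α β → α ≈₂ β
    ; ≋-refl = ≈-refl ; ≋-sym = ≈-sym ; ≋-trans = ≈-trans
    ; ≈-refl = ≈₂-refl ; ≈-sym = ≈₂-sym ; ≈-trans = ≈₂-trans ; ≈-dom = ≈₂-dom ; ≈-cod = ≈₂-cod
    ; cast = cast₂ ; cast-≈ = cast₂-≈
    ; id = id₂ ; _∘_ = _•_ ; id-≈ = id₂-≈ ; ∘-≈ = •-≈
    ; identityˡ = •-identityˡ ; identityʳ = •-identityʳ ; assoc = •-assoc }

record TwoFunctor (E B : TwoCategory) : Set where
  private
    module E = TwoCategory E
    module B = TwoCategory B
  field functor : Functor E.cells₁ B.cells₁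
  open Functor functor public
  field
    F₂    : ∀ {x y} {f g : E.Hom x y} → f E.⇒ g → F₁ f B.⇒ F₁ g
    F₂-≈  : ∀ {x y x′ y′} {f g : E.Hom x y} {f′ g′ : E.Hom x′ y′} {α : f E.⇒ g} {β : f′ E.⇒ g′} →
            α E.≈₂ β → F₂ α B.≈₂ F₂ β
    F-id₂ : ∀ {x y} {f : E.Hom x y} → F₂ (E.id₂ {f = f}) B.≈₂ B.id₂ {f = F₁ f}
    F-•   : ∀ {x y} {f g h : E.Hom x y} (β : g E.⇒ h) (α : f E.⇒ g) → F₂ (β E.• α) B.≈₂ F₂ β B.• F₂ α
    F-▷   : ∀ {x y z} (h : E.Hom y z) {f g : E.Hom x y} (α : f E.⇒ g) → F₂ (h E.▷ α) B.≈₂ F₁ h B.▷ F₂ α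
    F-◁   : ∀ {x y z} {f g : E.Hom y z} (α : f E.⇒ g) (k : E.Hom x y) → F₂ (α E.◁ k) B.≈₂ F₂ α B.◁ F₁ k

  homFunctor : ∀ x y → Functor (E.hom x y) (B.hom (F₀ x) (F₀ y))
  homFunctor x y = record { F₀ = F₁ ; F₁ = F₂ ; F₀-≋ = F₁-≈ ; F₁-≈ = F₂-≈ ; F-id = F-id₂ ; F-∘ = F-• }

record Cloven2Fibration {E B : TwoCategory} (p : TwoFunctor E B) : Set where
  private
    module E = TwoCategory E
    module B = TwoCategory B
  open TwoFunctor p
  open Fibrations
  field
    fibration : ClovenFibration functor
    factor₂   : ∀ {y z} (f : E.Hom y z) → IsCartesian functor f →
                ∀ {x} {g h : E.Hom x z} (α : g E.⇒ h) {k l : B.Hom (F₀ x) (F₀ y)} (γ : k B.⇒ l) →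
                F₂ α B.≈₂ F₁ f B.▷ γ →
                Σ[ k′ ∈ E.Hom x y ] Σ[ l′ ∈ E.Hom x y ] Σ[ γ′ ∈ k′ E.⇒ l′ ]
                  (α E.≈₂ f E.▷ γ′) × (F₂ γ′ B.≈₂ γ) ×
                  (∀ {k″ l″ : E.Hom x y} (γ″ : k″ E.⇒ l″) → α E.≈₂ f E.▷ γ″ → F₂ γ″ B.≈₂ γ → γ″ E.≈₂ γ′)
    homFibration  : ∀ x y → ClovenFibration (homFunctor x y)
    ◁-cartesian : ∀ {x y z} (f : E.Hom x y) {g h : E.Hom y z} (α : g E.⇒ h) →
                  IsCartesian (homFunctor y z) α → IsCartesian (homFunctor x z) (α E.◁ f)

record GloballySplit2Fibration {E B : TwoCategory} (p : TwoFunctor E B) : Set where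
  field cloven2Fibration : Cloven2Fibration p
  open Cloven2Fibration cloven2Fibration public
  open Fibrations.ClovenFibration fibration public
  field split : Fibrations.IsSplit (TwoFunctor.functor p) fibration

-- A category T over the 1-cells of a 2-category C by way of commutative squares, that is, a functor to
-- the underlying category of the arrow 2-category C^2, injective on parallel arrows.

record Squares (C : TwoCategory) : Set₁ where
  private module C = TwoCategory C
  field
    T         : Category
    top bot   : Functor T C.cells₁
  module T = Category T
  open Functor top public using () renaming (F₀ to top₀; F₁ to top₁)
  open Functor bot public using () renaming (F₀ to bot₀; F₁ to bot₁)
  field
    π         : ∀ X → C.Hom (top₀ X) (bot₀ X)
    π-≈       : ∀ {X Y} → X T.≋ Y → π X C.≈ π Y
    π-natural : ∀ {X Y} (f : T.Hom X Y) → π Y C.∘ top₁ f C.≈ bot₁ f C.∘ π X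
    reflect-≈ : ∀ {X Y X′ Y′} {f : T.Hom X Y} {g : T.Hom X′ Y′} →
                top₁ f C.≈ top₁ g → bot₁ f C.≈ bot₁ g → f T.≈ g

-- The 2-category with underlying category T and the 2-cells of C^2, and its projection to C.

module SquareTransformations {C : TwoCategory} (Q : Squares C) where
  private module C = TwoCategory C
  open Squares Q
  private
    module Top = Functor top
    module Bot = Functor bot

  infix 4 _⇒_ _≈₂_
  infixr 9 _•_ _▷_ _◁_
  infixr 3 _⟫_

  record _⇒_ {X Y} (f g : T.Hom X Y) : Set where
    constructor square
    field
      top₂    : top₁ f C.⇒ top₁ g
      bot₂    : bot₁ f C.⇒ bot₁ g
      commute : (π Y C.▷ top₂) C.≈₂ (bot₂ C.◁ π X)
  open _⇒_ public

  record _≈₂_ {X Y X′ Y′} {f g : T.Hom X Y} {f′ g′ : T.Hom X′ Y′} (α : f ⇒ g) (β : f′ ⇒ g′) : Set where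
    constructor equal
    field
      top₂-≈ : top₂ α C.≈₂ top₂ β
      bot₂-≈ : bot₂ α C.≈₂ bot₂ β
  open _≈₂_ public

  private
    _⟫_ : ∀ {A B A′ B′ A″ B″} {f g : C.Hom A B} {f′ g′ : C.Hom A′ B′} {f″ g″ : C.Hom A″ B″}
          {α : f C.⇒ g} {β : f′ C.⇒ g′} {γ : f″ C.⇒ g″} → α C.≈₂ β → β C.≈₂ γ → α C.≈₂ γ
    _⟫_ = C.≈₂-trans

  cast₂ : ∀ {X Y X′ Y′} {f g : T.Hom X Y} {f′ g′ : T.Hom X′ Y′} → f T.≈ f′ → g T.≈ g′ → f ⇒ g → f′ ⇒ g′
  cast₂ a b α = square (C.cast₂ (Top.F₁-≈ a) (Top.F₁-≈ b) (top₂ α)) (C.cast₂ (Bot.F₁-≈ a) (Bot.F₁-≈ b) (bot₂ α))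
    (C.▷-≈ (C.≈-sym (π-≈ (T.≈-cod a))) (C.cast₂-≈ _ _ (top₂ α)) ⟫ commute α ⟫
      C.≈₂-sym (C.◁-≈ (C.cast₂-≈ _ _ (bot₂ α)) (C.≈-sym (π-≈ (T.≈-dom a)))))

  id₂ : ∀ {X Y} {f : T.Hom X Y} → f ⇒ f
  id₂ {X} {Y} {f} = square C.id₂ C.id₂
    (C.▷-id₂ (π Y) (top₁ f) ⟫ C.id₂-≈ (π-natural f) ⟫ C.≈₂-sym (C.◁-id₂ (bot₁ f) (π X)))

  _•_ : ∀ {X Y} {f g h : T.Hom X Y} → g ⇒ h → f ⇒ g → f ⇒ h
  _•_ {X} {Y} β α = square (top₂ β C.• top₂ α) (bot₂ β C.• bot₂ α)
    (C.▷-• (π Y) (top₂ β) (top₂ α) ⟫ C.•-≈ (commute β) (commute α) ⟫ C.≈₂-sym (C.◁-• (bot₂ β) (bot₂ α) (π X)))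

  -- top₁ and bot₁ preserve composition only up to equality of 1-cells, so whiskerings are cast.

  _▷_ : ∀ {X Y Z} (h : T.Hom Y Z) {f g : T.Hom X Y} → f ⇒ g → h T.∘ f ⇒ h T.∘ g
  _▷_ {X} {Y} {Z} h {f} {g} α = square
    (C.cast₂ (C.≈-sym (Top.F-∘ h f)) (C.≈-sym (Top.F-∘ h g)) (top₁ h C.▷ top₂ α))
    (C.cast₂ (C.≈-sym (Bot.F-∘ h f)) (C.≈-sym (Bot.F-∘ h g)) (bot₁ h C.▷ bot₂ α))
    (C.▷-≈ C.≈-refl (C.cast₂-≈ _ _ _) ⟫ C.≈₂-sym (C.▷-∘ (π Z) (top₁ h) (top₂ α)) ⟫
     C.▷-≈ (π-natural h) C.≈₂-refl ⟫ C.▷-∘ (bot₁ h) (π Y) (top₂ α) ⟫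
     C.▷-≈ C.≈-refl (commute α) ⟫ C.≈₂-sym (C.▷-◁ (bot₁ h) (bot₂ α) (π X)) ⟫
     C.≈₂-sym (C.◁-≈ (C.cast₂-≈ _ _ _) C.≈-refl))

  _◁_ : ∀ {X Y Z} {f g : T.Hom Y Z} → f ⇒ g → (k : T.Hom X Y) → f T.∘ k ⇒ g T.∘ k
  _◁_ {X} {Y} {Z} {f} {g} α k = square
    (C.cast₂ (C.≈-sym (Top.F-∘ f k)) (C.≈-sym (Top.F-∘ g k)) (top₂ α C.◁ top₁ k))
    (C.cast₂ (C.≈-sym (Bot.F-∘ f k)) (C.≈-sym (Bot.F-∘ g k)) (bot₂ α C.◁ bot₁ k))
    (C.▷-≈ C.≈-refl (C.cast₂-≈ _ _ _) ⟫ C.≈₂-sym (C.▷-◁ (π Z) (top₂ α) (top₁ k)) ⟫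
     C.◁-≈ (commute α) C.≈-refl ⟫ C.≈₂-sym (C.◁-∘ (bot₂ α) (π Y) (top₁ k)) ⟫
     C.◁-≈ C.≈₂-refl (π-natural k) ⟫ C.◁-∘ (bot₂ α) (bot₁ k) (π X) ⟫
     C.≈₂-sym (C.◁-≈ (C.cast₂-≈ _ _ _) C.≈-refl))

  top-▷ : ∀ {X Y Z} (h : T.Hom Y Z) {f g : T.Hom X Y} (α : f ⇒ g) → top₂ (h ▷ α) C.≈₂ top₁ h C.▷ top₂ α
  top-▷ h α = C.cast₂-≈ _ _ _

  bot-▷ : ∀ {X Y Z} (h : T.Hom Y Z) {f g : T.Hom X Y} (α : f ⇒ g) → bot₂ (h ▷ α) C.≈₂ bot₁ h C.▷ bot₂ α
  bot-▷ h α = C.cast₂-≈ _ _ _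

  top-◁ : ∀ {X Y Z} {f g : T.Hom Y Z} (α : f ⇒ g) (k : T.Hom X Y) → top₂ (α ◁ k) C.≈₂ top₂ α C.◁ top₁ k
  top-◁ α k = C.cast₂-≈ _ _ _

  bot-◁ : ∀ {X Y Z} {f g : T.Hom Y Z} (α : f ⇒ g) (k : T.Hom X Y) → bot₂ (α ◁ k) C.≈₂ bot₂ α C.◁ bot₁ k
  bot-◁ α k = C.cast₂-≈ _ _ _

  twoCategory : TwoCategory
  twoCategory = record
    { cells₁ = T ; _⇒_ = _⇒_ ; _≈₂_ = _≈₂_
    ; ≈₂-refl = equal C.≈₂-refl C.≈₂-refl
    ; ≈₂-sym = λ e → equal (C.≈₂-sym (top₂-≈ e)) (C.≈₂-sym (bot₂-≈ e))
    ; ≈₂-trans = λ e e′ → equal (top₂-≈ e ⟫ top₂-≈ e′) (bot₂-≈ e ⟫ bot₂-≈ e′)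
    ; ≈₂-dom = λ e → reflect-≈ (C.≈₂-dom (top₂-≈ e)) (C.≈₂-dom (bot₂-≈ e))
    ; ≈₂-cod = λ e → reflect-≈ (C.≈₂-cod (top₂-≈ e)) (C.≈₂-cod (bot₂-≈ e))
    ; cast₂ = cast₂ ; cast₂-≈ = λ a b α → equal (C.cast₂-≈ _ _ (top₂ α)) (C.cast₂-≈ _ _ (bot₂ α))
    ; id₂ = id₂ ; _•_ = _•_ ; _▷_ = _▷_ ; _◁_ = _◁_
    ; id₂-≈ = λ e → equal (C.id₂-≈ (Top.F₁-≈ e)) (C.id₂-≈ (Bot.F₁-≈ e))
    ; •-≈ = λ e e′ → equal (C.•-≈ (top₂-≈ e) (top₂-≈ e′)) (C.•-≈ (bot₂-≈ e) (bot₂-≈ e′))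
    ; ▷-≈ = λ {_} {_} {_} {_} {_} {_} {h} {h′} {_} {_} {_} {_} {α} {α′} e e′ → equal
        (top-▷ h α ⟫ C.▷-≈ (Top.F₁-≈ e) (top₂-≈ e′) ⟫ C.≈₂-sym (top-▷ h′ α′))
        (bot-▷ h α ⟫ C.▷-≈ (Bot.F₁-≈ e) (bot₂-≈ e′) ⟫ C.≈₂-sym (bot-▷ h′ α′))
    ; ◁-≈ = λ {_} {_} {_} {_} {_} {_} {_} {_} {_} {_} {k} {k′} {α} {α′} e e′ → equal
        (top-◁ α k ⟫ C.◁-≈ (top₂-≈ e) (Top.F₁-≈ e′) ⟫ C.≈₂-sym (top-◁ α′ k′))
        (bot-◁ α k ⟫ C.◁-≈ (bot₂-≈ e) (Bot.F₁-≈ e′) ⟫ C.≈₂-sym (bot-◁ α′ k′))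
    ; •-identityˡ = λ α → equal (C.•-identityˡ (top₂ α)) (C.•-identityˡ (bot₂ α))
    ; •-identityʳ = λ α → equal (C.•-identityʳ (top₂ α)) (C.•-identityʳ (bot₂ α))
    ; •-assoc = λ γ β α → equal (C.•-assoc (top₂ γ) (top₂ β) (top₂ α)) (C.•-assoc (bot₂ γ) (bot₂ β) (bot₂ α))
    ; ▷-id₂ = λ h f → equal
        (top-▷ h id₂ ⟫ C.▷-id₂ (top₁ h) (top₁ f) ⟫ C.id₂-≈ (C.≈-sym (Top.F-∘ h f)))
        (bot-▷ h id₂ ⟫ C.▷-id₂ (bot₁ h) (bot₁ f) ⟫ C.id₂-≈ (C.≈-sym (Bot.F-∘ h f)))
    ; ▷-• = λ h β α → equal
        (top-▷ h (β • α) ⟫ C.▷-• (top₁ h) (top₂ β) (top₂ α) ⟫ C.≈₂-sym (C.•-≈ (top-▷ h β) (top-▷ h α)))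
        (bot-▷ h (β • α) ⟫ C.▷-• (bot₁ h) (bot₂ β) (bot₂ α) ⟫ C.≈₂-sym (C.•-≈ (bot-▷ h β) (bot-▷ h α)))
    ; ▷-id = λ α → equal
        (top-▷ T.id α ⟫ C.▷-≈ Top.F-id C.≈₂-refl ⟫ C.▷-id (top₂ α))
        (bot-▷ T.id α ⟫ C.▷-≈ Bot.F-id C.≈₂-refl ⟫ C.▷-id (bot₂ α))
    ; ▷-∘ = λ k h α → equal
        (top-▷ (k T.∘ h) α ⟫ C.▷-≈ (Top.F-∘ k h) C.≈₂-refl ⟫ C.▷-∘ (top₁ k) (top₁ h) (top₂ α) ⟫
          C.≈₂-sym (top-▷ k (h ▷ α) ⟫ C.▷-≈ C.≈-refl (top-▷ h α)))
        (bot-▷ (k T.∘ h) α ⟫ C.▷-≈ (Bot.F-∘ k h) C.≈₂-refl ⟫ C.▷-∘ (bot₁ k) (bot₁ h) (bot₂ α) ⟫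
          C.≈₂-sym (bot-▷ k (h ▷ α) ⟫ C.▷-≈ C.≈-refl (bot-▷ h α)))
    ; ◁-id₂ = λ f k → equal
        (top-◁ id₂ k ⟫ C.◁-id₂ (top₁ f) (top₁ k) ⟫ C.id₂-≈ (C.≈-sym (Top.F-∘ f k)))
        (bot-◁ id₂ k ⟫ C.◁-id₂ (bot₁ f) (bot₁ k) ⟫ C.id₂-≈ (C.≈-sym (Bot.F-∘ f k)))
    ; ◁-• = λ β α k → equal
        (top-◁ (β • α) k ⟫ C.◁-• (top₂ β) (top₂ α) (top₁ k) ⟫ C.≈₂-sym (C.•-≈ (top-◁ β k) (top-◁ α k)))
        (bot-◁ (β • α) k ⟫ C.◁-• (bot₂ β) (bot₂ α) (bot₁ k) ⟫ C.≈₂-sym (C.•-≈ (bot-◁ β k) (bot-◁ α k)))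
    ; ◁-id = λ α → equal
        (top-◁ α T.id ⟫ C.◁-≈ C.≈₂-refl Top.F-id ⟫ C.◁-id (top₂ α))
        (bot-◁ α T.id ⟫ C.◁-≈ C.≈₂-refl Bot.F-id ⟫ C.◁-id (bot₂ α))
    ; ◁-∘ = λ α h k → equal
        (top-◁ α (h T.∘ k) ⟫ C.◁-≈ C.≈₂-refl (Top.F-∘ h k) ⟫ C.◁-∘ (top₂ α) (top₁ h) (top₁ k) ⟫
          C.≈₂-sym (top-◁ (α ◁ h) k ⟫ C.◁-≈ (top-◁ α h) C.≈-refl))
        (bot-◁ α (h T.∘ k) ⟫ C.◁-≈ C.≈₂-refl (Bot.F-∘ h k) ⟫ C.◁-∘ (bot₂ α) (bot₁ h) (bot₁ k) ⟫
          C.≈₂-sym (bot-◁ (α ◁ h) k ⟫ C.◁-≈ (bot-◁ α h) C.≈-refl))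
    ; ▷-◁ = λ h α k → equal
        (top-◁ (h ▷ α) k ⟫ C.◁-≈ (top-▷ h α) C.≈-refl ⟫ C.▷-◁ (top₁ h) (top₂ α) (top₁ k) ⟫
          C.≈₂-sym (top-▷ h (α ◁ k) ⟫ C.▷-≈ C.≈-refl (top-◁ α k)))
        (bot-◁ (h ▷ α) k ⟫ C.◁-≈ (bot-▷ h α) C.≈-refl ⟫ C.▷-◁ (bot₁ h) (bot₂ α) (bot₁ k) ⟫
          C.≈₂-sym (bot-▷ h (α ◁ k) ⟫ C.▷-≈ C.≈-refl (bot-◁ α k)))
    ; interchange = λ {_} {_} {_} {h} {h′} {f} {f′} β α → equal
        (C.•-≈ (top-◁ β f′) (top-▷ h α) ⟫ C.interchange (top₂ β) (top₂ α) ⟫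
          C.≈₂-sym (C.•-≈ (top-▷ h′ α) (top-◁ β f)))
        (C.•-≈ (bot-◁ β f′) (bot-▷ h α) ⟫ C.interchange (bot₂ β) (bot₂ α) ⟫
          C.≈₂-sym (C.•-≈ (bot-▷ h′ α) (bot-◁ β f))) }

  projection : TwoFunctor twoCategory C
  projection = record
    { functor = bot ; F₂ = bot₂ ; F₂-≈ = bot₂-≈ ; F-id₂ = C.≈₂-refl ; F-• = λ β α → C.≈₂-refl
    ; F-▷ = bot-▷ ; F-◁ = bot-◁ }

module ContextTwoCategory (S : TypeTheory) where
  open TypeTheory S
  open Congruence S

  record Context : Set where
    constructor context
    field
      {length} : ℕ
      ctx      : Ctx length
      ctx-ok   : ⊢ ctx
  open Context public

  record Morphism (Γ Δ : Context) : Set where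
    constructor morphism
    field
      terms    : Sub (length Γ) (length Δ)
      terms-ok : ctx Γ ⊢ terms ⇛ ctx Δ
  open Morphism public

  record Transformation {Γ Δ : Context} (f g : Morphism Γ Δ) : Set where
    constructor transformation
    field
      paths    : Sub (length Γ) (length Δ)
      paths-ok : ctx Γ ⊢ IdCtx (ctx Δ) (terms f) (terms g) ∋ paths
  open Transformation public

  data _≋ᶜ_ : Context → Context → Set where
    equal : ∀ {n} {Γ Γ′ : Ctx n} {w w′} → ⊢ Γ ≐ Γ′ → context Γ w ≋ᶜ context Γ′ w′

  Terms-≐ : ∀ {Γ Δ Γ′ Δ′} → Γ ≋ᶜ Γ′ → Δ ≋ᶜ Δ′ →
            Sub (length Γ) (length Δ) → Sub (length Γ′) (length Δ′) → Set
  Terms-≐ (equal {Γ = Γ} _) (equal {Γ = Δ} _) σ σ′ = Γ ⊢ σ ≐ σ′ ⇛ Δ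

  Paths-≐ : ∀ {Γ Δ Γ′ Δ′} → Γ ≋ᶜ Γ′ → Δ ≋ᶜ Δ′ → (σ τ : Sub (length Γ) (length Δ)) →
            Sub (length Γ) (length Δ) → Sub (length Γ′) (length Δ′) → Set
  Paths-≐ (equal {Γ = Γ} _) (equal {Γ = Δ} _) σ τ p p′ = Γ ⊢ IdCtx Δ σ τ ∋ p ≐ p′

  record _≈ᵐ_ {Γ Δ Γ′ Δ′} (f : Morphism Γ Δ) (f′ : Morphism Γ′ Δ′) : Set where
    constructor equal
    field
      dom-≋   : Γ ≋ᶜ Γ′
      cod-≋   : Δ ≋ᶜ Δ′
      terms-≐ : Terms-≐ dom-≋ cod-≋ (terms f) (terms f′)

  record _≈ᵗ_ {Γ Δ Γ′ Δ′} {f g : Morphism Γ Δ} {f′ g′ : Morphism Γ′ Δ′}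
              (α : Transformation f g) (α′ : Transformation f′ g′) : Set where
    constructor equal
    field
      dom-≋   : Γ ≋ᶜ Γ′
      cod-≋   : Δ ≋ᶜ Δ′
      src-≐   : Terms-≐ dom-≋ cod-≋ (terms f) (terms f′)
      tgt-≐   : Terms-≐ dom-≋ cod-≋ (terms g) (terms g′)
      paths-≐ : Paths-≐ dom-≋ cod-≋ (terms f) (terms g) (paths α) (paths α′)

  ≋ᶜ-refl : ∀ {Γ} → Γ ≋ᶜ Γ
  ≋ᶜ-refl {context Γ w} = equal (ctx-refl w)

  ≋ᶜ-sym : ∀ {Γ Δ} → Γ ≋ᶜ Δ → Δ ≋ᶜ Γ
  ≋ᶜ-sym (equal c) = equal (ctx-sym c)

  ≋ᶜ-trans : ∀ {Γ Δ Ξ} → Γ ≋ᶜ Δ → Δ ≋ᶜ Ξ → Γ ≋ᶜ Ξ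
  ≋ᶜ-trans (equal c) (equal d) = equal (ctx-trans c d)

  ≈ᵐ-refl : ∀ {Γ Δ} {f : Morphism Γ Δ} → f ≈ᵐ f
  ≈ᵐ-refl {context Γ w} {context Δ v} {morphism σ s} = equal (equal (ctx-refl w)) (equal (ctx-refl v)) (⇛-refl s)

  ≈ᵐ-sym : ∀ {Γ Δ Γ′ Δ′} {f : Morphism Γ Δ} {g : Morphism Γ′ Δ′} → f ≈ᵐ g → g ≈ᵐ f
  ≈ᵐ-sym (equal (equal c) (equal d) e) = equal (equal (ctx-sym c)) (equal (ctx-sym d)) (⇛-sym (ctx-⇛-≐ (≐-converts c) (≐-converts d) e))

  ≈ᵐ-trans : ∀ {Γ Δ Γ′ Δ′ Γ″ Δ″} {f : Morphism Γ Δ} {g : Morphism Γ′ Δ′} {h : Morphism Γ″ Δ″} →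
             f ≈ᵐ g → g ≈ᵐ h → f ≈ᵐ h
  ≈ᵐ-trans (equal (equal c) (equal d) e) (equal (equal c′) (equal d′) e′) = equal (equal (ctx-trans c c′)) (equal (ctx-trans d d′))
    (⇛-trans e (ctx-⇛-≐ (sym-converts (≐-converts c)) (sym-converts (≐-converts d)) e′))

  castᵐ : ∀ {Γ Δ Γ′ Δ′} → Γ ≋ᶜ Γ′ → Δ ≋ᶜ Δ′ → Morphism Γ Δ → Morphism Γ′ Δ′
  castᵐ (equal c) (equal d) (morphism σ s) = morphism σ (ctx-⇛ (≐-converts c) (≐-converts d) s)

  idᵐ : ∀ {Γ} → Morphism Γ Γ
  idᵐ {context Γ w} = morphism idₛ (id⇛ w)

  _∘ᵐ_ : ∀ {Γ Δ Ξ} → Morphism Δ Ξ → Morphism Γ Δ → Morphism Γ Ξ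
  morphism σ s ∘ᵐ morphism τ t = morphism (σ ⊚ τ) (⇛-comp s t)

  ≡⇒≈ᵐ : ∀ {Γ Δ} {f g : Morphism Γ Δ} → terms f ≡ terms g → f ≈ᵐ g
  ≡⇒≈ᵐ {context Γ w} {context Δ v} {morphism σ s} {morphism τ t} e = equal (equal (ctx-refl w)) (equal (ctx-refl v)) (≡⇒≐ e s)

  contexts : Category
  contexts = record
    { Ob = Context ; _≋_ = _≋ᶜ_ ; Hom = Morphism ; _≈_ = _≈ᵐ_
    ; ≋-refl = ≋ᶜ-refl ; ≋-sym = ≋ᶜ-sym ; ≋-trans = ≋ᶜ-trans
    ; ≈-refl = ≈ᵐ-refl ; ≈-sym = ≈ᵐ-sym ; ≈-trans = ≈ᵐ-trans
    ; ≈-dom = _≈ᵐ_.dom-≋ ; ≈-cod = _≈ᵐ_.cod-≋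
    ; cast = castᵐ
    ; cast-≈ = λ { (equal c) (equal d) (morphism σ s) → equal (equal (ctx-sym c)) (equal (ctx-sym d))
        (⇛-refl (ctx-⇛ (≐-converts c) (≐-converts d) s)) }
    ; id = idᵐ ; _∘_ = _∘ᵐ_
    ; id-≈ = λ { {context Γ w} (equal c) → equal (equal c) (equal c) (⇛-refl (id⇛ w)) }
    ; ∘-≈ = λ { (equal (equal _) (equal d) e) (equal (equal c′) (equal _) e′) → equal (equal c′) (equal d) (⇛-comp-≐ e e′) }
    ; identityˡ = λ f → ≡⇒≈ᵐ (id-⊚ (terms f)) ; identityʳ = λ f → ≡⇒≈ᵐ (⊚-id (terms f))
    ; assoc = λ h g f → ≡⇒≈ᵐ (⊚-assoc (terms h) (terms g) (terms f)) }

  zipᵗ : ∀ {Γ Δ} {f g : Morphism Γ Δ} (α : Transformation f g) →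
         ctx Γ ⊢ zip (terms f) (terms g) (paths α) ⇛ Path (ctx Δ)
  zipᵗ {f = f} {g} α = ∋⇒zip (terms-ok f) (terms-ok g) (paths-ok α)

  fromZip : ∀ {Γ Δ} (f g : Morphism Γ Δ) {p} → ctx Γ ⊢ zip (terms f) (terms g) p ⇛ Path (ctx Δ) → Transformation f g
  fromZip f g {p} u = transformation p (zip⇒∋ (terms-ok f) (terms-ok g) u)

  from-zip : ∀ {m n} {Γ Γ′ : Ctx m} {Δ Δ′ : Ctx n} {w w′ v v′}
             {f g : Morphism (context Γ w) (context Δ v)} {f′ g′ : Morphism (context Γ′ w′) (context Δ′ v′)}
             {α : Transformation f g} {α′ : Transformation f′ g′} → ⊢ Γ ≐ Γ′ → ⊢ Δ ≐ Δ′ →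
             Γ ⊢ zip (terms f) (terms g) (paths α) ≐ zip (terms f′) (terms g′) (paths α′) ⇛ Path Δ → α ≈ᵗ α′
  from-zip {v = v} {f = f} {g} c d e = equal (equal c) (equal d) es et
    (zip⇒∋-≐ (terms-ok f) (terms-ok g) (⇛-trans e (zip-≐ v (⇛-right e) (⇛-sym es) (⇛-sym et))))
    where
    es = zip-src-≐ v e
    et = zip-tgt-≐ v e

  to-zip : ∀ {m n} {Γ : Ctx m} {Δ : Ctx n} {σ σ′ τ τ′ p p′} → Γ ⊢ σ ≐ σ′ ⇛ Δ → Γ ⊢ τ ≐ τ′ ⇛ Δ →
           Γ ⊢ IdCtx Δ σ τ ∋ p ≐ p′ → Γ ⊢ zip σ τ p ≐ zip σ′ τ′ p′ ⇛ Path Δ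
  to-zip es et e = ⇛-trans z (zip-≐ (cod (⇛-left es)) (⇛-right z) es et)
    where z = ∋⇒zip-≐ (⇛-left es) (⇛-left et) e

  zip⇒≈ᵗ : ∀ {Γ Δ} {f g f′ g′ : Morphism Γ Δ} {α : Transformation f g} {β : Transformation f′ g′} →
           ctx Γ ⊢ zip (terms f) (terms g) (paths α) ≐ zip (terms f′) (terms g′) (paths β) ⇛ Path (ctx Δ) → α ≈ᵗ β
  zip⇒≈ᵗ {context Γ w} {context Δ v} e = from-zip (ctx-refl w) (ctx-refl v) e

  ≡⇒≈ᵗ : ∀ {Γ Δ} {f g f′ g′ : Morphism Γ Δ} {α : Transformation f g} {β : Transformation f′ g′} →
         terms f ≡ terms f′ → terms g ≡ terms g′ → paths α ≡ paths β → α ≈ᵗ β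
  ≡⇒≈ᵗ {f = f} {g} {α = α} a b c = zip⇒≈ᵗ (≡⇒≐ (zip≡ a b c) (zipᵗ α))

  idᵗ : ∀ {Γ Δ} {f : Morphism Γ Δ} → Transformation f f
  idᵗ {Δ = Δ} {f} = fromZip f f {rs (ctx Δ) (terms f)} (rs⇛ (terms-ok f))

  _•ᵗ_ : ∀ {Γ Δ} {f g h : Morphism Γ Δ} → Transformation g h → Transformation f g → Transformation f h
  _•ᵗ_ {Δ = Δ} {f} {g} {h} β α =
    fromZip f h {compose-at (ctx Δ) (terms f) (terms g) (terms h) (paths α) (paths β)}
      (Compose.compose-at⇛ (ctx-ok Δ) (zipᵗ α) (zipᵗ β))

  _▷ᵗ_ : ∀ {Γ Δ Ξ} (h : Morphism Δ Ξ) {f g : Morphism Γ Δ} → Transformation f g → Transformation (h ∘ᵐ f) (h ∘ᵐ g)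
  _▷ᵗ_ {Γ} {Δ} {Ξ} h {f} {g} α =
    fromZip (h ∘ᵐ f) (h ∘ᵐ g) {ap (ctx Δ) (ctx Ξ) (terms h) ⊚ zip (terms f) (terms g) (paths α)}
      (ApCompose.A⇛ (terms-ok h) (zipᵗ α))

  _◁ᵗ_ : ∀ {Γ Δ Ξ} {f g : Morphism Δ Ξ} → Transformation f g → (k : Morphism Γ Δ) → Transformation (f ∘ᵐ k) (g ∘ᵐ k)
  _◁ᵗ_ {f = f} {g} α k = fromZip (f ∘ᵐ k) (g ∘ᵐ k) {paths α ⊚ terms k}
    (⇛≡ (zip-⊚ (terms f) (terms g) (paths α) (terms k)) (⇛-comp (zipᵗ α) (terms-ok k)))

  ≈ᵗ-refl : ∀ {Γ Δ} {f g : Morphism Γ Δ} {α : Transformation f g} → α ≈ᵗ α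
  ≈ᵗ-refl = ≡⇒≈ᵗ refl refl refl

  ≈ᵗ-sym : ∀ {Γ Δ Γ′ Δ′} {f g : Morphism Γ Δ} {f′ g′ : Morphism Γ′ Δ′} {α : Transformation f g} {β : Transformation f′ g′} →
           α ≈ᵗ β → β ≈ᵗ α
  ≈ᵗ-sym (equal (equal c) (equal d) e₁ e₂ e) = from-zip (ctx-sym c) (ctx-sym d)
    (⇛-sym (ctx-⇛-≐ (≐-converts c) (Path-converts d) (to-zip e₁ e₂ e)))

  ≈ᵗ-trans : ∀ {Γ Δ Γ′ Δ′ Γ″ Δ″} {f g : Morphism Γ Δ} {f′ g′ : Morphism Γ′ Δ′} {f″ g″ : Morphism Γ″ Δ″}
             {α : Transformation f g} {β : Transformation f′ g′} {γ : Transformation f″ g″} → α ≈ᵗ β → β ≈ᵗ γ → α ≈ᵗ γ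
  ≈ᵗ-trans (equal (equal c) (equal d) e₁ e₂ e) (equal (equal c′) (equal d′) e₁′ e₂′ e′) = from-zip (ctx-trans c c′) (ctx-trans d d′)
    (⇛-trans (to-zip e₁ e₂ e) (ctx-⇛-≐ (sym-converts (≐-converts c)) (sym-converts (Path-converts d)) (to-zip e₁′ e₂′ e′)))

  castᵗ : ∀ {Γ Δ Γ′ Δ′} {f g : Morphism Γ Δ} {f′ g′ : Morphism Γ′ Δ′} → f ≈ᵐ f′ → g ≈ᵐ g′ →
          Transformation f g → Transformation f′ g′
  castᵗ {f′ = f′} {g′} (equal (equal c) (equal d) e) (equal (equal _) (equal _) e′) α = fromZip f′ g′ {paths α}
    (ctx-⇛ (≐-converts c) (Path-converts d) (⇛-right (zip-≐ (cod (⇛-left e)) (zipᵗ α) e e′)))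

  castᵗ-≈ : ∀ {Γ Δ Γ′ Δ′} {f g : Morphism Γ Δ} {f′ g′ : Morphism Γ′ Δ′} (a : f ≈ᵐ f′) (b : g ≈ᵐ g′)
            (α : Transformation f g) → castᵗ a b α ≈ᵗ α
  castᵗ-≈ (equal (equal c) (equal d) e) (equal (equal _) (equal _) e′) α = from-zip (ctx-sym c) (ctx-sym d)
    (⇛-sym (ctx-⇛-≐ (≐-converts c) (Path-converts d) (zip-≐ (cod (⇛-left e)) (zipᵗ α) e e′)))

  id-≈ᵗ : ∀ {Γ Δ Γ′ Δ′} {f : Morphism Γ Δ} {f′ : Morphism Γ′ Δ′} → f ≈ᵐ f′ → idᵗ {f = f} ≈ᵗ idᵗ {f = f′}
  id-≈ᵗ (equal (equal c) (equal d) e) = from-zip c d (⇛-trans (rs-≐ e) (CtxCong.rs-cong (ctxCong d) (⇛-right e)))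

  •-≈ᵗ : ∀ {Γ Δ Γ′ Δ′} {f g h : Morphism Γ Δ} {f′ g′ h′ : Morphism Γ′ Δ′}
         {β : Transformation g h} {α : Transformation f g} {β′ : Transformation g′ h′} {α′ : Transformation f′ g′} →
         β ≈ᵗ β′ → α ≈ᵗ α′ → (β •ᵗ α) ≈ᵗ (β′ •ᵗ α′)
  •-≈ᵗ (equal (equal c) (equal d) e₁ e₂ e) (equal (equal _) (equal _) e₁′ e₂′ e′) = from-zip c d
    (⇛-trans (Compose.compose-at-≐ (cod (⇛-left e₁)) α≐ β≐) (compose-ctx d (⇛-right α≐) (⇛-right β≐)))
    where
    α≐ = to-zip e₁′ e₂′ e′
    β≐ = to-zip e₁ e₂ e

  ▷-≈ᵗ : ∀ {Γ Δ Ξ Γ′ Δ′ Ξ′} {h : Morphism Δ Ξ} {h′ : Morphism Δ′ Ξ′} {f g : Morphism Γ Δ} {f′ g′ : Morphism Γ′ Δ′}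
         {α : Transformation f g} {α′ : Transformation f′ g′} → h ≈ᵐ h′ → α ≈ᵗ α′ → (h ▷ᵗ α) ≈ᵗ (h′ ▷ᵗ α′)
  ▷-≈ᵗ (equal (equal {Γ = Γ} {Γ′} c) (equal {Γ = Δ} {Δ′} d) eh) (equal (equal c′) (equal _) e₁ e₂ e) = from-zip c′ d
    (⇛≐≡ (Apᵖ-zip Γ Δ _ _ _ _) (Apᵖ-zip Γ′ Δ′ _ _ _ _)
      (⇛-comp-≐ (⇛-trans (ap-≐ (dom (⇛-left eh)) eh) (ap-ctx c d (⇛-right eh))) (to-zip e₁ e₂ e)))

  ◁-≈ᵗ : ∀ {Γ Δ Ξ Γ′ Δ′ Ξ′} {f g : Morphism Δ Ξ} {f′ g′ : Morphism Δ′ Ξ′} {k : Morphism Γ Δ} {k′ : Morphism Γ′ Δ′}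
         {α : Transformation f g} {α′ : Transformation f′ g′} → α ≈ᵗ α′ → k ≈ᵐ k′ → (α ◁ᵗ k) ≈ᵗ (α′ ◁ᵗ k′)
  ◁-≈ᵗ (equal (equal _) (equal d) e₁ e₂ e) (equal (equal c′) (equal _) ek) = from-zip c′ d
    (⇛≐≡ (zip-⊚ _ _ _ _) (zip-⊚ _ _ _ _) (⇛-comp-≐ (to-zip e₁ e₂ e) ek))

  ℭ : TwoCategory
  ℭ = record
    { cells₁ = contexts ; _⇒_ = Transformation ; _≈₂_ = _≈ᵗ_
    ; ≈₂-refl = ≈ᵗ-refl ; ≈₂-sym = ≈ᵗ-sym ; ≈₂-trans = ≈ᵗ-trans
    ; ≈₂-dom = λ e → equal (_≈ᵗ_.dom-≋ e) (_≈ᵗ_.cod-≋ e) (_≈ᵗ_.src-≐ e)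
    ; ≈₂-cod = λ e → equal (_≈ᵗ_.dom-≋ e) (_≈ᵗ_.cod-≋ e) (_≈ᵗ_.tgt-≐ e)
    ; cast₂ = castᵗ ; cast₂-≈ = castᵗ-≈
    ; id₂ = idᵗ ; _•_ = _•ᵗ_ ; _▷_ = _▷ᵗ_ ; _◁_ = _◁ᵗ_
    ; id₂-≈ = id-≈ᵗ ; •-≈ = •-≈ᵗ ; ▷-≈ = ▷-≈ᵗ ; ◁-≈ = ◁-≈ᵗ
    ; •-identityˡ = λ {A} {B} α → zip⇒≈ᵗ (Compose.compose-idˡ (ctx-ok B) (zipᵗ α))
    ; •-identityʳ = λ {A} {B} α → zip⇒≈ᵗ (compose-idʳ (ctx-ok B) (zipᵗ α))
    ; •-assoc = λ {A} {B} γ β α → zip⇒≈ᵗ (ComposeAssoc.compose-assoc (ctx-ok B) (zipᵗ α) (zipᵗ β) (zipᵗ γ))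
    ; ▷-id₂ = λ h f → zip⇒≈ᵗ (ApCompose.A-rs (terms-ok h) (terms-ok f))
    ; ▷-• = λ h β α → zip⇒≈ᵗ (ApCompose.ap-compose (terms-ok h) (zipᵗ α) (zipᵗ β))
    ; ▷-id = λ {A} {B} {f} {g} α → zip⇒≈ᵗ
        (⇛≐≡ (Apᵖ-zip (ctx B) (ctx B) idₛ (terms f) (terms g) (paths α)) (id-⊚ _)
          (⇛-comp-≐ (ap-id (ctx-ok B)) (⇛-refl (zipᵗ α))))
    ; ▷-∘ = λ {A} {B} {C} {D} k h {f} {g} α → zip⇒≈ᵗ
        (⇛≐≡ (Apᵖ-zip (ctx B) (ctx D) (terms k ⊚ terms h) (terms f) (terms g) (paths α))
             (trans (⊚≡ (Apᵖ (ctx C) (ctx D) (terms k)) (Apᵖ-zip (ctx B) (ctx C) (terms h) (terms f) (terms g) (paths α)))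
               (Apᵖ-zip (ctx C) (ctx D) (terms k) _ _ _))
          (⇛-comp-≐ (ap-∘ (terms-ok k) (terms-ok h)) (⇛-refl (zipᵗ α))))
    ; ◁-id₂ = λ {A} {B} {C} f k → ≡⇒≈ᵗ refl refl (rs-⊚ (ctx C) (terms f) (terms k))
    ; ◁-• = λ {A} {B} {C} {f} {g} {h} β α k → ≡⇒≈ᵗ refl refl
        (compose-⊚ (ctx C) (terms f) (terms g) (terms h) (paths α) (paths β) (terms k))
    ; ◁-id = λ {A} {B} {f} {g} α → ≡⇒≈ᵗ (⊚-id (terms f)) (⊚-id (terms g)) (⊚-id (paths α))
    ; ◁-∘ = λ {A} {B} {C} {D} {f} {g} α h k → ≡⇒≈ᵗ (sym (⊚-assoc (terms f) (terms h) (terms k)))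
        (sym (⊚-assoc (terms g) (terms h) (terms k))) (sym (⊚-assoc (paths α) (terms h) (terms k)))
    ; ▷-◁ = λ {A} {B} {C} {D} h {f} {g} α k → ≡⇒≈ᵗ (⊚-assoc (terms h) (terms f) (terms k)) (⊚-assoc (terms h) (terms g) (terms k))
        (ApCompose.A-⊚ (terms-ok h) (terms f) (terms g) (paths α) (terms k))
    ; interchange = λ {A} {B} {C} {h} {h′} β α → zip⇒≈ᵗ
        (Interchange.interchange (terms-ok h) (terms-ok h′) (zipᵗ β) (zipᵗ α)) }

module TypeTwoCategory (S : TypeTheory) where
  open TypeTheory S
  open Congruence S
  open ContextTwoCategory S
  private module C = TwoCategory ℭ

  record TypeInContext : Set where
    constructor typeInContext
    field
      base    : Context
      type    : Ty (length base)
      type-ok : ctx base ⊢ type type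
  open TypeInContext public

  _∙ : TypeInContext → Context
  (typeInContext (context Γ w) A A∶) ∙ = context (Γ ▹ A) (w ▹ A∶)

  π : (X : TypeInContext) → Morphism (X ∙) (base X)
  π (typeInContext Γ A A∶) = morphism wk (wk⇛ A∶)

  record TypeMorphism (X Y : TypeInContext) : Set where
    constructor typeMorphism
    field
      over    : Morphism (base X) (base Y)
      term    : Tm (suc (length (base X)))
      term-ok : ctx (X ∙) ⊢ term ∶ type Y [ terms over ⊚ wk ]ᵀ
  open TypeMorphism public

  total : ∀ {X Y} → TypeMorphism X Y → Morphism (X ∙) (Y ∙)
  total {X} {Y} (typeMorphism f g g∶) =
    morphism (g ∷ terms f ⊚ wk) (ext (⇛-comp (terms-ok f) (wk⇛ (type-ok X))) (type-ok Y) g∶)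

  data _≋ᵀ_ : TypeInContext → TypeInContext → Set where
    equal : ∀ {n} {Γ Γ′ : Ctx n} {w w′ A A′ a a′} → ⊢ Γ ≐ Γ′ → Γ ⊢ A ≐ A′ type →
            typeInContext (context Γ w) A a ≋ᵀ typeInContext (context Γ′ w′) A′ a′

  data _≈ᵀ_ : ∀ {X Y X′ Y′} → TypeMorphism X Y → TypeMorphism X′ Y′ → Set where
    equal : ∀ {X Y X′ Y′} {f : TypeMorphism X Y} {f′ : TypeMorphism X′ Y′} →
            X ≋ᵀ X′ → Y ≋ᵀ Y′ → over f C.≈ over f′ → total f C.≈ total f′ → f ≈ᵀ f′

  ∙-≋ : ∀ {X Y} → X ≋ᵀ Y → X ∙ C.≋ Y ∙
  ∙-≋ (equal c e) = equal (c ▹ e)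

  ∙-≋⁻¹ : ∀ {X Y} → X ∙ C.≋ Y ∙ → X ≋ᵀ Y
  ∙-≋⁻¹ {typeInContext (context Γ w) A a} {typeInContext (context Γ′ w′) A′ a′} (equal (c ▹ e)) = equal c e

  base-≋ : ∀ {X Y} → X ≋ᵀ Y → base X C.≋ base Y
  base-≋ (equal c e) = equal c

  π-≈ : ∀ {X Y} → X ≋ᵀ Y → π X C.≈ π Y
  π-≈ (equal c e) = equal (equal (c ▹ e)) (equal c) (⇛-refl (wk⇛ (left-type e)))

  equalᵀ : ∀ {X Y X′ Y′} {f : TypeMorphism X Y} {f′ : TypeMorphism X′ Y′} →
           over f C.≈ over f′ → total f C.≈ total f′ → f ≈ᵀ f′
  equalᵀ e t = equal (∙-≋⁻¹ (C.≈-dom t)) (∙-≋⁻¹ (C.≈-cod t)) e t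

  over-≈ : ∀ {X Y X′ Y′} {f : TypeMorphism X Y} {f′ : TypeMorphism X′ Y′} → f ≈ᵀ f′ → over f C.≈ over f′
  over-≈ (equal _ _ e _) = e

  total-≈ : ∀ {X Y X′ Y′} {f : TypeMorphism X Y} {f′ : TypeMorphism X′ Y′} → f ≈ᵀ f′ → total f C.≈ total f′
  total-≈ (equal _ _ _ t) = t

  idᵀ : ∀ {X} → TypeMorphism X X
  idᵀ {typeInContext (context Γ w) A A∶} =
    typeMorphism idᵐ (var zero) (v₀∶ A∶ ∶≡ cong (A [_]ᵀ) (sym (id-⊚ wk)))

  _∘ᵀ_ : ∀ {X Y Z} → TypeMorphism Y Z → TypeMorphism X Y → TypeMorphism X Z
  _∘ᵀ_ {X} {Y} {Z} h f = typeMorphism (over h ∘ᵐ over f) (term h [ terms (total f) ])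
    (subst-term (terms-ok (total f)) (term-ok h) ∶≡
      trans ([⊚]ᵀ (type Z) _ _) (cong (type Z [_]ᵀ) (trans (⊚wk-∷ (terms (over h)) _ _) (sym (⊚-assoc _ _ _)))))

  over-id : ∀ {X} → over (idᵀ {X}) C.≈ C.id {base X}
  over-id {typeInContext (context Γ w) A a} = C.≈-refl

  total-id : ∀ {X} → total (idᵀ {X}) C.≈ C.id {X ∙}
  total-id {typeInContext (context Γ w) A A∶} = ≡⇒≈ᵐ (cong (var zero ∷_) (id-⊚ wk))

  total-∘ : ∀ {X Y Z} (h : TypeMorphism Y Z) (f : TypeMorphism X Y) → total (h ∘ᵀ f) C.≈ total h C.∘ total f
  total-∘ h f = ≡⇒≈ᵐ (cong (_ ∷_) (trans (⊚-assoc _ _ _) (sym (⊚wk-∷ (terms (over h)) _ _))))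

  π-total : ∀ {X Y} (f : TypeMorphism X Y) → π Y C.∘ total f C.≈ over f C.∘ π X
  π-total f = ≡⇒≈ᵐ (wk-∷ _ _)

  castᵀ : ∀ {X Y X′ Y′} → X ≋ᵀ X′ → Y ≋ᵀ Y′ → TypeMorphism X Y → TypeMorphism X′ Y′
  castᵀ (equal c a) (equal d b) (typeMorphism f g g∶) = typeMorphism (castᵐ (equal c) (equal d) f) g
    (ctx-term (≐-converts (c ▹ a)) (conv g∶ (subst-type-≐ (⇛-refl (⇛-comp (terms-ok f) (wk⇛ (left-type a)))) b)))

  castᵀ-≈ : ∀ {X Y X′ Y′} (a : X ≋ᵀ X′) (b : Y ≋ᵀ Y′) (f : TypeMorphism X Y) → castᵀ a b f ≈ᵀ f
  castᵀ-≈ a@(equal c _) b@(equal d _) f = equalᵀ (C.cast-≈ (base-≋ a) (base-≋ b) (over f))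
    (C.≈-trans (≡⇒≈ᵐ refl) (C.cast-≈ (∙-≋ a) (∙-≋ b) (total f)))

  types : Category
  types = record
    { Ob = TypeInContext ; _≋_ = _≋ᵀ_ ; Hom = TypeMorphism ; _≈_ = _≈ᵀ_
    ; ≋-refl = ∙-≋⁻¹ C.≋-refl ; ≋-sym = λ e → ∙-≋⁻¹ (C.≋-sym (∙-≋ e))
    ; ≋-trans = λ e e′ → ∙-≋⁻¹ (C.≋-trans (∙-≋ e) (∙-≋ e′))
    ; ≈-refl = equalᵀ C.≈-refl C.≈-refl
    ; ≈-sym = λ e → equalᵀ (C.≈-sym (over-≈ e)) (C.≈-sym (total-≈ e))
    ; ≈-trans = λ e e′ → equalᵀ (C.≈-trans (over-≈ e) (over-≈ e′)) (C.≈-trans (total-≈ e) (total-≈ e′))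
    ; ≈-dom = λ { (equal a b _ _) → a } ; ≈-cod = λ { (equal a b _ _) → b }
    ; cast = castᵀ ; cast-≈ = castᵀ-≈
    ; id = idᵀ ; _∘_ = _∘ᵀ_
    ; id-≈ = λ {X} {Y} e → equalᵀ (C.≈-trans (over-id {X}) (C.≈-trans (C.id-≈ (base-≋ e)) (C.≈-sym (over-id {Y}))))
        (C.≈-trans total-id (C.≈-trans (C.id-≈ (∙-≋ e)) (C.≈-sym total-id)))
    ; ∘-≈ = λ {_} {_} {_} {_} {_} {_} {g} {f} {g′} {f′} e e′ → equalᵀ (C.∘-≈ (over-≈ e) (over-≈ e′))
        (C.≈-trans (total-∘ g f) (C.≈-trans (C.∘-≈ (total-≈ e) (total-≈ e′)) (C.≈-sym (total-∘ g′ f′))))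
    ; identityˡ = λ {X} {Y} f → equalᵀ (C.≈-trans (C.∘-≈ (over-id {Y}) C.≈-refl) (C.identityˡ (over f)))
        (C.≈-trans (total-∘ idᵀ f) (C.≈-trans (C.∘-≈ total-id C.≈-refl) (C.identityˡ (total f))))
    ; identityʳ = λ {X} {Y} f → equalᵀ (C.≈-trans (C.∘-≈ C.≈-refl (over-id {X})) (C.identityʳ (over f)))
        (C.≈-trans (total-∘ f idᵀ) (C.≈-trans (C.∘-≈ C.≈-refl total-id) (C.identityʳ (total f))))
    ; assoc = λ h g f → equalᵀ (C.assoc (over h) (over g) (over f))
        (C.≈-trans (total-∘ (h ∘ᵀ g) f) (C.≈-trans (C.∘-≈ (total-∘ h g) C.≈-refl)
          (C.≈-trans (C.assoc (total h) (total g) (total f)) (C.≈-sym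
            (C.≈-trans (total-∘ h (g ∘ᵀ f)) (C.∘-≈ C.≈-refl (total-∘ g f))))))) }

  squares : Squares ℭ
  squares = record
    { T = types
    ; top = record { F₀ = _∙ ; F₁ = total ; F₀-≋ = ∙-≋ ; F₁-≈ = total-≈ ; F-id = total-id ; F-∘ = total-∘ }
    ; bot = record { F₀ = base ; F₁ = over ; F₀-≋ = base-≋ ; F₁-≈ = over-≈ ; F-id = λ {X} → over-id {X} ; F-∘ = λ h f → C.≈-refl }
    ; π = π ; π-≈ = π-≈ ; π-natural = π-total ; reflect-≈ = λ t e → equalᵀ e t }

  𝔗 : TwoCategory
  𝔗 = SquareTransformations.twoCategory squares

  p : TwoFunctor 𝔗 ℭ
  p = SquareTransformations.projection squares

  reindex : ∀ {Γ} (Y : TypeInContext) → Morphism Γ (base Y) → TypeInContext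
  reindex {Γ} Y f = typeInContext Γ (type Y [ terms f ]ᵀ) (subst-type (terms-ok f) (type-ok Y))

  -- (f, ι)
  chosenLift : ∀ {Γ} (Y : TypeInContext) (f : Morphism Γ (base Y)) → TypeMorphism (reindex Y f) Y
  chosenLift Y f = typeMorphism f (var zero) (v₀∶ (type-ok (reindex Y f)) ∶≡ [⊚]ᵀ (type Y) _ _)

{-# OPTIONS --safe #-}
module Submission where

open import Defs
open import Data.Fin.Base using (zero; suc)
open import Data.Nat.Base using (_+_; suc)
open import Data.Product.Base using (Σ-syntax; _×_; _,_; proj₁; proj₂)
open import Data.Vec.Base using ([]; _∷_; tabulate; head; tail)
open import Data.Vec.Properties using (tabulate∘lookup)
open import Relation.Binary.PropositionalEquality using (_≡_; refl; sym; trans; cong; cong₂; subst)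

-- Both 2-categories are locally groupoidal, so every 2-cell is cartesian over its image, and the local
-- fibrations exist as soon as 2-cells lift; a 2-cell γ : k ⇒ h below h lifts to the pair of γ and
-- reflexivity, by transporting h along γ.  To factor α through a chosen lift c over c ▷ γ, compose α
-- with the inverse of c ▷ γ̄ for γ̄ a lift of γ: what remains lies over an identity.  It is a path in a
-- fibre, and on such paths c acts as the identity up to definitional equality, by path induction and
-- discreteness of the identity types.

-- Discreteness enters through `unique-path`: two families of paths with equal end points that agree
-- at reflexivity are definitionally equal. It applies to families over all of `Path Φ`, with both
-- end points free, whereas a path in a fibre has its base component fixed at reflexivity. A
-- statement about fibre paths is therefore extended to all paths and then specialised, which is
-- possible because transport along reflexivity is definitionally the identity. The direction of
-- transport matters as well: identity contexts carry the fibre over the target of a path back to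
-- the fibre over its source, which is what a lift of γ with prescribed target requires. Two formal
-- matters remain. Factorisations are demanded for every cartesian 1-cell and not just for the
-- chosen ones, so the former are compared with the latter. And equality relates cells with possibly
-- different boundaries, so cells are cast to matching boundaries before they are composed.

-- Locally groupoidal 2-categories.

record LocallyGroupoidal (C : TwoCategory) : Set where
  open TwoCategory C
  infix 10 _⁻¹
  field
    _⁻¹      : ∀ {A B} {f g : Hom A B} → f ⇒ g → g ⇒ f
    inverseˡ : ∀ {A B} {f g : Hom A B} (α : f ⇒ g) → (α ⁻¹) • α ≈₂ id₂ {f = f}
    inverseʳ : ∀ {A B} {f g : Hom A B} (α : f ⇒ g) → α • (α ⁻¹) ≈₂ id₂ {f = g}

module TwoCells (C : TwoCategory) where
  open TwoCategory C

  infixr 3 _⟫_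
  _⟫_ : ∀ {A B A′ B′ A″ B″} {f g : Hom A B} {f′ g′ : Hom A′ B′} {f″ g″ : Hom A″ B″}
        {α : f ⇒ g} {β : f′ ⇒ g′} {γ : f″ ⇒ g″} → α ≈₂ β → β ≈₂ γ → α ≈₂ γ
  _⟫_ = ≈₂-trans

  ▷-cong : ∀ {A B C A′} (h : Hom B C) {f g : Hom A B} {f′ g′ : Hom A′ B} {α : f ⇒ g} {α′ : f′ ⇒ g′} →
           α ≈₂ α′ → h ▷ α ≈₂ h ▷ α′
  ▷-cong h e = ▷-≈ ≈-refl e

  -- The usual comparison of a left inverse with a right inverse. Since `β′` has other boundaries
  -- than `α`, it is cast to `β″` before the two are composed.
  inverse-unique : ∀ {A B A′ B′} {f g : Hom A B} {f′ g′ : Hom A′ B′} {α : f ⇒ g} {β : g ⇒ f} {α′ : f′ ⇒ g′} {β′ : g′ ⇒ f′} →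
                   β • α ≈₂ id₂ {f = f} → α′ • β′ ≈₂ id₂ {f = g′} → α ≈₂ α′ → β ≈₂ β′
  inverse-unique {α = α} {β} {α′} {β′} l r e =
    ≈₂-sym (•-identityʳ β) ⟫ •-≈ ≈₂-refl (id₂-≈ g≈ ⟫ ≈₂-sym r ⟫ •-≈ (≈₂-sym e) (≈₂-sym β″≈)) ⟫
    ≈₂-sym (•-assoc β α β″) ⟫ •-≈ l ≈₂-refl ⟫ •-identityˡ β″ ⟫ β″≈
    where
    g≈ = ≈₂-cod e
    β″ = cast₂ (≈-sym g≈) (≈-sym (≈₂-dom e)) β′
    β″≈ : β″ ≈₂ β′
    β″≈ = cast₂-≈ _ _ β′

module GroupoidProperties {C : TwoCategory} (G : LocallyGroupoidal C) where
  open TwoCategory C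
  open LocallyGroupoidal G
  open TwoCells C

  cancelˡ : ∀ {A B} {f g h : Hom A B} (α : f ⇒ g) (β : h ⇒ f) → α ⁻¹ • (α • β) ≈₂ β
  cancelˡ α β = ≈₂-sym (•-assoc (α ⁻¹) α β) ⟫ •-≈ (inverseˡ α) ≈₂-refl ⟫ •-identityˡ β

  cancelʳ : ∀ {A B} {f g h : Hom A B} (α : f ⇒ g) (β : h ⇒ g) → α • (α ⁻¹ • β) ≈₂ β
  cancelʳ α β = ≈₂-sym (•-assoc α (α ⁻¹) β) ⟫ •-≈ (inverseʳ α) ≈₂-refl ⟫ •-identityˡ β

-- Inversion is componentwise. The inverted square commutes because whiskering by `π` preserves
-- inverses and the two whiskered cells to be inverted are equal.
squares-locallyGroupoidal : ∀ {C : TwoCategory} (Q : Squares C) → LocallyGroupoidal C →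
                            LocallyGroupoidal (SquareTransformations.twoCategory Q)
squares-locallyGroupoidal {C} Q G = record
  { _⁻¹ = λ {X} {Y} α → square (top₂ α ⁻¹) (bot₂ α ⁻¹) (inverse-unique
      (≈₂-sym (▷-• (π Y) (top₂ α ⁻¹) (top₂ α)) ⟫ ▷-cong (π Y) (inverseˡ (top₂ α)) ⟫ ▷-id₂ (π Y) _)
      (≈₂-sym (◁-• (bot₂ α) (bot₂ α ⁻¹) (π X)) ⟫ ◁-≈ (inverseʳ (bot₂ α)) ≈-refl ⟫ ◁-id₂ _ (π X))
      (commute α))
  ; inverseˡ = λ α → equal (inverseˡ (top₂ α)) (inverseˡ (bot₂ α))
  ; inverseʳ = λ α → equal (inverseʳ (top₂ α)) (inverseʳ (bot₂ α)) }
  where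
  open TwoCategory C
  open LocallyGroupoidal G
  open TwoCells C
  open Squares Q using (π)
  open SquareTransformations Q using (square; equal; top₂; bot₂; commute)

-- 2-fibrations whose total 2-category is locally groupoidal.

module Fibred {E B : TwoCategory} (P : TwoFunctor E B) (fibration : Fibrations.ClovenFibration (TwoFunctor.functor P))
              (G : LocallyGroupoidal E) where
  private
    module E where
      open TwoCategory E public
      open LocallyGroupoidal G public
      open GroupoidProperties G public
    module B = TwoCategory B
  open TwoCells E renaming (_⟫_ to _⟫ᴱ_; ▷-cong to ▷-congᴱ)
  open TwoCells B renaming (_⟫_ to _⟫ᴮ_; ▷-cong to ▷-congᴮ)
  open TwoFunctor P
  open Fibrations
  open ClovenFibration fibration

  -- Composition with the inverse of `α` already solves for the filler uniquely upstairs; the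
  -- equation downstairs shows that this solution lies over `k`.
  invertible-cartesian : ∀ {x y} {f g : E.Hom x y} (α : f E.⇒ g) → IsCartesian (homFunctor x y) α
  invertible-cartesian α β k e =
    α E.⁻¹ E.• β , E.≈₂-sym (E.cancelʳ α β) ,
    (F-• (α E.⁻¹) β ⟫ᴮ B.•-≈ B.≈₂-refl e ⟫ᴮ B.≈₂-sym (B.•-assoc _ _ k) ⟫ᴮ
      B.•-≈ (B.≈₂-sym (F-• (α E.⁻¹) α) ⟫ᴮ F₂-≈ (E.inverseˡ α) ⟫ᴮ F-id₂) B.≈₂-refl ⟫ᴮ B.•-identityˡ k) ,
    λ k″ e₁ _ → E.≈₂-sym (E.•-≈ E.≈₂-refl e₁ ⟫ᴱ E.cancelˡ α k″)

  record Factorisation {x y z} (f : E.Hom y z) {g h : E.Hom x z} (α : g E.⇒ h)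
                       {k l : B.Hom (F₀ x) (F₀ y)} (γ : k B.⇒ l) : Set where
    field
      {source target} : E.Hom x y
      cell            : source E.⇒ target
      composite       : α E.≈₂ f E.▷ cell
      over            : F₂ cell B.≈₂ γ
      unique          : ∀ {k″ l″ : E.Hom x y} (γ″ : k″ E.⇒ l″) → α E.≈₂ f E.▷ γ″ → F₂ γ″ B.≈₂ γ → γ″ E.≈₂ cell

  -- The end points of a factorisation are themselves factorisations of 1-cells, so that its uniqueness
  -- can be tested on parallel 2-cells.

  factorisation : ∀ {x y z} {f : E.Hom y z} → IsCartesian functor f → ∀ {g h : E.Hom x z} {α : g E.⇒ h}
                  {k l : B.Hom (F₀ x) (F₀ y)} {γ : k B.⇒ l} {s t : E.Hom x y} (γ′ : s E.⇒ t) →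
                  α E.≈₂ f E.▷ γ′ → F₂ γ′ B.≈₂ γ →
                  (∀ (γ″ : s E.⇒ t) → α E.≈₂ f E.▷ γ″ → F₂ γ″ B.≈₂ γ → γ″ E.≈₂ γ′) → Factorisation f α γ
  factorisation {f = f} cart {g} {h} {α} {k} {l} {γ} {s} {t} γ′ e o u = record
    { cell = γ′ ; composite = e ; over = o ; unique = unique }
    where
    same : ∀ {g} {k : B.Hom _ _} {s s″} → g E.≈ f E.∘ s → F₁ s B.≈ k → g E.≈ f E.∘ s″ → F₁ s″ B.≈ k → s″ E.≈ s
    same a b a″ b″ = E.≈-trans (U _ a″ b″) (E.≈-sym (U _ a b))
      where U = proj₂ (proj₂ (proj₂ (cart _ _ (B.≈-trans (F₁-≈ a) (B.≈-trans (F-∘ f _) (B.∘-≈ B.≈-refl b))))))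
    unique : ∀ {k″ l″} (γ″ : k″ E.⇒ l″) → α E.≈₂ f E.▷ γ″ → F₂ γ″ B.≈₂ γ → γ″ E.≈₂ γ′
    unique γ″ e″ o″ = E.≈₂-sym c ⟫ᴱ u (E.cast₂ a b γ″) (e″ ⟫ᴱ E.≈₂-sym (▷-congᴱ f c)) (F₂-≈ c ⟫ᴮ o″)
      where
      a = same (E.≈₂-dom e) (B.≈₂-dom o) (E.≈₂-dom e″) (B.≈₂-dom o″)
      b = same (E.≈₂-cod e) (B.≈₂-cod o) (E.≈₂-cod e″) (B.≈₂-cod o″)
      c : E.cast₂ a b γ″ E.≈₂ γ″
      c = E.cast₂-≈ a b γ″

  -- A cartesian 1-cell is isomorphic to the chosen one below it.

  module Cartesian {y z} {f : E.Hom y z} (f-cartesian : IsCartesian functor f) where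
    private
      c = lift z (F₁ f)
      -- The chosen pullback lies over an object that is merely `≋` to `F₀ y`, so the comparisons
      -- `i` and `j` lie over casts of the identity.
      ≋ᴮ : F₀ y B.≋ F₀ (pullback z (F₁ f))
      ≋ᴮ = B.≋-sym (B.≈-dom (lift-over z (F₁ f)))
      u : B.Hom (F₀ y) (F₀ (pullback z (F₁ f)))
      u = B.cast B.≋-refl ≋ᴮ B.id
      u≈ : u B.≈ B.id {F₀ y}
      u≈ = B.cast-≈ _ _ _
      v : B.Hom (F₀ (pullback z (F₁ f))) (F₀ y)
      v = B.cast ≋ᴮ B.≋-refl B.id
      v≈ : v B.≈ B.id {F₀ y}
      v≈ = B.cast-≈ _ _ _
      to = lift-cartesian z (F₁ f) f u
        (B.≈-sym (B.≈-trans (B.∘-≈ (lift-over z (F₁ f)) u≈) (B.identityʳ (F₁ f))))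
      i = proj₁ to
      f≈ : f E.≈ c E.∘ i
      f≈ = proj₁ (proj₂ to)
      i≈ : F₁ i B.≈ u
      i≈ = proj₁ (proj₂ (proj₂ to))
      from = f-cartesian c v
        (B.≈-trans (lift-over z (F₁ f)) (B.≈-sym (B.≈-trans (B.∘-≈ B.≈-refl v≈) (B.identityʳ (F₁ f)))))
      j = proj₁ from
      c≈ : c E.≈ f E.∘ j
      c≈ = proj₁ (proj₂ from)
      j≈ : F₁ j B.≈ v
      j≈ = proj₁ (proj₂ (proj₂ from))
      endo = f-cartesian f B.id (B.≈-sym (B.identityʳ (F₁ f)))
      -- Both sides factor `f` through itself over the identity.
      ji≈ : j E.∘ i E.≈ E.id {y}
      ji≈ = E.≈-trans
        (proj₂ (proj₂ (proj₂ endo)) (j E.∘ i)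
          (E.≈-trans f≈ (E.≈-trans (E.∘-≈ c≈ E.≈-refl) (E.assoc f j i)))
          (B.≈-trans (F-∘ j i) (B.≈-trans (B.∘-≈ (B.≈-trans j≈ v≈) (B.≈-trans i≈ u≈)) (B.identityˡ B.id))))
        (E.≈-sym (proj₂ (proj₂ (proj₂ endo)) E.id (E.≈-sym (E.identityʳ f)) F-id))

    -- A factor through `c` is carried along `j`. Existence rests on c = f ∘ j; uniqueness moves a
    -- competitor along `i`, compares it there, and returns by j ∘ i = id.
    factorisation-via-lift : ∀ {x} {g h : E.Hom x z} {α : g E.⇒ h} {k l : B.Hom (F₀ x) (F₀ y)} {γ : k B.⇒ l} →
      (∀ {k l : B.Hom (F₀ x) (F₀ (pullback z (F₁ f)))} (γ : k B.⇒ l) → F₂ α B.≈₂ F₁ c B.▷ γ → Factorisation c α γ) →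
      F₂ α B.≈₂ F₁ f B.▷ γ → Factorisation f α γ
    factorisation-via-lift {x} {α = α} {γ = γ} factor e = record
      { cell = j E.▷ cell
      ; composite = composite ⟫ᴱ E.▷-≈ c≈ E.≈₂-refl ⟫ᴱ E.▷-∘ f j cell
      ; over = F-▷ j cell ⟫ᴮ B.▷-≈ (B.≈-trans j≈ v≈) (over ⟫ᴮ uγ≈) ⟫ᴮ B.▷-id γ
      ; unique = λ γ″ e″ o″ → E.≈₂-sym (E.▷-id γ″) ⟫ᴱ E.▷-≈ (E.≈-sym ji≈) E.≈₂-refl ⟫ᴱ E.▷-∘ j i γ″ ⟫ᴱ
          ▷-congᴱ j (unique (i E.▷ γ″)
            (e″ ⟫ᴱ E.▷-≈ f≈ E.≈₂-refl ⟫ᴱ E.▷-∘ c i γ″) (F-▷ i γ″ ⟫ᴮ B.▷-≈ i≈ o″)) }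
      where
      uγ≈ : u B.▷ γ B.≈₂ γ
      uγ≈ = B.▷-≈ u≈ B.≈₂-refl ⟫ᴮ B.▷-id γ
      open Factorisation (factor (u B.▷ γ) (e ⟫ᴮ B.≈₂-sym (B.▷-≈ (lift-over z (F₁ f)) uγ≈)))

  -- What has to be supplied about the fibres: liftings of 2-cells, and factorisation through a
  -- chosen lift in the special case of a cell over an identity. Everything else is formal.
  record LocalStructure : Set where
    field
      homFibration : ∀ x y → ClovenFibration (homFunctor x y)
      vertical     : ∀ {x z b} (f : B.Hom b (F₀ z)) {g g′ : E.Hom x (pullback z f)}
        (δ : lift z f E.∘ g E.⇒ lift z f E.∘ g′) → F₁ g B.≈ F₁ g′ → F₂ δ B.≈₂ B.id₂ {f = F₁ (lift z f E.∘ g)} →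
        Σ[ δ′ ∈ g E.⇒ g′ ] (δ E.≈₂ lift z f E.▷ δ′) × (F₂ δ′ B.≈₂ B.id₂ {f = F₁ g}) ×
          (∀ (δ″ : g E.⇒ g′) → δ E.≈₂ lift z f E.▷ δ″ → F₂ δ″ B.≈₂ B.id₂ {f = F₁ g} → δ″ E.≈₂ δ′)

  module _ (L : LocalStructure) where
    open LocalStructure L

    -- Write α = (f ▷ γ̄) • δ, with γ̄ the lift of γ at the target; then δ is vertical.

    lift-factorisation : ∀ {x z b} (f : B.Hom b (F₀ z)) {g h : E.Hom x z} (α : g E.⇒ h)
                         {k l : B.Hom (F₀ x) (F₀ (pullback z f))} (γ : k B.⇒ l) →
                         F₂ α B.≈₂ F₁ (lift z f) B.▷ γ → Factorisation (lift z f) α γ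
    lift-factorisation {x} {z} f {g} {h} α {k} {l} γ e = factorisation (lift-cartesian z f) (γ̄ E.• δ′)
      (E.≈₂-sym (E.▷-• c γ̄ δ′ ⟫ᴱ E.•-≈ E.≈₂-refl (E.≈₂-sym δ≈) ⟫ᴱ E.≈₂-sym (E.•-assoc _ _ α′) ⟫ᴱ
        E.•-≈ (E.≈₂-sym (E.▷-• c γ̄ (γ̄ E.⁻¹)) ⟫ᴱ ▷-congᴱ c (E.inverseʳ γ̄) ⟫ᴱ E.▷-id₂ c t) E.≈₂-refl ⟫ᴱ
        E.•-identityˡ α′ ⟫ᴱ α′≈))
      (F-• γ̄ δ′ ⟫ᴮ B.•-≈ γ̄≈ (proj₁ (proj₂ (proj₂ V)) ⟫ᴮ B.id₂-≈ s≈) ⟫ᴮ B.•-identityʳ γ)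
      -- A competitor equals γ̄ • (γ̄⁻¹ • γ″), and the cell in brackets is again a factor of `δ`
      -- over an identity.
      λ γ″ e″ o″ → E.≈₂-sym (E.cancelʳ γ̄ γ″) ⟫ᴱ E.•-≈ E.≈₂-refl (proj₂ (proj₂ (proj₂ V)) (γ̄ E.⁻¹ E.• γ″)
        (E.•-≈ E.≈₂-refl (α′≈ ⟫ᴱ e″) ⟫ᴱ E.≈₂-sym (E.▷-• c (γ̄ E.⁻¹) γ″))
        (F-• (γ̄ E.⁻¹) γ″ ⟫ᴮ B.•-≈ B.≈₂-refl (o″ ⟫ᴮ B.≈₂-sym γ̄≈) ⟫ᴮ inverse≈ ⟫ᴮ B.id₂-≈ (B.≈-sym s≈s*)))
      where
      c = lift z f
      S = lift-cartesian z f g k (B.≈₂-dom e)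
      s = proj₁ S
      s≈ : F₁ s B.≈ k
      s≈ = proj₁ (proj₂ (proj₂ S))
      T = lift-cartesian z f h l (B.≈₂-cod e)
      t = proj₁ T
      t≈ : F₁ t B.≈ l
      t≈ = proj₁ (proj₂ (proj₂ T))
      -- The target of `γ` is `l`, to which the image of `t` is merely equal.
      γ₁ = B.cast₂ B.≈-refl (B.≈-sym t≈) γ
      module H = ClovenFibration (homFibration x (pullback z f))
      s* = H.pullback t γ₁
      γ̄ : s* E.⇒ t
      γ̄ = H.lift t γ₁
      γ̄≈ : F₂ γ̄ B.≈₂ γ
      γ̄≈ = H.lift-over t γ₁ ⟫ᴮ B.cast₂-≈ _ _ γ
      α′ = E.cast₂ (proj₁ (proj₂ S)) (proj₁ (proj₂ T)) α
      α′≈ : α′ E.≈₂ α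
      α′≈ = E.cast₂-≈ _ _ α
      δ : c E.∘ s E.⇒ c E.∘ s*
      δ = (c E.▷ γ̄ E.⁻¹) E.• α′
      inverse≈ : F₂ (γ̄ E.⁻¹) B.• F₂ γ̄ B.≈₂ B.id₂ {f = F₁ s*}
      inverse≈ = B.≈₂-sym (F-• (γ̄ E.⁻¹) γ̄) ⟫ᴮ F₂-≈ (E.inverseˡ γ̄) ⟫ᴮ F-id₂
      s≈s* : F₁ s B.≈ F₁ s*
      s≈s* = B.≈-trans s≈ (B.≈-sym (B.≈₂-dom γ̄≈))
      F₂δ≈ : F₂ δ B.≈₂ B.id₂ {f = F₁ (c E.∘ s)}
      F₂δ≈ = F-• (c E.▷ γ̄ E.⁻¹) α′ ⟫ᴮ
        B.•-≈ (F-▷ c (γ̄ E.⁻¹)) (F₂-≈ α′≈ ⟫ᴮ e ⟫ᴮ ▷-congᴮ (F₁ c) (B.≈₂-sym γ̄≈)) ⟫ᴮ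
        B.≈₂-sym (B.▷-• (F₁ c) (F₂ (γ̄ E.⁻¹)) (F₂ γ̄)) ⟫ᴮ ▷-congᴮ (F₁ c) inverse≈ ⟫ᴮ B.▷-id₂ (F₁ c) (F₁ s*) ⟫ᴮ
        B.id₂-≈ (B.≈-trans (B.∘-≈ B.≈-refl (B.≈-sym s≈s*)) (B.≈-sym (F-∘ c s)))
      V = vertical f δ s≈s* F₂δ≈
      δ′ = proj₁ V
      δ≈ : δ E.≈₂ c E.▷ δ′
      δ≈ = proj₁ (proj₂ V)

    cloven2Fibration : Cloven2Fibration P
    cloven2Fibration = record
      { fibration = fibration
      ; factor₂ = λ {y} {z} f cart α γ e →
          let open Factorisation (Cartesian.factorisation-via-lift cart (lift-factorisation (F₁ f) α) e)
          in source , target , cell , composite , over , unique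
      ; homFibration = homFibration
      ; ◁-cartesian = λ f α _ → invertible-cartesian (α E.◁ f) }

-- The split fibration of 1-cells given by reindexing.

module TypeFibration (S : TypeTheory) where
  open TypeTheory S
  open Congruence S
  open ContextTwoCategory S
  open TypeTwoCategory S
  private module T = Category types

  terms≐ : ∀ {Γ Δ} {f g : Morphism Γ Δ} → f ≈ᵐ g → ctx Γ ⊢ terms f ≐ terms g ⇛ ctx Δ
  terms≐ (equal (equal _) (equal _) e) = e

  ≐⇒≈ᵐ : ∀ {Γ Δ} {f g : Morphism Γ Δ} → ctx Γ ⊢ terms f ≐ terms g ⇛ ctx Δ → f ≈ᵐ g
  ≐⇒≈ᵐ {context Γ w} {context Δ v} e = equal (equal (ctx-refl w)) (equal (ctx-refl v)) e

  term≐ : ∀ {X Y} {f g : TypeMorphism X Y} → f ≈ᵀ g →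
          ctx (X ∙) ⊢ term f ≐ term g ∶ type Y [ terms (over f) ⊚ wk ]ᵀ
  term≐ e with terms≐ (total-≈ e)
  ... | ext _ _ t = t

  ≐⇒≈ᵀ : ∀ {X Y} {f g : TypeMorphism X Y} → over f ≈ᵐ over g →
         ctx (X ∙) ⊢ term f ≐ term g ∶ type Y [ terms (over f) ⊚ wk ]ᵀ → f ≈ᵀ g
  ≐⇒≈ᵀ {X} {Y} o t = equalᵀ o (≐⇒≈ᵐ (ext (⇛-comp-≐ (terms≐ o) (⇛-refl (wk⇛ (type-ok X)))) (type-ok Y) t))

  wk-≐ : ∀ {m n} {Γ : Ctx m} {Ξ : Ctx n} {A B} {σ τ : Sub m n} → Γ ⊢ A type → Ξ ⊢ B type →
         Γ ⊢ σ ≐ τ ⇛ Ξ → Γ ▹ A ⊢ B [ σ ⊚ wk ]ᵀ ≐ B [ τ ⊚ wk ]ᵀ type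
  wk-≐ A∶ B∶ e = subst-type-≐ (⇛-comp-≐ e (⇛-refl (wk⇛ A∶))) (≐ᵀ-refl B∶)

  term-lift-∘ : ∀ {X Γ} Y (f : Morphism Γ (base Y)) (h : TypeMorphism X (reindex Y f)) →
                term (chosenLift Y f ∘ᵀ h) ≡ term h
  term-lift-∘ Y f h = v₀ _ _

  -- The filler has the very term of `g`: as the base of `g` equals f ∘ k, the type of that term is
  -- definitionally the reindexed one, and conversion suffices.
  chosenLift-cartesian : ∀ {Γ} Y (f : Morphism Γ (base Y)) →
                         Fibrations.IsCartesian (TwoFunctor.functor p) (chosenLift Y f)
  chosenLift-cartesian {Γ} Y f {X} g k e = k′ ,
    ≐⇒≈ᵀ e (eq≡ refl (sym (term-lift-∘ Y f k′)) refl (≐-refl (term-ok g))) , ≈ᵐ-refl ,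
    λ k″ e₁ e₂ → ≐⇒≈ᵀ e₂ (conv-≐ (eq≡ (term-lift-∘ Y f k″) refl refl (≐-sym (term≐ e₁)))
      (≐ᵀ-trans over≐ (teq≡ (sym (B≡ k)) (sym (B≡ (over k″)))
        (wk-≐ (type-ok X) (type-ok Y) (⇛-comp-≐ (⇛-refl (terms-ok f)) (⇛-sym (terms≐ e₂)))))))
    where
    B≡ : ∀ (h : Morphism (base X) Γ) → type Y [ terms f ]ᵀ [ terms h ⊚ wk ]ᵀ ≡ type Y [ terms f ⊚ terms h ⊚ wk ]ᵀ
    B≡ h = []-[]ᵀ (type Y) (sym (⊚-assoc _ _ _))
    over≐ : ctx (X ∙) ⊢ type Y [ terms (over g) ⊚ wk ]ᵀ ≐ type Y [ terms f ]ᵀ [ terms k ⊚ wk ]ᵀ type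
    over≐ = teq≡ refl (sym (B≡ k)) (wk-≐ (type-ok X) (type-ok Y) (terms≐ e))
    k′ : TypeMorphism X (reindex Y f)
    k′ = typeMorphism k (term g) (conv (term-ok g) over≐)

  chosenLift-≈ : ∀ {Y Y′ Γ Γ′} {f : Morphism Γ (base Y)} {f′ : Morphism Γ′ (base Y′)} → Y ≋ᵀ Y′ → f ≈ᵐ f′ →
                 chosenLift Y f ≈ᵀ chosenLift Y′ f′
  chosenLift-≈ {Y} {f = f} (equal d b) e@(equal (equal c) (equal _) s) =
    equalᵀ e (equal (equal (c ▹ subst-type-≐ s b)) (equal (d ▹ b)) (ext (⇛-comp-≐ s (⇛-refl (wk⇛ B∶))) (left-type b)
      (≐-refl (v₀∶ B∶) ≐≡ [⊚]ᵀ (type Y) _ _)))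
    where B∶ = subst-type (terms-ok f) (type-ok Y)

  fibration : Fibrations.ClovenFibration (TwoFunctor.functor p)
  fibration = record
    { pullback = λ Y f → reindex Y f ; lift = λ Y f → chosenLift Y f ; lift-over = λ _ _ → ≈ᵐ-refl
    ; lift-cartesian = λ Y f → chosenLift-cartesian Y f ; lift-≈ = chosenLift-≈ }

  -- Splitness is the strictness of substitution: the laws `[id]ᵀ` and `[⊚]ᵀ` are equations of raw
  -- syntax.
  fibration-split : Fibrations.IsSplit (TwoFunctor.functor p) fibration
  fibration-split = record { lift-id = chosenLift-id ; lift-∘ = chosenLift-∘ }
    where
    chosenLift-id : ∀ Y → chosenLift Y idᵐ ≈ᵀ idᵀ {Y}
    chosenLift-id Y@(typeInContext (context Γ w) A A∶) = equalᵀ ≈ᵐ-refl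
      (equal (equal (ctx-refl w ▹ A≐)) (equal (ctx-refl w ▹ ≐ᵀ-refl A∶)) (⇛-refl (terms-ok (total (chosenLift Y idᵐ)))))
      where
      A≐ : Γ ⊢ A [ idₛ ]ᵀ ≐ A type
      A≐ = teq≡ refl ([id]ᵀ A) (≐ᵀ-refl (subst-type (id⇛ w) A∶))
    chosenLift-∘ : ∀ Y {Ξ Γ} (f : Morphism Γ (base Y)) (g g′ : Morphism Ξ Γ) → g′ ≈ᵐ g →
             chosenLift Y (f ∘ᵐ g) ≈ᵀ (chosenLift Y f ∘ᵀ chosenLift (reindex Y f) g′)
    chosenLift-∘ Y {Ξ} f g g′ e = equalᵀ over≈
      (equal (∙-≋ X≋) (∙-≋ T.≋-refl) (ext (⇛-comp-≐ (terms≐ over≈) (⇛-refl (wk⇛ B∶))) (type-ok Y)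
        (eq≡ refl (sym (v₀ _ _)) ([⊚]ᵀ (type Y) _ _) (≐-refl (v₀∶ B∶)))))
      where
      over≈ : (f ∘ᵐ g) ≈ᵐ (f ∘ᵐ g′)
      over≈ = ≐⇒≈ᵐ (⇛-comp-≐ (⇛-refl (terms-ok f)) (⇛-sym (terms≐ e)))
      B∶ = subst-type (terms-ok (f ∘ᵐ g)) (type-ok Y)
      X≋ : reindex Y (f ∘ᵐ g) ≋ᵀ reindex (reindex Y f) g′
      X≋ = equal (ctx-refl (ctx-ok Ξ)) (teq≡ refl (sym ([⊚]ᵀ (type Y) _ _)) (subst-type-≐ (terms≐ over≈) (≐ᵀ-refl (type-ok Y))))

-- Inverses of paths and of 2-cells between contexts.

module Inverses (S : TypeTheory) where
  open TypeTheory S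
  open Congruence S
  open ContextTwoCategory S

  inverse : ∀ {n} → Ctx n → Sub (tri n) n
  inverse {n} Φ = Jᶜ Φ [] (IdCtx Φ (tgt n) (src n)) (rs Φ idₛ)

  Inverse : ∀ {n} → Ctx n → Sub (tri n) (tri n)
  Inverse {n} Φ = zip (tgt n) (src n) (inverse Φ)

  module Inverse {n} {Φ : Ctx n} (v : ⊢ Φ) where
    open PathFacts (pathFacts v)
    private
      module C = Compose v

      d∋ : Φ ⊢ IdCtx Φ (tgt n) (src n) [ rfl Φ ]ᴱ ∋ rs Φ idₛ
      d∋ = subst (λ (Θ : Ext n n) → Φ ⊢ Θ ∋ rs Φ idₛ)
             (sym (trans (IdCtx-[] Φ _ _ (rfl Φ)) (cong₂ (IdCtx Φ) (tgt-rfl Φ) (src-rfl Φ))))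
             (zip⇒∋ (id⇛ v) (id⇛ v) (rs⇛ (id⇛ v)))
      result = elim [] (IdCtx Φ (tgt n) (src n)) {rs Φ idₛ} (proj₁ (IdCtx-wf Path-wf tgt∶ src∶)) d∋

    Inverse⇛ : Path Φ ⊢ Inverse Φ ⇛ Path Φ
    Inverse⇛ = ∋⇒zip tgt∶ src∶ (proj₁ result)

    Inverse-rfl : Φ ⊢ Inverse Φ ⊚ rfl Φ ≐ rfl Φ ⇛ Path Φ
    Inverse-rfl = ⇛≐≡ (sym (zip-⊚ _ _ _ _)) (zip≡ (tgt-rfl Φ) (src-rfl Φ) refl)
      (∋⇒zip-≐ (⇛-comp tgt∶ rfl∶) (⇛-comp src∶ rfl∶)
        (subst (λ (Θ : Ext n n) → Φ ⊢ Θ ∋ inverse Φ ⊚ rfl Φ ≐ rs Φ idₛ) (IdCtx-[] Φ _ _ (rfl Φ)) (proj₂ result)))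

    Inverse-zip : ∀ {m} (x y p : Sub m n) → Inverse Φ ⊚ zip x y p ≡ zip y x (inverse Φ ⊚ zip x y p)
    Inverse-zip x y p = trans (zip-⊚ _ _ _ _) (zip≡ (tgt-zip x y p) (src-zip x y p) refl)

    inverse⇛ : ∀ {m} {Γ : Ctx m} {x y p} → Γ ⊢ zip x y p ⇛ Path Φ → Γ ⊢ zip y x (inverse Φ ⊚ zip x y p) ⇛ Path Φ
    inverse⇛ {x = x} {y} {p} u = ⇛≡ (Inverse-zip x y p) (⇛-comp Inverse⇛ u)

    private
      generic⇛ : Path Φ ⊢ zip (src n) (tgt n) (path-vars n) ⇛ Path Φ
      generic⇛ = ⇛≡ (sym (zip-vars n)) (id⇛ Path-wf)

      -- inverse ∘ rfl, with end points in the form in which compositions at rfl produce them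
      inverse-rfl : Φ ⊢ zip idₛ idₛ (inverse Φ ⊚ rfl Φ) ≐ rfl Φ ⇛ Path Φ
      inverse-rfl = ⇛≐≡ (trans (zip-⊚ _ _ _ _) (zip≡ (tgt-rfl Φ) (src-rfl Φ) refl)) refl Inverse-rfl

      along : ∀ {m} (x y p : Sub m n) (a : Sub (tri n) n) {b} → a ⊚ zip x y p ≡ b → rfl Φ ⊚ a ⊚ zip x y p ≡ zip b b (rs Φ b)
      along x y p a refl = trans (⊚-assoc _ _ _) (rfl-⊚ Φ _)

      -- Elimination alone would give a propositional identification with reflexivity; `unique-path`
      -- makes it definitional. Leaving `a` general serves both inverse laws, with `a` the source or
      -- the target.
      loop : ∀ (a l : Sub (tri n) n) → Path Φ ⊢ a ⇛ Φ → Path Φ ⊢ zip a a l ⇛ Path Φ → a ⊚ rfl Φ ≡ idₛ →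
             Φ ⊢ zip idₛ idₛ (l ⊚ rfl Φ) ≐ rfl Φ ⇛ Path Φ →
             ∀ {m} {Γ : Ctx m} {x y p : Sub m n} → Γ ⊢ zip x y p ⇛ Path Φ →
             Γ ⊢ zip a a l ⊚ zip x y p ≐ rfl Φ ⊚ a ⊚ zip x y p ⇛ Path Φ
      loop a l a∶ l∶ a≡ e u = ⇛-comp-≐ (unique-path v v (zip a a l) (rfl Φ ⊚ a) l∶ (⇛-comp rfl∶ a∶)
        (≡⇒≐ (trans (src-zip a a l) (sym s≡)) (⇛-comp src∶ l∶)) (≡⇒≐ (trans (tgt-zip a a l) (sym t≡)) (⇛-comp tgt∶ l∶))
        (⇛≐≡ (sym (trans (zip-⊚ a a l (rfl Φ)) (zip≡ a≡ a≡ refl)))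
          (sym (trans (⊚≡ (rfl Φ) a≡) (⊚-id _))) e)) (⇛-refl u)
        where
        s≡ : src n ⊚ (rfl Φ ⊚ a) ≡ a
        s≡ = trans (sym (⊚-assoc _ _ _)) (trans (cong (_⊚ a) (src-rfl Φ)) (id-⊚ a))
        t≡ : tgt n ⊚ (rfl Φ ⊚ a) ≡ a
        t≡ = trans (sym (⊚-assoc _ _ _)) (trans (cong (_⊚ a) (tgt-rfl Φ)) (id-⊚ a))

    -- At reflexivity the inverse computes to reflexivity, and so does the composite, by the left
    -- unit law; `loop` extends this to all paths.
    compose-inverseˡ : ∀ {m} {Γ : Ctx m} {x y p} → Γ ⊢ zip x y p ⇛ Path Φ →
                       Γ ⊢ zip x x (compose-at Φ x y x p (inverse Φ ⊚ zip x y p)) ≐ zip x x (rs Φ x) ⇛ Path Φ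
    compose-inverseˡ {x = x} {y} {p} u =
      ⇛≐≡ (trans (zip-⊚ _ _ _ _) (zip≡ s≡ s≡ (trans (compose-⊚ Φ s t s q (inverse Φ) _)
            (compose-at≡ Φ s≡ (tgt-zip x y p) s≡ (path-vars-zip x y p) refl))))
          (along x y p s s≡)
        (loop s L src∶ (C.compose-at⇛ {x = s} {t} {s} {q} {inverse Φ} generic⇛ Inverse⇛) (src-rfl Φ)
          (⇛-trans (⇛≐≡ (zip≡ refl refl (sym (trans (compose-⊚ Φ s t s q (inverse Φ) (rfl Φ))
              (compose-at≡ Φ (src-rfl Φ) (tgt-rfl Φ) (src-rfl Φ) (path-vars-zip idₛ idₛ (rs Φ idₛ)) refl)))) refl
            (C.compose-at-≐ {x = idₛ} {idₛ} {idₛ} {rs Φ idₛ} {inverse Φ ⊚ rfl Φ} {idₛ} {idₛ} {idₛ} {rs Φ idₛ} {rs Φ idₛ} (⇛-refl rfl∶) inverse-rfl)) (C.compose-idˡ rfl∶)) u)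
      where
      s = src n
      t = tgt n
      q = path-vars n
      L = compose-at Φ s t s q (inverse Φ)
      s≡ : s ⊚ zip x y p ≡ x
      s≡ = src-zip x y p

    compose-inverseʳ : ∀ {m} {Γ : Ctx m} {x y p} → Γ ⊢ zip x y p ⇛ Path Φ →
                       Γ ⊢ zip y y (compose-at Φ y x y (inverse Φ ⊚ zip x y p) p) ≐ zip y y (rs Φ y) ⇛ Path Φ
    compose-inverseʳ {x = x} {y} {p} u =
      ⇛≐≡ (trans (zip-⊚ _ _ _ _) (zip≡ t≡ t≡ (trans (compose-⊚ Φ t s t (inverse Φ) q _)
            (compose-at≡ Φ {p = inverse Φ ⊚ zip x y p} t≡ (src-zip x y p) t≡ refl (path-vars-zip x y p)))))
          (along x y p t t≡)
        (loop t L tgt∶ (C.compose-at⇛ {x = t} {s} {t} {inverse Φ} {q} Inverse⇛ generic⇛) (tgt-rfl Φ)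
          (⇛-trans (⇛≐≡ (zip≡ refl refl (sym (trans (compose-⊚ Φ t s t (inverse Φ) q (rfl Φ))
              (compose-at≡ Φ {p = inverse Φ ⊚ rfl Φ} (tgt-rfl Φ) (src-rfl Φ) (tgt-rfl Φ) refl (path-vars-zip idₛ idₛ (rs Φ idₛ)))))) refl
            (C.compose-at-≐ {x = idₛ} {idₛ} {idₛ} {inverse Φ ⊚ rfl Φ} {rs Φ idₛ} {idₛ} {idₛ} {idₛ} {rs Φ idₛ} {rs Φ idₛ} inverse-rfl (⇛-refl rfl∶))) (C.compose-idˡ rfl∶)) u)
      where
      s = src n
      t = tgt n
      q = path-vars n
      L = compose-at Φ t s t (inverse Φ) q
      t≡ : t ⊚ zip x y p ≡ y
      t≡ = tgt-zip x y p

  _⁻¹ᵗ : ∀ {Γ Δ} {f g : Morphism Γ Δ} → Transformation f g → Transformation g f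
  _⁻¹ᵗ {Δ = Δ} {f} {g} α = fromZip g f (Inverse.inverse⇛ (ctx-ok Δ) (zipᵗ α))

  ℭ-locallyGroupoidal : LocallyGroupoidal ℭ
  ℭ-locallyGroupoidal = record
    { _⁻¹ = _⁻¹ᵗ
    ; inverseˡ = λ {_} {Δ} α → zip⇒≈ᵗ (Inverse.compose-inverseˡ (ctx-ok Δ) (zipᵗ α))
    ; inverseʳ = λ {_} {Δ} α → zip⇒≈ᵗ (Inverse.compose-inverseʳ (ctx-ok Δ) (zipᵗ α)) }

-- Paths in an extended context.

module PathsOfExtensions (S : TypeTheory) where
  open TypeTheory S
  open Congruence S

  -- Written as the tail of `idₛ`, so that the components of the identity substitution can be read
  -- off by `unzip` without rewriting.
  wkₜ : ∀ n → Sub (3 + n) n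
  wkₜ n = tabulate (λ i → var (suc (suc (suc i))))

  wkₜ-∷ : ∀ {m n} (q y′ y : Tm m) (u : Sub m n) → wkₜ n ⊚ (q ∷ y′ ∷ y ∷ u) ≡ u
  wkₜ-∷ q y′ y u = trans (tabulate-⊚ (λ i → suc (suc (suc i))) (q ∷ y′ ∷ y ∷ u)) (tabulate∘lookup u)

  module Fibre {n} {Λ : Ctx n} (v : ⊢ Λ) {D} (D∶ : Λ ⊢ D type) where
    open Step (pathFacts v) D∶ public
    open PathFacts (pathFacts v)

    tr : ∀ {m} → Tm m → Sub m (tri n) → Tm m
    tr y′ u = transport Λ D [ y′ ∷ u ]

    record Components {m} (Γ : Ctx m) (q y′ y : Tm m) (u : Sub m (tri n)) : Set where
      constructor components
      field
        base∶ : Γ ⊢ u ⇛ Path Λ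
        src-∶ : Γ ⊢ y ∶ D [ src n ⊚ u ]ᵀ
        tgt-∶ : Γ ⊢ y′ ∶ D [ tgt n ⊚ u ]ᵀ
        path∶ : Γ ⊢ q ∶ Id (D [ src n ⊚ u ]ᵀ) y (tr y′ u)
    open Components public

    unzip : ∀ {m} {Γ : Ctx m} {q y′ y u} → Γ ⊢ q ∷ y′ ∷ y ∷ u ⇛ Path (Λ ▹ D) → Components Γ q y′ y u
    unzip (ext (ext (ext u _ y) _ y′) _ q) =
      components u (y ∶≡ [⊚]ᵀ D _ _) (y′ ∶≡ trans ([]-[]ᵀ _ (wk-∷ _ _)) ([⊚]ᵀ D _ _)) (q ∶≡ Id-type-at _ _ _)

    zip∶-≐ : ∀ {m} {Γ : Ctx m} {u y y′ q u₁ y₁ y′₁ q₁} → Γ ⊢ u ≐ u₁ ⇛ Path Λ → Γ ⊢ y ≐ y₁ ∶ D [ src n ⊚ u ]ᵀ →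
             Γ ⊢ y′ ≐ y′₁ ∶ D [ tgt n ⊚ u ]ᵀ → Γ ⊢ q ≐ q₁ ∶ Id (D [ src n ⊚ u ]ᵀ) y (tr y′ u) →
             Γ ⊢ q ∷ y′ ∷ y ∷ u ≐ q₁ ∷ y′₁ ∷ y₁ ∷ u₁ ⇛ Path (Λ ▹ D)
    zip∶-≐ u y y′ q =
      ext (ext (ext u Ds∶ (y ≐≡ sym ([⊚]ᵀ D _ _))) (wk-type Ds∶ Dt∶) (y′ ≐≡ sym (trans ([]-[]ᵀ _ (wk-∷ _ _)) ([⊚]ᵀ D _ _))))
          Id-type∶ (q ≐≡ sym (Id-type-at _ _ _))

    base-≐ : ∀ {m} {Γ : Ctx m} {q y′ y u u₁} → Γ ⊢ q ∷ y′ ∷ y ∷ u ⇛ Path (Λ ▹ D) → Γ ⊢ u ≐ u₁ ⇛ Path Λ →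
             Γ ⊢ q ∷ y′ ∷ y ∷ u ≐ q ∷ y′ ∷ y ∷ u₁ ⇛ Path (Λ ▹ D)
    base-≐ t e = zip∶-≐ e (≐-refl (src-∶ cs)) (≐-refl (tgt-∶ cs)) (≐-refl (path∶ cs))
      where cs = unzip t

    src-type-rfl : ∀ {m} (σ : Sub m n) → D [ src n ⊚ (rfl Λ ⊚ σ) ]ᵀ ≡ D [ σ ]ᵀ
    src-type-rfl σ = cong (D [_]ᵀ) (trans (sym (⊚-assoc _ _ _)) (trans (cong (_⊚ σ) (src-rfl Λ)) (id-⊚ σ)))

    tgt-type-rfl : ∀ {m} (σ : Sub m n) → D [ tgt n ⊚ (rfl Λ ⊚ σ) ]ᵀ ≡ D [ σ ]ᵀ
    tgt-type-rfl σ = cong (D [_]ᵀ) (trans (sym (⊚-assoc _ _ _)) (trans (cong (_⊚ σ) (tgt-rfl Λ)) (id-⊚ σ)))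

    tr-≐ : ∀ {m} {Γ : Ctx m} {u u₁ a a₁} → Γ ⊢ u ≐ u₁ ⇛ Path Λ → Γ ⊢ a ≐ a₁ ∶ D [ tgt n ⊚ u ]ᵀ →
           Γ ⊢ tr a u ≐ tr a₁ u₁ ∶ D [ src n ⊚ u ]ᵀ
    tr-≐ u a = subst-term-≐ (ext u Dt∶ (a ≐≡ sym ([⊚]ᵀ D _ _))) (≐-refl transport∶) ≐≡ trans ([]-[]ᵀ _ (wk-∷ _ _)) ([⊚]ᵀ D _ _)

    -- Paths in a fibre: those over reflexivity, where transport is the identity.

    Id-vertical : ∀ {m} {Γ : Ctx m} {σ y y′} → Γ ⊢ σ ⇛ Λ → Γ ⊢ y ∶ D [ σ ]ᵀ → Γ ⊢ y′ ∶ D [ σ ]ᵀ →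
                  Γ ⊢ Id (D [ src n ⊚ (rfl Λ ⊚ σ) ]ᵀ) y (tr y′ (rfl Λ ⊚ σ)) ≐ Id (D [ σ ]ᵀ) y y′ type
    Id-vertical {σ = σ} s y y′ = teq≡ (Id≡ (sym (src-type-rfl σ)) refl refl) refl
      (Id-cong (≐ᵀ-refl (type-of y)) (≐-refl y) (transport-rfl s y′))

    vertical⇛ : ∀ {m} {Γ : Ctx m} {σ q y y′} → Γ ⊢ σ ⇛ Λ → Γ ⊢ y ∶ D [ σ ]ᵀ → Γ ⊢ y′ ∶ D [ σ ]ᵀ →
                Γ ⊢ q ∶ Id (D [ σ ]ᵀ) y y′ → Γ ⊢ q ∷ y′ ∷ y ∷ rfl Λ ⊚ σ ⇛ Path (Λ ▹ D)
    vertical⇛ {σ = σ} s y y′ q = zip∶ (⇛-comp rfl∶ s) (y ∶≡ sym (src-type-rfl σ)) (y′ ∶≡ sym (tgt-type-rfl σ))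
      (conv q (≐ᵀ-sym (Id-vertical s y y′)))

    vertical-≐ : ∀ {m} {Γ : Ctx m} {σ q q₁ y y₁ y′ y′₁} → Γ ⊢ σ ⇛ Λ → Γ ⊢ y ≐ y₁ ∶ D [ σ ]ᵀ → Γ ⊢ y′ ≐ y′₁ ∶ D [ σ ]ᵀ →
                 Γ ⊢ q ≐ q₁ ∶ Id (D [ σ ]ᵀ) y y′ → Γ ⊢ q ∷ y′ ∷ y ∷ rfl Λ ⊚ σ ≐ q₁ ∷ y′₁ ∷ y₁ ∷ rfl Λ ⊚ σ ⇛ Path (Λ ▹ D)
    vertical-≐ {σ = σ} s y y′ q = zip∶-≐ (⇛-refl (⇛-comp rfl∶ s)) (y ≐≡ sym (src-type-rfl σ)) (y′ ≐≡ sym (tgt-type-rfl σ))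
      (conv-≐ q (≐ᵀ-sym (Id-vertical s (left-term y) (left-term y′))))

    vertical-path-≐ : ∀ {m} {Γ : Ctx m} {σ q q₁ y y₁ y′ y′₁} → Γ ⊢ σ ⇛ Λ → Γ ⊢ y ∶ D [ σ ]ᵀ → Γ ⊢ y′ ∶ D [ σ ]ᵀ →
                      Γ ⊢ q ∷ y′ ∷ y ∷ rfl Λ ⊚ σ ≐ q₁ ∷ y′₁ ∷ y₁ ∷ rfl Λ ⊚ σ ⇛ Path (Λ ▹ D) → Γ ⊢ q ≐ q₁ ∶ Id (D [ σ ]ᵀ) y y′
    vertical-path-≐ s y y′ (ext _ _ q) = conv-≐ (q ≐≡ Id-type-at _ _ _) (Id-vertical s y y′)

    -- The end points agree, and at reflexivity both sides give `rfl Λ ⊚ wk`. This is what turns the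
    -- commutation condition on 2-cells into an equation for the base part of the top cell.
    ap-wk : Path (Λ ▹ D) ⊢ Apᵖ (Λ ▹ D) Λ wk ≐ wkₜ (tri n) ⇛ Path Λ
    ap-wk = unique-path (v ▹ D∶) v (Apᵖ (Λ ▹ D) Λ wk) (wkₜ (tri n)) (Ap.ap⇛ (v ▹ D∶) (wk⇛ D∶)) base⇛
      (≡⇒≐ (trans (src-Apᵖ (Λ ▹ D) Λ wk) (trans (wk-∷ _ _) (wk³≡ (src n)))) (⇛-comp src∶ (Ap.ap⇛ (v ▹ D∶) (wk⇛ D∶))))
      (≡⇒≐ (trans (tgt-Apᵖ (Λ ▹ D) Λ wk) (trans (wk-∷ _ _) (wk³≡ (tgt n)))) (⇛-comp tgt∶ (Ap.ap⇛ (v ▹ D∶) (wk⇛ D∶))))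
      (⇛≐≡ refl (trans (sym (wkₜ-∷ _ _ _ _)) (cong (wkₜ (tri n) ⊚_) (sym (rfl-▹ Λ D)))) (Ap.ap-rfl (v ▹ D∶) (wk⇛ D∶)))
      where
      base⇛ : Path (Λ ▹ D) ⊢ wkₜ (tri n) ⇛ Path Λ
      base⇛ = base∶ (unzip (id⇛ Path-wf′))
      wk³≡ : ∀ {k} (a : Sub (tri n) k) → a ⊚ wk ⊚ wk ⊚ wk ≡ a ⊚ wkₜ (tri n)
      wk³≡ a = trans (cong (λ b → b ⊚ wk ⊚ wk ⊚ wk) (sym (⊚-id a)))
        (trans (cong (λ b → b ⊚ wk ⊚ wk) (⊚-assoc a idₛ wk)) (trans (cong (_⊚ wk) (⊚-assoc a _ wk))
          (trans (⊚-assoc a _ wk) (cong (a ⊚_) (id-⊚wk³ (tri n))))))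

    ap-wk-∷ : ∀ {m} {Γ : Ctx m} {q y′ y u} → Γ ⊢ q ∷ y′ ∷ y ∷ u ⇛ Path (Λ ▹ D) →
              Γ ⊢ Apᵖ (Λ ▹ D) Λ wk ⊚ (q ∷ y′ ∷ y ∷ u) ≐ u ⇛ Path Λ
    ap-wk-∷ t = ⇛≐≡ refl (wkₜ-∷ _ _ _ _) (⇛-comp-≐ ap-wk (⇛-refl t))

  -- The action of ↑ f on paths is the identity on the paths in a fibre.  A path (p, q) of Λ.B[f] is
  -- straightened to the path in the fibre over its source from which q was obtained by transport;
  -- both sides, composed with this operation, are determined by their values at reflexivity.

  module ApLift {m n} {Λ : Ctx m} {Ψ : Ctx n} {B} (B∶ : Ψ ⊢ B type) {f} (f∶ : Λ ⊢ f ⇛ Ψ) where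
    private
      v = dom f∶
      w = cod f∶
      D = B [ f ]ᵀ
      D∶ = subst-type f∶ B∶
      module Λ where
        open PathFacts (pathFacts v) public
        open Fibre v D∶ public
      module Ψ where
        open PathFacts (pathFacts w) public
        open Fibre w B∶ public

      -- The type of `q` over `u` is already that of a path in the fibre over the source, so `q` is
      -- kept and only `y′` is transported. The parameter `a` is reflexivity at the source, taken in
      -- Λ or, after applying `f`, in Ψ.
      straighten : ∀ {k l} → Sub (tri m) k → Tm l → Tm l → Tm l → Sub l (tri m) → Sub l (3 + k)
      straighten a q y′ y u = q ∷ Λ.tr y′ u ∷ y ∷ a ⊚ u

      straighten-⊚ : ∀ {k l j} (a : Sub (tri m) k) (q y′ y : Tm l) (u : Sub l (tri m)) (ρ : Sub j l) →
                     straighten a q y′ y u ⊚ ρ ≡ straighten a (q [ ρ ]) (y′ [ ρ ]) (y [ ρ ]) (u ⊚ ρ)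
      straighten-⊚ a q y′ y u ρ = cong₂ (λ t b → q [ ρ ] ∷ t ∷ y [ ρ ] ∷ b) ([⊚] _ _ _) (⊚-assoc a u ρ)

      generic : ∀ {k} → Sub (tri m) k → Sub (3 + tri m) (3 + k)
      generic a = straighten a (var zero) (var (suc zero)) (var (suc (suc zero))) (wkₜ (tri m))

      generic-⊚ : ∀ {k l} (a : Sub (tri m) k) (q y′ y : Tm l) (u : Sub l (tri m)) →
                  generic a ⊚ (q ∷ y′ ∷ y ∷ u) ≡ straighten a q y′ y u
      generic-⊚ a q y′ y u = trans (straighten-⊚ a _ _ _ _ _)
        (cong₄ (straighten a) (var-[] _ _) (var-[] _ _) (var-[] _ _) (wkₜ-∷ q y′ y u))
        where
        cong₄ : ∀ {A B C : Set} (F : A → A → A → B → C) {x x′ y y′ z z′ w w′} →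
                x ≡ x′ → y ≡ y′ → z ≡ z′ → w ≡ w′ → F x y z w ≡ F x′ y′ z′ w′
        cong₄ F refl refl refl refl = refl

      rflΛ : Sub (tri m) (tri m)
      rflΛ = rfl Λ ⊚ src m

      rflΨ : Sub (tri m) (tri n)
      rflΨ = rfl Ψ ⊚ (f ⊚ src m)

      src-rfl-⊚ : ∀ {l} (σ : Sub l m) → src m ⊚ (rfl Λ ⊚ σ) ≡ σ
      src-rfl-⊚ σ = trans (sym (⊚-assoc _ _ _)) (trans (cong (_⊚ σ) (src-rfl Λ)) (id-⊚ σ))

      rflΛ≡ : ∀ {l} (σ : Sub l m) → rflΛ ⊚ (rfl Λ ⊚ σ) ≡ rfl Λ ⊚ σ
      rflΛ≡ σ = ⊚≡ (rfl Λ) (src-rfl-⊚ σ)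

      rflΨ≡ : ∀ {l} (σ : Sub l m) → rflΨ ⊚ (rfl Λ ⊚ σ) ≡ rfl Ψ ⊚ (f ⊚ σ)
      rflΨ≡ σ = ⊚≡ (rfl Ψ) (⊚≡ f (src-rfl-⊚ σ))

      B≡ : ∀ {l} (σ : Sub l m) → D [ σ ]ᵀ ≡ B [ f ⊚ σ ]ᵀ
      B≡ σ = [⊚]ᵀ B f σ

      module _ {l} {Γ : Ctx l} {σ q y y′} (s : Γ ⊢ σ ⇛ Λ) (y∶ : Γ ⊢ y ∶ D [ σ ]ᵀ) (y′∶ : Γ ⊢ y′ ∶ D [ σ ]ᵀ)
               (q∶ : Γ ⊢ q ∶ Id (D [ σ ]ᵀ) y y′) where
        private
          tr≐ : Γ ⊢ y′ ≐ Λ.tr y′ (rfl Λ ⊚ σ) ∶ D [ σ ]ᵀ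
          tr≐ = ≐-sym (Λ.transport-rfl s y′∶)

        -- On a path over reflexivity straightening only transports `y′` along reflexivity, which
        -- changes nothing definitionally.
        straighten-Λ : Γ ⊢ q ∷ y′ ∷ y ∷ rfl Λ ⊚ σ ≐ generic rflΛ ⊚ (q ∷ y′ ∷ y ∷ rfl Λ ⊚ σ) ⇛ Path (Λ ▹ D)
        straighten-Λ = ⇛≐≡ refl (sym (trans (generic-⊚ rflΛ _ _ _ _) (cong (λ u → q ∷ Λ.tr y′ (rfl Λ ⊚ σ) ∷ y ∷ u) (rflΛ≡ σ))))
          (Λ.vertical-≐ s (≐-refl y∶) tr≐ (≐-refl q∶))

        straighten-Ψ : Γ ⊢ q ∷ y′ ∷ y ∷ rfl Ψ ⊚ (f ⊚ σ) ≐ generic rflΨ ⊚ (q ∷ y′ ∷ y ∷ rfl Λ ⊚ σ) ⇛ Path (Ψ ▹ B)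
        straighten-Ψ = ⇛≐≡ refl (sym (trans (generic-⊚ rflΨ _ _ _ _) (cong (λ u → q ∷ Λ.tr y′ (rfl Λ ⊚ σ) ∷ y ∷ u) (rflΨ≡ σ))))
          (Ψ.vertical-≐ (⇛-comp f∶ s) (≐-refl y∶ ≐≡ B≡ σ) (tr≐ ≐≡ B≡ σ) (≐-refl q∶ ≐≡ Id≡ (B≡ σ) refl refl))

      vars : Λ.Components (Path (Λ ▹ D)) (var zero) (var (suc zero)) (var (suc (suc zero))) (wkₜ (tri m))
      vars = Λ.unzip (id⇛ Λ.Path-wf′)

      σ₀ : Sub (3 + tri m) m
      σ₀ = src m ⊚ wkₜ (tri m)

      σ₀∶ : Path (Λ ▹ D) ⊢ σ₀ ⇛ Λ
      σ₀∶ = ⇛-comp Λ.src∶ (Λ.base∶ vars)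

      tr∶ : Path (Λ ▹ D) ⊢ Λ.tr (var (suc zero)) (wkₜ (tri m)) ∶ D [ σ₀ ]ᵀ
      tr∶ = Λ.transport-at (Λ.base∶ vars) (Λ.tgt-∶ vars)

      generic-Λ⇛ : Path (Λ ▹ D) ⊢ generic rflΛ ⇛ Path (Λ ▹ D)
      generic-Λ⇛ = ⇛≡ (cong (λ u → var zero ∷ Λ.tr (var (suc zero)) (wkₜ (tri m)) ∷ var (suc (suc zero)) ∷ u) (sym (⊚-assoc _ _ _))) (Λ.vertical⇛ σ₀∶ (Λ.src-∶ vars) tr∶ (Λ.path∶ vars))

      generic-Ψ⇛ : Path (Λ ▹ D) ⊢ generic rflΨ ⇛ Path (Ψ ▹ B)
      generic-Ψ⇛ = ⇛≡ (cong (λ u → var zero ∷ Λ.tr (var (suc zero)) (wkₜ (tri m)) ∷ var (suc (suc zero)) ∷ u) (trans (cong (rfl Ψ ⊚_) (sym (⊚-assoc _ _ _))) (sym (⊚-assoc _ _ _))))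
        (Ψ.vertical⇛ (⇛-comp f∶ σ₀∶) (Λ.src-∶ vars ∶≡ B≡ σ₀) (tr∶ ∶≡ B≡ σ₀) (Λ.path∶ vars ∶≡ Id≡ (B≡ σ₀) refl refl))

      Ap↑ = Apᵖ (Λ ▹ D) (Ψ ▹ B) (↑ f)
      ↑∶ : Λ ▹ D ⊢ ↑ f ⇛ Ψ ▹ B
      ↑∶ = ↑⇛ f∶ B∶
      Ap↑⇛ : Path (Λ ▹ D) ⊢ Ap↑ ⇛ Path (Ψ ▹ B)
      Ap↑⇛ = Ap.ap⇛ (v ▹ D∶) ↑∶

      -- After straightening the base path is a reflexivity, so `src` and `tgt` give the same point;
      -- one argument covers both.
      ends : ∀ {a : Sub (tri m) m} {b : Sub (tri n) n} → a ⊚ rfl Λ ≡ idₛ → b ⊚ rfl Ψ ≡ idₛ →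
             f ⊚ (a ⊚ wk ⊚ wk ⊚ wk ⊚ generic rflΛ) ≡ b ⊚ wk ⊚ wk ⊚ wk ⊚ generic rflΨ
      ends {a} {b} eq eq′ = trans (cong (f ⊚_) (end a eq)) (sym (trans (end b eq′) (⊚-assoc f (src m) _)))
        where
        end : ∀ {k} {Φ : Ctx k} (a : Sub (tri k) k) {g : Sub (tri m) k} → a ⊚ rfl Φ ≡ idₛ →
              a ⊚ wk ⊚ wk ⊚ wk ⊚ generic (rfl Φ ⊚ g) ≡ g ⊚ wkₜ (tri m)
        end {Φ = Φ} a {g} eq = trans (⊚wk³ a _ _ _ _) (trans (sym (⊚-assoc a _ _))
          (cong (_⊚ wkₜ (tri m)) (trans (sym (⊚-assoc a (rfl Φ) g)) (trans (cong (_⊚ g) eq) (id-⊚ g)))))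

      -- At reflexivity straightening has no effect and `Ap↑` returns reflexivity, so both sides
      -- reduce to `rfl (Ψ ▹ B) ⊚ ↑ f`.
      agree : Path (Λ ▹ D) ⊢ Ap↑ ⊚ generic rflΛ ≐ generic rflΨ ⇛ Path (Ψ ▹ B)
      agree = unique-path (v ▹ D∶) (w ▹ B∶) (Ap↑ ⊚ generic rflΛ) (generic rflΨ) L∶ generic-Ψ⇛
        (≡⇒≐ src≡ (⇛-comp (PathFacts.src∶ (pathFacts (w ▹ B∶))) L∶))
        (≡⇒≐ tgt≡ (⇛-comp (PathFacts.tgt∶ (pathFacts (w ▹ B∶))) L∶))
        (⇛-trans (⇛≐≡ (sym (⊚-assoc _ _ _)) refl (⇛-comp-≐ (⇛-refl Ap↑⇛) (⇛-sym at-Λ)))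
          (⇛-trans (Ap.ap-rfl (v ▹ D∶) ↑∶) at-Ψ))
        where
        L∶ = ⇛-comp Ap↑⇛ generic-Λ⇛
        src≡ : src (suc n) ⊚ (Ap↑ ⊚ generic rflΛ) ≡ src (suc n) ⊚ generic rflΨ
        src≡ = trans (sym (⊚-assoc _ _ _)) (trans (cong (_⊚ generic rflΛ) (src-Apᵖ (Λ ▹ D) (Ψ ▹ B) (↑ f)))
          (trans (⊚-assoc _ _ _) (trans (↑-∷ f _ _) (cong₂ _∷_ (trans (var-[] _ _) (sym (var-[] _ _))) (ends (src-rfl Λ) (src-rfl Ψ))))))
        tgt≡ : tgt (suc n) ⊚ (Ap↑ ⊚ generic rflΛ) ≡ tgt (suc n) ⊚ generic rflΨ
        tgt≡ = trans (sym (⊚-assoc _ _ _)) (trans (cong (_⊚ generic rflΛ) (tgt-Apᵖ (Λ ▹ D) (Ψ ▹ B) (↑ f)))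
          (trans (⊚-assoc _ _ _) (trans (↑-∷ f _ _) (cong₂ _∷_ (trans (var-[] _ _) (sym (var-[] _ _))) (ends (tgt-rfl Λ) (tgt-rfl Ψ))))))
        at-Λ : Λ ▹ D ⊢ rfl (Λ ▹ D) ≐ generic rflΛ ⊚ rfl (Λ ▹ D) ⇛ Path (Λ ▹ D)
        at-Λ = ⇛≐≡ (sym (rfl-▹ Λ D)) (cong (generic rflΛ ⊚_) (sym (rfl-▹ Λ D)))
          (straighten-Λ (wk⇛ D∶) (v₀∶ D∶) (v₀∶ D∶) (r-intro (v₀∶ D∶)))
        at-Ψ : Λ ▹ D ⊢ rfl (Ψ ▹ B) ⊚ ↑ f ≐ generic rflΨ ⊚ rfl (Λ ▹ D) ⇛ Path (Ψ ▹ B)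
        at-Ψ = ⇛≐≡ (trans (cong₂ (λ A u → r A (var zero) ∷ var zero ∷ var zero ∷ u) (B≡ wk) (rfl-⊚ Ψ (f ⊚ wk))) (sym (rfl-⊚ (Ψ ▹ B) (↑ f))))
          (cong (generic rflΨ ⊚_) (sym (rfl-▹ Λ D)))
          (straighten-Ψ (wk⇛ D∶) (v₀∶ D∶) (v₀∶ D∶) (r-intro (v₀∶ D∶)))

    ap-↑-vertical : ∀ {l} {Γ : Ctx l} {σ q y y′} → Γ ⊢ σ ⇛ Λ → Γ ⊢ y ∶ D [ σ ]ᵀ → Γ ⊢ y′ ∶ D [ σ ]ᵀ →
                    Γ ⊢ q ∶ Id (D [ σ ]ᵀ) y y′ →
                    Γ ⊢ Apᵖ (Λ ▹ D) (Ψ ▹ B) (↑ f) ⊚ (q ∷ y′ ∷ y ∷ rfl Λ ⊚ σ) ≐ q ∷ y′ ∷ y ∷ rfl Ψ ⊚ (f ⊚ σ) ⇛ Path (Ψ ▹ B)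
    ap-↑-vertical s y y′ q = ⇛-trans (⇛-comp-≐ (⇛-refl Ap↑⇛) (straighten-Λ s y y′ q))
      (⇛-trans (⇛≐≡ (⊚-assoc _ _ _) refl (⇛-comp-≐ agree (⇛-refl (Λ.vertical⇛ s y y′ q)))) (⇛-sym (straighten-Ψ s y y′ q)))

-- Lifting and factoring 2-cells between types in context.

module TypeTwoFibration (S : TypeTheory) where
  open TypeTheory S
  open Congruence S
  open ContextTwoCategory S
  open TypeTwoCategory S
  open TypeFibration S
  open Inverses S
  open PathsOfExtensions S
  open SquareTransformations squares using (square; equal; top₂; bot₂; commute; top₂-≈; top-▷; bot-▷)
  private
    module C = TwoCategory ℭ
    module T = TwoCategory 𝔗
  open TwoCells ℭ

  𝔗-locallyGroupoidal : LocallyGroupoidal 𝔗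
  𝔗-locallyGroupoidal = squares-locallyGroupoidal squares ℭ-locallyGroupoidal

  open Fibred p fibration 𝔗-locallyGroupoidal

  zipᵗ-≐ : ∀ {Γ Δ} {f g f′ g′ : Morphism Γ Δ} {α : Transformation f g} {β : Transformation f′ g′} → α ≈ᵗ β →
           ctx Γ ⊢ zip (terms f) (terms g) (paths α) ≐ zip (terms f′) (terms g′) (paths β) ⇛ Path (ctx Δ)
  zipᵗ-≐ (equal (equal _) (equal _) e₁ e₂ e) = to-zip e₁ e₂ e

  module _ {X Y : TypeInContext} where
    module Y = Fibre (ctx-ok (base Y)) (type-ok Y)

    below : ∀ {f g : TypeMorphism X Y} → Transformation (over f) (over g) → Sub (suc (length (base X))) (tri (length (base Y)))
    below {f} {g} α = zip (terms (over f) ⊚ wk) (terms (over g) ⊚ wk) (paths α ⊚ wk)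

    fibre : TypeMorphism X Y → Sub (suc (length (base X))) (length (base Y))
    fibre f = terms (over f) ⊚ wk

    fibre∶ : ∀ f → ctx (X ∙) ⊢ fibre f ⇛ ctx (base Y)
    fibre∶ f = ⇛-comp (terms-ok (over f)) (wk⇛ (type-ok X))

    module _ {f g : TypeMorphism X Y} where

      -- The base part of the top cell is prescribed to be the whiskering of `α` with the
      -- projection, so commutation is exactly `ap-wk-∷`.
      square-from : ∀ (α : Transformation (over f) (over g)) {q} →
                    ctx (X ∙) ⊢ q ∷ term g ∷ term f ∷ below {f} {g} α ⇛ Path (ctx (Y ∙)) → f T.⇒ g
      square-from α {q} t = square top α
        (zip⇒≈ᵗ (⇛≐≡ (Apᵖ-zip (ctx (Y ∙)) (ctx (base Y)) wk _ _ _) refl (Y.ap-wk-∷ (zipᵗ top))))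
        where
        top : Transformation (total f) (total g)
        top = fromZip (total f) (total g) {q ∷ paths α ⊚ wk} t

      private
        zip-head-tail : ∀ {l n} (a b : Tm l) (σ τ : Sub l n) (p : Sub l (suc n)) →
                        zip (a ∷ σ) (b ∷ τ) p ≡ head p ∷ b ∷ a ∷ zip σ τ (tail p)
        zip-head-tail a b σ τ (q ∷ p) = refl

      -- The component of the top 2-cell over the base is determined by the bottom 2-cell.

      top-≐ : (δ : f T.⇒ g) → ctx (X ∙) ⊢ zip (terms (total f)) (terms (total g)) (paths (top₂ δ)) ≐
                                head (paths (top₂ δ)) ∷ term g ∷ term f ∷ below {f} {g} (bot₂ δ) ⇛ Path (ctx (Y ∙))
      top-≐ δ = ⇛≐≡ (sym top≡) refl (Y.base-≐ t front)
        where
        u = zip (terms (over f) ⊚ wk) (terms (over g) ⊚ wk) (tail (paths (top₂ δ)))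
        top≡ : zip (terms (total f)) (terms (total g)) (paths (top₂ δ)) ≡ head (paths (top₂ δ)) ∷ term g ∷ term f ∷ u
        top≡ = zip-head-tail (term f) (term g) _ _ (paths (top₂ δ))
        t : ctx (X ∙) ⊢ head (paths (top₂ δ)) ∷ term g ∷ term f ∷ u ⇛ Path (ctx (Y ∙))
        t = ⇛≡ top≡ (zipᵗ (top₂ δ))
        front : ctx (X ∙) ⊢ u ≐ below {f} {g} (bot₂ δ) ⇛ Path (ctx (base Y))
        front = ⇛-trans (⇛-sym (Y.ap-wk-∷ t)) (⇛≐≡
          (trans (sym (Apᵖ-zip (ctx (Y ∙)) (ctx (base Y)) wk _ _ _)) (cong (Apᵖ (ctx (Y ∙)) (ctx (base Y)) wk ⊚_) top≡))
          refl (zipᵗ-≐ (commute δ)))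

      -- 2-cells over an identity are paths in a fibre.

      vertical : Tm (suc (length (base X))) → Sub (suc (length (base X))) (3 + tri (length (base Y)))
      vertical q = q ∷ term g ∷ term f ∷ rfl (ctx (base Y)) ⊚ fibre f

      below-≐ : (α : Transformation (over f) (over g)) → α ≈ᵗ idᵗ {f = over f} →
                ctx (X ∙) ⊢ below {f} {g} α ≐ rfl (ctx (base Y)) ⊚ fibre f ⇛ Path (ctx (base Y))
      below-≐ α e = ⇛≐≡ refl (sym (rfl-⊚ _ _)) (zipᵗ-≐ (C.◁-≈ e C.≈-refl ⟫ C.◁-id₂ (over f) (π X)))

      vertical-top-≐ : (δ : f T.⇒ g) → bot₂ δ ≈ᵗ idᵗ {f = over f} →
                       ctx (X ∙) ⊢ zip (terms (total f)) (terms (total g)) (paths (top₂ δ)) ≐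
                         vertical (head (paths (top₂ δ))) ⇛ Path (ctx (Y ∙))
      vertical-top-≐ δ e = ⇛-trans (top-≐ δ) (Y.base-≐ (⇛-right (top-≐ δ)) (below-≐ (bot₂ δ) e))

      module Vertical (e : over f ≈ᵐ over g) where

        right∶ : ctx (X ∙) ⊢ term g ∶ type Y [ fibre f ]ᵀ
        right∶ = conv (term-ok g) (wk-≐ (type-ok X) (type-ok Y) (⇛-sym (terms≐ e)))

        VerticalPath : Tm (suc (length (base X))) → Set
        VerticalPath q = ctx (X ∙) ⊢ q ∶ Id (type Y [ fibre f ]ᵀ) (term f) (term g)

        vertical-path∶ : ∀ {q} → ctx (X ∙) ⊢ vertical q ⇛ Path (ctx (Y ∙)) → VerticalPath q
        vertical-path∶ t = conv (Y.path∶ (Y.unzip t)) (Y.Id-vertical (fibre∶ f) (term-ok f) right∶)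

        vertical∶ : ∀ {q} → VerticalPath q → ctx (X ∙) ⊢ vertical q ⇛ Path (ctx (Y ∙))
        vertical∶ = Y.vertical⇛ (fibre∶ f) (term-ok f) right∶

        vertical-cong : ∀ {q q′} → ctx (X ∙) ⊢ q ≐ q′ ∶ Id (type Y [ fibre f ]ᵀ) (term f) (term g) →
                        ctx (X ∙) ⊢ vertical q ≐ vertical q′ ⇛ Path (ctx (Y ∙))
        vertical-cong = Y.vertical-≐ (fibre∶ f) (≐-refl (term-ok f)) (≐-refl right∶)

        vertical-injective : ∀ {q q′} → ctx (X ∙) ⊢ vertical q ≐ vertical q′ ⇛ Path (ctx (Y ∙)) →
                             ctx (X ∙) ⊢ q ≐ q′ ∶ Id (type Y [ fibre f ]ᵀ) (term f) (term g)
        vertical-injective = Y.vertical-path-≐ (fibre∶ f) (term-ok f) right∶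

        private
          id-cell : Transformation (over f) (over g)
          id-cell = castᵗ ≈ᵐ-refl e idᵗ
          id-cell≈ : id-cell ≈ᵗ idᵗ {f = over f}
          id-cell≈ = castᵗ-≈ ≈ᵐ-refl e idᵗ

        vertical-square : ∀ {q} → VerticalPath q → f T.⇒ g
        vertical-square q∶ = square-from id-cell (⇛-right (Y.base-≐ (vertical∶ q∶) (⇛-sym (below-≐ id-cell id-cell≈))))

        vertical-square-over : ∀ {q} (q∶ : VerticalPath q) → bot₂ (vertical-square q∶) ≈ᵗ idᵗ {f = over f}
        vertical-square-over q∶ = id-cell≈

  module OverLift {Γ} {X} (Y : TypeInContext) (f : Morphism Γ (base Y)) {g g′ : TypeMorphism X (reindex Y f)}
           (e : over g ≈ᵐ over g′) where
    c = chosenLift Y f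

    module c∘g = Vertical {f = c ∘ᵀ g} {c ∘ᵀ g′} (C.∘-≈ (C.≈-refl {f = f}) e)
    module g = Vertical {f = g} {g′} e

    -- The total map of `c` is `↑ (terms f)`, so `ap-↑-vertical` applies: whiskering with `c` keeps
    -- the path in the fibre. Both existence and uniqueness of vertical factors rest on this.
    ▷-vertical : (δ : g T.⇒ g′) → bot₂ δ ≈ᵗ idᵗ {f = over g} →
                 ctx (X ∙) ⊢ zip (terms (total (c ∘ᵀ g))) (terms (total (c ∘ᵀ g′))) (paths (top₂ (c T.▷ δ))) ≐
                   vertical {f = c ∘ᵀ g} {c ∘ᵀ g′} (head (paths (top₂ δ))) ⇛ Path (ctx (Y ∙))
    ▷-vertical δ e₂ = ⇛-trans (zipᵗ-≐ (top-▷ c δ))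
      (⇛≐≡ (Apᵖ-zip Λ Ψ (↑ (terms f)) (terms (total g)) (terms (total g′)) (paths (top₂ δ))) vertical≡ (⇛-trans ap-top ap-vertical))
      where
      Λ = ctx (reindex Y f ∙)
      Ψ = ctx (Y ∙)
      Ap↑ = Apᵖ Λ Ψ (↑ (terms f))
      q = head (paths (top₂ δ))
      straight = q ∷ term g′ ∷ term g ∷ rfl (ctx (base Y)) ⊚ (terms f ⊚ fibre g)
      ap-top : ctx (X ∙) ⊢ Ap↑ ⊚ zip (terms (total g)) (terms (total g′)) (paths (top₂ δ)) ≐ Ap↑ ⊚ vertical {f = g} {g′} q ⇛ Path Ψ
      ap-top = ⇛-comp-≐ (⇛-refl (Ap.ap⇛ (ctx-ok (reindex Y f ∙)) (terms-ok (total c)))) (vertical-top-≐ δ e₂)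
      ap-vertical : ctx (X ∙) ⊢ Ap↑ ⊚ vertical {f = g} {g′} q ≐ straight ⇛ Path Ψ
      ap-vertical = ApLift.ap-↑-vertical (type-ok Y) (terms-ok f) (fibre∶ g) (term-ok g) g.right∶
        (g.vertical-path∶ (⇛-right (vertical-top-≐ δ e₂)))
      vertical≡ : straight ≡ vertical {f = c ∘ᵀ g} {c ∘ᵀ g′} q
      vertical≡ = trans (cong₂ (λ a b → q ∷ a ∷ b ∷ rfl (ctx (base Y)) ⊚ (terms f ⊚ fibre g))
          (sym (term-lift-∘ Y f g′)) (sym (term-lift-∘ Y f g)))
        (cong (λ u → q ∷ term (c ∘ᵀ g′) ∷ term (c ∘ᵀ g) ∷ rfl (ctx (base Y)) ⊚ u) (sym (⊚-assoc (terms f) (terms (over g)) wk)))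

  module Lift {X Y} (h : TypeMorphism X Y) {k : Morphism (base X) (base Y)} (γ : Transformation k (over h)) where
    module B = Fibre (ctx-ok (base Y)) (type-ok Y)

    u = zip (terms k ⊚ wk) (terms (over h) ⊚ wk) (paths γ ⊚ wk)

    u∶ : ctx (X ∙) ⊢ u ⇛ Path (ctx (base Y))
    u∶ = zipᵗ (γ ◁ᵗ π X)

    B[src] : type Y [ src _ ⊚ u ]ᵀ ≡ type Y [ terms k ⊚ wk ]ᵀ
    B[src] = cong (type Y [_]ᵀ) (src-zip _ _ _)

    B[tgt] : type Y [ tgt _ ⊚ u ]ᵀ ≡ type Y [ terms (over h) ⊚ wk ]ᵀ
    B[tgt] = cong (type Y [_]ᵀ) (tgt-zip (terms k ⊚ wk) _ _)

    h∶ : ctx (X ∙) ⊢ term h ∶ type Y [ tgt _ ⊚ u ]ᵀ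
    h∶ = term-ok h ∶≡ sym B[tgt]

    tr∶ : ctx (X ∙) ⊢ B.tr (term h) u ∶ type Y [ src _ ⊚ u ]ᵀ
    tr∶ = B.transport-at u∶ h∶

    -- Transport along `γ` runs from the fibre over its target to the fibre over its source. With
    -- this term as source, the path component of the lift must join the transported term to itself.
    source : TypeMorphism X Y
    source = typeMorphism k (B.tr (term h) u) (tr∶ ∶≡ B[src])

    cell : source T.⇒ h
    cell = square-from γ (B.zip∶ u∶ tr∶ h∶ (r-intro tr∶))

  Lift-≈ : ∀ {X Y} {h h′ : TypeMorphism X Y} {k k′ : Morphism (base X) (base Y)}
           {γ : Transformation k (over h)} {γ′ : Transformation k′ (over h′)} →
           h ≈ᵀ h′ → γ ≈ᵗ γ′ → Lift.cell h γ T.≈₂ Lift.cell h′ γ′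
  Lift-≈ {X} {Y} {h} {h′} {γ = γ} {γ′} e e₂ = equal (zip⇒≈ᵗ (L.B.zip∶-≐ u≐ tr≐ h≐
      (r-cong (subst-type-≐ (⇛-comp-≐ (⇛-refl (PathFacts.src∶ (pathFacts (cod (terms-ok (over h)))))) u≐) (≐ᵀ-refl (type-ok Y))) tr≐))) e₂
    where
    module L = Lift h γ
    u≐ = zipᵗ-≐ (C.◁-≈ e₂ (C.≈-refl {f = π X}))
    h≐ = term≐ e ≐≡ sym L.B[tgt]
    tr≐ = L.B.tr-≐ u≐ h≐

  localStructure : LocalStructure
  localStructure .LocalStructure.homFibration X Y = record
    { pullback = λ h γ → Lift.source h γ ; lift = λ h γ → Lift.cell h γ
    ; lift-over = λ h γ → C.≈₂-refl
    ; lift-cartesian = λ h γ → invertible-cartesian (Lift.cell h γ)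
    ; lift-≈ = Lift-≈ }
  localStructure .LocalStructure.vertical {X} {Y} f {g} {g′} δ e e₂ = δ′ ,
    equal (zip⇒≈ᵗ (⇛-trans (vertical-top-≐ δ e₂) (⇛-sym (▷-vertical δ′ δ′-over))))
          (e₂ ⟫ C.≈₂-sym (bot-▷ c δ′ ⟫ ▷-cong f δ′-over ⟫ C.▷-id₂ f (over g))) ,
    δ′-over ,
    -- Whiskering with `c` keeps the fibre path of `δ″`, so that path equals the one of `δ`, from
    -- which `δ′` was built; the base parts are fixed by the bottom cells.
    λ δ″ e₁ e₃ → equal (zip⇒≈ᵗ (⇛-trans (vertical-top-≐ δ″ e₃) (⇛-trans
      (g.vertical-cong (to-fibre-≐ (c∘g.vertical-injective (⇛-trans (⇛-sym (▷-vertical δ″ e₃))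
        (⇛-trans (⇛-sym (zipᵗ-≐ (top₂-≈ e₁))) (vertical-top-≐ δ e₂))))))
      (⇛-sym (vertical-top-≐ δ′ δ′-over))))) (e₃ ⟫ C.≈₂-sym δ′-over)
    where
    open OverLift Y f e
    B≡ : type Y [ fibre (c ∘ᵀ g) ]ᵀ ≡ type Y [ terms f ]ᵀ [ fibre g ]ᵀ
    B≡ = sym ([]-[]ᵀ (type Y) (sym (⊚-assoc _ _ _)))
    -- An equation of raw types: a path in a fibre of `Y` is literally one in the fibre of the
    -- reindexed type, so the path of `δ` serves for `δ′`.
    Id-fibre≡ : Id (type Y [ fibre (c ∘ᵀ g) ]ᵀ) (term (c ∘ᵀ g)) (term (c ∘ᵀ g′)) ≡
                Id (type Y [ terms f ]ᵀ [ fibre g ]ᵀ) (term g) (term g′)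
    Id-fibre≡ = Id≡ B≡ (term-lift-∘ Y f g) (term-lift-∘ Y f g′)
    to-fibre-≐ : ∀ {q q′} → ctx (X ∙) ⊢ q ≐ q′ ∶ Id (type Y [ fibre (c ∘ᵀ g) ]ᵀ) (term (c ∘ᵀ g)) (term (c ∘ᵀ g′)) →
                 ctx (X ∙) ⊢ q ≐ q′ ∶ Id (type Y [ terms f ]ᵀ [ fibre g ]ᵀ) (term g) (term g′)
    to-fibre-≐ t = t ≐≡ Id-fibre≡
    δ-path : g.VerticalPath (head (paths (top₂ δ)))
    δ-path = c∘g.vertical-path∶ (⇛-right (vertical-top-≐ δ e₂)) ∶≡ Id-fibre≡
    δ′ = g.vertical-square δ-path
    δ′-over : bot₂ δ′ ≈ᵗ idᵗ {f = over g}
    δ′-over = g.vertical-square-over δ-path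

  globallySplit2Fibration : GloballySplit2Fibration p
  globallySplit2Fibration = record { cloven2Fibration = cloven2Fibration localStructure ; split = fibration-split }

proposition3p4p9 : (S : TypeTheory) → let open TypeTwoCategory S in let open ContextTwoCategory S in
    Σ[ F ∈ GloballySplit2Fibration p ]
    (∀ {Γ : Context} (Y : TypeInContext) (f : Morphism Γ (base Y)) →
    TwoCategory._≈_ 𝔗 (GloballySplit2Fibration.lift F Y f) (chosenLift Y f))
proposition3p4p9 S = TypeTwoFibration.globallySplit2Fibration S , λ Y f →
  TwoCategory.≈-refl (TypeTwoCategory.𝔗 S) {f = TypeTwoCategory.chosenLift S Y f}
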